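{- There is an absolute constant $K>0$ such that for every $n\ge 1$, every $f:\{0,1\}^n\to\{0,1\}$, every $\epsilon\in[0,\tfrac18]$ and every product distribution $\mu$ on $\{0,1\}^n$, $$D^{\mu}_{8\epsilon}(f)\le K\cdot \mathrm{prt}_\epsilon(f)^2\cdot\log(1/\epsilon),$$ where for $\epsilon=0$ the right-hand side is read as $+\infty$.
   Context: Let $f:\{0,1\}^n\to\{0,1\}$ and $[n]=\{1,\dots,n\}$; logarithms are base 2. Distributional query complexity: for a probability distribution $\mu$ on $\{0,1\}^n$ and $\delta\ge 0$, $D^\mu_\delta(f)$ is the minimum, over deterministic query algorithms (decision trees) $\mathcal A$ with $\Pr_{x\sim\mu}[\mathcal A(x)=f(x)]\ge 1-\delta$, of the worst-case (over inputs $x$) number of queried bits of $x$. A product distribution on $\{0,1\}^n$ is a distribution of the form $\mu(x)=\prod_{i\in[n]}\mu_i(x_i)$ with $\mu_i:\{0,1\}\to[0,1]$, $\mu_i(0)+\mu_i(1)=1$. Assignments: an assignment is a map $A:[n]\to\{0,1,*\}$, identified with the subcube $\{x: \forall i,\ x_i=A(i)\text{ or }A(i)=*\}$; $|A|=|\{i:A(i)\ne *\}|$ is its co-dimension. Partition bound: $\mathrm{prt}_\epsilon(f)$ is the (base 2) logarithm of the optimal value of the linear program in variables $w_{z,A}$ ($z\in\{0,1\}$, $A$ ranging over assignments): minimize $\sum_{z,A}w_{z,A}2^{|A|}$ subject to $\sum_{A\ni x}w_{f(x),A}\ge 1-\epsilon$ for all $x\in\{0,1\}^n$; $\sum_{z}\sum_{A\ni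 x}w_{z,A}=1$ for all $x\in\{0,1\}^n$; and $w_{z,A}\ge 0$ for all $z,A$. -}

module Defs where

open import Data.Bool using (Bool; true; false)
import Data.Bool.Properties as Bool
open import Data.Fin using (Fin)
import Data.Fin.Properties as Fin
open import Data.Integer as ℤ using (ℤ; +_)
import Data.Integer.Properties as ℤ
import Data.Integer.Solver as ℤSolver
open import Data.List using (List; []; _∷_; foldr; map; filter; tabulate; cartesianProductWith)
open import Data.List.Extrema.Nat using (max)
open import Data.Maybe using (Maybe; just; nothing)
import Data.Maybe.Properties as Maybe
open import Data.Nat as ℕ using (ℕ; zero; suc)
import Data.Nat.Properties as ℕ
open import Data.Nat.Logarithm
  using (⌊log₂_⌋; ⌊log₂⌋-mono-≤; ⌊log₂[2^n]⌋≡n; ⌊log₂⌊n/2⌋⌋≡⌊log₂n⌋∸1; ⌊log₂[2*b]⌋≡1+⌊log₂b⌋)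
import Data.Nat.Solver as ℕSolver
open import Data.Product using (∃-syntax; Σ-syntax; _×_; _,_)
open import Data.Rational as ℚ using (ℚ; mkℚ; 0ℚ; 1ℚ; ↥_; ↧ₙ_; ∣_∣)
import Data.Rational.Properties as ℚ
import Data.Rational.Solver as ℚSolver
open import Data.Rational.Unnormalised as ℚᵘ using (mkℚᵘ)
import Data.Rational.Unnormalised.Properties as ℚᵘ
open import Data.Sum using (_⊎_; [_,_]′)
open import Data.Vec using (Vec; []; _∷_; lookup; count)
open import Relation.Binary.PropositionalEquality
  using (_≡_; refl; sym; trans; cong; cong₂)
open import Relation.Nullary using (¬_; Dec; yes; no; contradiction; ¬?; _⊎-dec_)

IsCauchy : (ℕ → ℚ) → Set
IsCauchy s = ∀ ε → 0ℚ ℚ.< ε →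
  ∃[ N ] ∀ m n → N ℕ.≤ m → N ℕ.≤ n → ∣ s m ℚ.- s n ∣ ℚ.≤ ε

EventuallyPos : (ℕ → ℚ) → Set
EventuallyPos s = ∃[ δ ] 0ℚ ℚ.< δ × ∃[ N ] ∀ n → N ℕ.≤ n → δ ℚ.≤ s n

recip : ℚ → ℚ
recip q with q ℚ.≟ 0ℚ
... | yes _  = 0ℚ
... | no q≢0 = (ℚ.1/ q) {{ℚ.≢-nonZero q≢0}}

-- With q = a / b, both ⌊log₂ aᵏ⌋ and ⌊log₂ bᵏ⌋ are exact up to 1, so
-- logNum q k / k is within 1/k of log₂ q for q > 0.
logNum : ℚ → ℕ → ℤ
logNum q k = + ⌊log₂ ℤ.∣ ↥ q ∣ ℕ.^ k ⌋ ℤ.- + ⌊log₂ ↧ₙ q ℕ.^ k ⌋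

ratLog : ℚ → ℕ → ℚ
ratLog q n = logNum q (suc n) ℚ./ suc n

module CauchyLemmas where

  open ℚ.≤-Reasoning
  open ℚSolver.+-*-Solver

  *-monoˡ : ∀ {a b c} → 0ℚ ℚ.≤ c → a ℚ.≤ b → c ℚ.* a ℚ.≤ c ℚ.* b
  *-monoˡ {c = c} 0≤c = ℚ.*-monoˡ-≤-nonNeg c {{ℚ.nonNegative 0≤c}}

  *-monoʳ : ∀ {a b c} → 0ℚ ℚ.≤ c → a ℚ.≤ b → a ℚ.* c ℚ.≤ b ℚ.* c
  *-monoʳ {c = c} 0≤c = ℚ.*-monoʳ-≤-nonNeg c {{ℚ.nonNegative 0≤c}}

  *-mono : ∀ {a b c d} → 0ℚ ℚ.≤ b → 0ℚ ℚ.≤ c → a ℚ.≤ b → c ℚ.≤ d → a ℚ.* c ℚ.≤ b ℚ.* d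
  *-mono 0≤b 0≤c a≤b c≤d = ℚ.≤-trans (*-monoʳ 0≤c a≤b) (*-monoˡ 0≤b c≤d)

  *-pos : ∀ {a b} → 0ℚ ℚ.< a → 0ℚ ℚ.< b → 0ℚ ℚ.< a ℚ.* b
  *-pos {a} {b} 0<a 0<b =
    ℚ.positive⁻¹ (a ℚ.* b) {{ℚ.pos*pos⇒pos a {{ℚ.positive 0<a}} b {{ℚ.positive 0<b}}}}

  +-pos : ∀ {a b} → 0ℚ ℚ.< a → 0ℚ ℚ.< b → 0ℚ ℚ.< a ℚ.+ b
  +-pos = ℚ.+-mono-<

  0<1 : 0ℚ ℚ.< 1ℚ
  0<1 = ℚ.positive⁻¹ 1ℚ

  inverse : ∀ a → 0ℚ ℚ.< a → ∃[ b ] 0ℚ ℚ.< b × a ℚ.* b ≡ 1ℚ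
  inverse a 0<a = b , ℚ.positive⁻¹ b {{ℚ.1/pos⇒pos a {{ℚ.positive 0<a}}}} , ℚ.*-inverseʳ a {{nz}}
    where
    nz = ℚ.>-nonZero 0<a
    b = (ℚ.1/ a) {{nz}}

  fromScaled : ∀ s C → 0ℚ ℚ.< C →
    (∀ ε → 0ℚ ℚ.< ε →
      ∃[ N ] ∀ m n → N ℕ.≤ m → N ℕ.≤ n → ∣ s m ℚ.- s n ∣ ℚ.≤ C ℚ.* ε) →
    IsCauchy s
  fromScaled s C 0<C h ε 0<ε with inverse C 0<C
  ... | D , 0<D , CD≡1 with h (D ℚ.* ε) (*-pos 0<D 0<ε)
  ... | N , close = N , λ m n N≤m N≤n → ℚ.≤-trans (close m n N≤m N≤n) (ℚ.≤-reflexive eq)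
    where
    eq : C ℚ.* (D ℚ.* ε) ≡ ε
    eq = trans (sym (ℚ.*-assoc C D ε)) (trans (cong (ℚ._* ε) CD≡1) (ℚ.*-identityˡ ε))

  abstract
    const-cauchy : ∀ q → IsCauchy (λ _ → q)
    const-cauchy q ε 0<ε = 0 , λ _ _ _ _ →
      ℚ.≤-trans (ℚ.≤-reflexive (cong ∣_∣ (ℚ.+-inverseʳ q))) (ℚ.<⇒≤ 0<ε)

  abstract
    neg-cauchy : ∀ s → IsCauchy s → IsCauchy (λ n → ℚ.- s n)
    neg-cauchy s cs ε 0<ε with cs ε 0<ε
    ... | N , close = N , λ m n N≤m N≤n → begin
      ∣ ℚ.- s m ℚ.- ℚ.- s n ∣ ≡⟨ cong ∣_∣ (sym (ℚ.neg-distrib-+ (s m) (ℚ.- s n))) ⟩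
      ∣ ℚ.- (s m ℚ.- s n) ∣   ≡⟨ ℚ.∣-p∣≡∣p∣ (s m ℚ.- s n) ⟩
      ∣ s m ℚ.- s n ∣         ≤⟨ close m n N≤m N≤n ⟩
      ε                       ∎

  abstract
    +-cauchy : ∀ s t → IsCauchy s → IsCauchy t → IsCauchy (λ n → s n ℚ.+ t n)
    +-cauchy s t cs ct = fromScaled (λ n → s n ℚ.+ t n) (1ℚ ℚ.+ 1ℚ) (+-pos 0<1 0<1) close
      where
      close : ∀ ε → 0ℚ ℚ.< ε → ∃[ N ] ∀ m n → N ℕ.≤ m → N ℕ.≤ n →
        ∣ (s m ℚ.+ t m) ℚ.- (s n ℚ.+ t n) ∣ ℚ.≤ (1ℚ ℚ.+ 1ℚ) ℚ.* ε
      close ε 0<ε with cs ε 0<ε | ct ε 0<ε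
      ... | M , cs′ | N , ct′ = M ℕ.⊔ N , λ m n m≥ n≥ → begin
        ∣ (s m ℚ.+ t m) ℚ.- (s n ℚ.+ t n) ∣
          ≡⟨ cong ∣_∣ (solve 4 (λ a b c d → (a :+ b) :- (c :+ d) := (a :- c) :+ (b :- d)) refl
               (s m) (t m) (s n) (t n)) ⟩
        ∣ (s m ℚ.- s n) ℚ.+ (t m ℚ.- t n) ∣
          ≤⟨ ℚ.∣p+q∣≤∣p∣+∣q∣ (s m ℚ.- s n) (t m ℚ.- t n) ⟩
        ∣ s m ℚ.- s n ∣ ℚ.+ ∣ t m ℚ.- t n ∣
          ≤⟨ ℚ.+-mono-≤ (cs′ m n (ℕ.m⊔n≤o⇒m≤o M N m≥) (ℕ.m⊔n≤o⇒m≤o M N n≥))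
                        (ct′ m n (ℕ.m⊔n≤o⇒n≤o M N m≥) (ℕ.m⊔n≤o⇒n≤o M N n≥)) ⟩
        ε ℚ.+ ε
          ≡⟨ sym (trans (ℚ.*-distribʳ-+ ε 1ℚ 1ℚ) (cong₂ ℚ._+_ (ℚ.*-identityˡ ε) (ℚ.*-identityˡ ε))) ⟩
        (1ℚ ℚ.+ 1ℚ) ℚ.* ε ∎

  bounded : ∀ s → IsCauchy s → ∃[ B ] 0ℚ ℚ.< B × ∃[ N ] ∀ n → N ℕ.≤ n → ∣ s n ∣ ℚ.≤ B
  bounded s cs with cs 1ℚ 0<1
  ... | N , close = ∣ s N ∣ ℚ.+ 1ℚ , ℚ.+-mono-≤-< (ℚ.0≤∣p∣ (s N)) 0<1 , N , λ n N≤n → begin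
    ∣ s n ∣                       ≡⟨ cong ∣_∣ (solve 2 (λ a b → a := b :+ (a :- b)) refl (s n) (s N)) ⟩
    ∣ s N ℚ.+ (s n ℚ.- s N) ∣     ≤⟨ ℚ.∣p+q∣≤∣p∣+∣q∣ (s N) (s n ℚ.- s N) ⟩
    ∣ s N ∣ ℚ.+ ∣ s n ℚ.- s N ∣   ≤⟨ ℚ.+-monoʳ-≤ ∣ s N ∣ (close n N N≤n ℕ.≤-refl) ⟩
    ∣ s N ∣ ℚ.+ 1ℚ                ∎

  *-close : ∀ a b c d A B ε → 0ℚ ℚ.≤ A → 0ℚ ℚ.≤ ε → ∣ a ∣ ℚ.≤ A → ∣ d ∣ ℚ.≤ B →
    ∣ a ℚ.- c ∣ ℚ.≤ ε → ∣ b ℚ.- d ∣ ℚ.≤ ε → ∣ a ℚ.* b ℚ.- c ℚ.* d ∣ ℚ.≤ (A ℚ.+ B) ℚ.* ε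
  *-close a b c d A B ε 0≤A 0≤ε a≤A d≤B ac bd = begin
    ∣ a ℚ.* b ℚ.- c ℚ.* d ∣
      ≡⟨ cong ∣_∣ (solve 4 (λ a b c d → a :* b :- c :* d := a :* (b :- d) :+ (a :- c) :* d) refl a b c d) ⟩
    ∣ a ℚ.* (b ℚ.- d) ℚ.+ (a ℚ.- c) ℚ.* d ∣
      ≤⟨ ℚ.∣p+q∣≤∣p∣+∣q∣ (a ℚ.* (b ℚ.- d)) ((a ℚ.- c) ℚ.* d) ⟩
    ∣ a ℚ.* (b ℚ.- d) ∣ ℚ.+ ∣ (a ℚ.- c) ℚ.* d ∣
      ≡⟨ cong₂ ℚ._+_ (ℚ.∣p*q∣≡∣p∣*∣q∣ a (b ℚ.- d)) (ℚ.∣p*q∣≡∣p∣*∣q∣ (a ℚ.- c) d) ⟩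
    ∣ a ∣ ℚ.* ∣ b ℚ.- d ∣ ℚ.+ ∣ a ℚ.- c ∣ ℚ.* ∣ d ∣
      ≤⟨ ℚ.+-mono-≤ (*-mono 0≤A (ℚ.0≤∣p∣ (b ℚ.- d)) a≤A bd) (*-mono 0≤ε (ℚ.0≤∣p∣ d) ac d≤B) ⟩
    A ℚ.* ε ℚ.+ ε ℚ.* B
      ≡⟨ solve 3 (λ a b e → a :* e :+ e :* b := (a :+ b) :* e) refl A B ε ⟩
    (A ℚ.+ B) ℚ.* ε ∎

  abstract
    *-cauchy : ∀ s t → IsCauchy s → IsCauchy t → IsCauchy (λ n → s n ℚ.* t n)
    *-cauchy s t cs ct =
      let A , 0<A , P , s≤A = bounded s cs
          B , 0<B , Q , t≤B = bounded t ct
      in fromScaled (λ n → s n ℚ.* t n) (A ℚ.+ B) (+-pos 0<A 0<B) λ ε 0<ε →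
        let M , cs′ = cs ε 0<ε
            N , ct′ = ct ε 0<ε
            l : ∀ {k} → (M ℕ.⊔ N) ℕ.⊔ (P ℕ.⊔ Q) ℕ.≤ k → (M ℕ.⊔ N) ℕ.≤ k
            l = ℕ.m⊔n≤o⇒m≤o (M ℕ.⊔ N) (P ℕ.⊔ Q)
            r : ∀ {k} → (M ℕ.⊔ N) ℕ.⊔ (P ℕ.⊔ Q) ℕ.≤ k → (P ℕ.⊔ Q) ℕ.≤ k
            r = ℕ.m⊔n≤o⇒n≤o (M ℕ.⊔ N) (P ℕ.⊔ Q)
        in (M ℕ.⊔ N) ℕ.⊔ (P ℕ.⊔ Q) , λ m n m≥ n≥ →
          *-close (s m) (t m) (s n) (t n) A B ε (ℚ.<⇒≤ 0<A) (ℚ.<⇒≤ 0<ε)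
            (s≤A m (ℕ.m⊔n≤o⇒m≤o P Q (r m≥)))
            (t≤B n (ℕ.m⊔n≤o⇒n≤o P Q (r n≥)))
            (cs′ m n (ℕ.m⊔n≤o⇒m≤o M N (l m≥)) (ℕ.m⊔n≤o⇒m≤o M N (l n≥)))
            (ct′ m n (ℕ.m⊔n≤o⇒n≤o M N (l m≥)) (ℕ.m⊔n≤o⇒n≤o M N (l n≥)))

  recip-inverse : ∀ q → 0ℚ ℚ.< q → q ℚ.* recip q ≡ 1ℚ
  recip-inverse q 0<q with q ℚ.≟ 0ℚ
  ... | yes q≡0 = contradiction (sym q≡0) (ℚ.<⇒≢ 0<q)
  ... | no q≢0  = ℚ.*-inverseʳ q {{ℚ.≢-nonZero q≢0}}

  recip-pos : ∀ q → 0ℚ ℚ.< q → 0ℚ ℚ.< recip q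
  recip-pos q 0<q with q ℚ.≟ 0ℚ
  ... | yes q≡0 = contradiction (sym q≡0) (ℚ.<⇒≢ 0<q)
  ... | no q≢0  = ℚ.positive⁻¹ _ {{pos}}
    where
    pos : ℚ.Positive ((ℚ.1/ q) {{ℚ.≢-nonZero q≢0}})
    pos = ℚ.1/pos⇒pos q {{ℚ.positive 0<q}}

  recip-antimono : ∀ {a b} → 0ℚ ℚ.< a → a ℚ.≤ b → recip b ℚ.≤ recip a
  recip-antimono {a} {b} 0<a a≤b = begin
    recip b                        ≡⟨ sym (ℚ.*-identityˡ (recip b)) ⟩
    1ℚ ℚ.* recip b                 ≡⟨ cong (ℚ._* recip b) (sym (trans (ℚ.*-comm (recip a) a) (recip-inverse a 0<a))) ⟩
    recip a ℚ.* a ℚ.* recip b      ≤⟨ *-monoʳ (ℚ.<⇒≤ (recip-pos b 0<b)) (*-monoˡ (ℚ.<⇒≤ (recip-pos a 0<a)) a≤b) ⟩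
    recip a ℚ.* b ℚ.* recip b      ≡⟨ ℚ.*-assoc (recip a) b (recip b) ⟩
    recip a ℚ.* (b ℚ.* recip b)    ≡⟨ cong (recip a ℚ.*_) (recip-inverse b 0<b) ⟩
    recip a ℚ.* 1ℚ                 ≡⟨ ℚ.*-identityʳ (recip a) ⟩
    recip a                        ∎
    where
    0<b : 0ℚ ℚ.< b
    0<b = ℚ.<-≤-trans 0<a a≤b

  recip-diff : ∀ a b → 0ℚ ℚ.< a → 0ℚ ℚ.< b →
    recip a ℚ.- recip b ≡ (recip a ℚ.* recip b) ℚ.* (b ℚ.- a)
  recip-diff a b 0<a 0<b = sym (trans
    (solve 4 (λ a b u v → (u :* v) :* (b :- a) := u :* (b :* v) :- v :* (a :* u)) refl a b (recip a) (recip b))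
    (cong₂ ℚ._-_ (trans (cong (recip a ℚ.*_) (recip-inverse b 0<b)) (ℚ.*-identityʳ (recip a)))
                 (trans (cong (recip b ℚ.*_) (recip-inverse a 0<a)) (ℚ.*-identityʳ (recip b)))))

  recip-close : ∀ a b δ ε → 0ℚ ℚ.< δ → δ ℚ.≤ a → δ ℚ.≤ b → ∣ b ℚ.- a ∣ ℚ.≤ ε →
    ∣ recip a ℚ.- recip b ∣ ℚ.≤ (recip δ ℚ.* recip δ) ℚ.* ε
  recip-close a b δ ε 0<δ δ≤a δ≤b ab = begin
    ∣ recip a ℚ.- recip b ∣
      ≡⟨ cong ∣_∣ (recip-diff a b 0<a 0<b) ⟩
    ∣ (recip a ℚ.* recip b) ℚ.* (b ℚ.- a) ∣
      ≡⟨ ℚ.∣p*q∣≡∣p∣*∣q∣ (recip a ℚ.* recip b) (b ℚ.- a) ⟩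
    ∣ recip a ℚ.* recip b ∣ ℚ.* ∣ b ℚ.- a ∣
      ≡⟨ cong (ℚ._* ∣ b ℚ.- a ∣) (ℚ.0≤p⇒∣p∣≡p (ℚ.<⇒≤ (*-pos (recip-pos a 0<a) (recip-pos b 0<b)))) ⟩
    (recip a ℚ.* recip b) ℚ.* ∣ b ℚ.- a ∣
      ≤⟨ *-mono (ℚ.<⇒≤ (*-pos (recip-pos δ 0<δ) (recip-pos δ 0<δ))) (ℚ.0≤∣p∣ (b ℚ.- a))
           (*-mono (ℚ.<⇒≤ (recip-pos δ 0<δ)) (ℚ.<⇒≤ (recip-pos b 0<b))
             (recip-antimono 0<δ δ≤a) (recip-antimono 0<δ δ≤b))
           ab ⟩
    (recip δ ℚ.* recip δ) ℚ.* ε ∎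
    where
    0<a : 0ℚ ℚ.< a
    0<a = ℚ.<-≤-trans 0<δ δ≤a
    0<b : 0ℚ ℚ.< b
    0<b = ℚ.<-≤-trans 0<δ δ≤b

  abstract
    recip-cauchy : ∀ s → IsCauchy s → EventuallyPos s → IsCauchy (λ n → recip (s n))
    recip-cauchy s cs (δ , 0<δ , P , δ≤s) =
      fromScaled (λ n → recip (s n)) (recip δ ℚ.* recip δ) (*-pos (recip-pos δ 0<δ) (recip-pos δ 0<δ)) λ ε 0<ε →
        let M , cs′ = cs ε 0<ε
            l : ∀ {k} → M ℕ.⊔ P ℕ.≤ k → M ℕ.≤ k
            l = ℕ.m⊔n≤o⇒m≤o M P
            r : ∀ {k} → M ℕ.⊔ P ℕ.≤ k → P ℕ.≤ k
            r = ℕ.m⊔n≤o⇒n≤o M P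
        in M ℕ.⊔ P , λ m n m≥ n≥ →
          recip-close (s m) (s n) δ ε 0<δ (δ≤s m (r m≥)) (δ≤s n (r n≥)) (cs′ n m (l n≥) (l m≥))

  abstract
    recip-eventuallyPos : ∀ s → IsCauchy s → EventuallyPos s → EventuallyPos (λ n → recip (s n))
    recip-eventuallyPos s cs (δ , 0<δ , P , δ≤s) =
      let B , 0<B , Q , s≤B = bounded s cs
          l : ∀ {k} → P ℕ.⊔ Q ℕ.≤ k → P ℕ.≤ k
          l = ℕ.m⊔n≤o⇒m≤o P Q
          r : ∀ {k} → P ℕ.⊔ Q ℕ.≤ k → Q ℕ.≤ k
          r = ℕ.m⊔n≤o⇒n≤o P Q
          pos : ∀ n → P ℕ.⊔ Q ℕ.≤ n → 0ℚ ℚ.< s n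
          pos n n≥ = ℚ.<-≤-trans 0<δ (δ≤s n (l n≥))
      in recip B , recip-pos B 0<B , P ℕ.⊔ Q , λ n n≥ →
        recip-antimono (pos n n≥)
          (ℚ.≤-trans (ℚ.≤-reflexive (sym (ℚ.0≤p⇒∣p∣≡p (ℚ.<⇒≤ (pos n n≥))))) (s≤B n (r n≥)))

module LogLemmas where

  open CauchyLemmas

  ⌊log₂⌋< : ∀ k n → n ℕ.< 2 ℕ.^ suc k → ⌊log₂ n ⌋ ℕ.≤ k
  ⌊log₂⌋< zero    0             n<  = ℕ.z≤n
  ⌊log₂⌋< zero    1             n<  = ℕ.z≤n
  ⌊log₂⌋< zero    (suc (suc n)) (ℕ.s≤s (ℕ.s≤s ()))
  ⌊log₂⌋< (suc k) n             n<  = begin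
    ⌊log₂ n ⌋                 ≤⟨ ℕ.m≤n+m∸n ⌊log₂ n ⌋ 1 ⟩
    1 ℕ.+ (⌊log₂ n ⌋ ℕ.∸ 1)   ≡⟨ cong suc (sym (⌊log₂⌊n/2⌋⌋≡⌊log₂n⌋∸1 n)) ⟩
    1 ℕ.+ ⌊log₂ ℕ.⌊ n /2⌋ ⌋   ≤⟨ ℕ.s≤s (⌊log₂⌋< k ℕ.⌊ n /2⌋ half<) ⟩
    suc k                     ∎
    where
    open ℕ.≤-Reasoning
    double : ∀ m → ℕ.⌊ m /2⌋ ℕ.+ ℕ.⌊ m /2⌋ ℕ.≤ m
    double m = ℕ.≤-trans (ℕ.+-monoʳ-≤ ℕ.⌊ m /2⌋ (ℕ.⌊n/2⌋≤⌈n/2⌉ m))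
                         (ℕ.≤-reflexive (ℕ.⌊n/2⌋+⌈n/2⌉≡n m))
    half< : ℕ.⌊ n /2⌋ ℕ.< 2 ℕ.^ suc k
    half< = ℕ.*-cancelˡ-< 2 ℕ.⌊ n /2⌋ (2 ℕ.^ suc k) (begin-strict
      2 ℕ.* ℕ.⌊ n /2⌋                ≡⟨ cong (ℕ.⌊ n /2⌋ ℕ.+_) (ℕ.+-identityʳ ℕ.⌊ n /2⌋) ⟩
      ℕ.⌊ n /2⌋ ℕ.+ ℕ.⌊ n /2⌋        ≤⟨ double n ⟩
      n                              <⟨ n< ⟩
      2 ℕ.* 2 ℕ.^ suc k              ∎)

  ≤⌊log₂⌋ : ∀ {k n} → 2 ℕ.^ k ℕ.≤ n → k ℕ.≤ ⌊log₂ n ⌋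
  ≤⌊log₂⌋ {k} 2^k≤n = ℕ.≤-trans (ℕ.≤-reflexive (sym (⌊log₂[2^n]⌋≡n k))) (⌊log₂⌋-mono-≤ 2^k≤n)

  2^⌊log₂⌋≤ : ∀ n → 1 ℕ.≤ n → 2 ℕ.^ ⌊log₂ n ⌋ ℕ.≤ n
  2^⌊log₂⌋≤ n 1≤n = go ⌊log₂ n ⌋ ℕ.≤-refl
    where
    go : ∀ k → k ℕ.≤ ⌊log₂ n ⌋ → 2 ℕ.^ k ℕ.≤ n
    go zero    _  = 1≤n
    go (suc k) k< = ℕ.≮⇒≥ λ n< → ℕ.<⇒≱ k< (⌊log₂⌋< k n n<)

  <2^⌊log₂⌋ : ∀ n → n ℕ.< 2 ℕ.^ suc ⌊log₂ n ⌋
  <2^⌊log₂⌋ n = ℕ.≰⇒> λ 2^≤n → ℕ.1+n≰n (≤⌊log₂⌋ {suc ⌊log₂ n ⌋} 2^≤n)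

  2^-cancel-≤ : ∀ {a b} → 2 ℕ.^ a ℕ.≤ 2 ℕ.^ b → a ℕ.≤ b
  2^-cancel-≤ {a} {b} 2^≤ = ℕ.≤-trans (≤⌊log₂⌋ {a} 2^≤) (ℕ.≤-reflexive (⌊log₂[2^n]⌋≡n b))

  1≤^ : ∀ n k → 1 ℕ.≤ n → 1 ℕ.≤ n ℕ.^ k
  1≤^ (suc n) k _ = ℕ.m^n>0 (suc n) k

  ⌊log₂⌋-superadditive : ∀ m n → 1 ℕ.≤ m → 1 ℕ.≤ n → ⌊log₂ m ⌋ ℕ.+ ⌊log₂ n ⌋ ℕ.≤ ⌊log₂ m ℕ.* n ⌋
  ⌊log₂⌋-superadditive m n 1≤m 1≤n = ≤⌊log₂⌋ {⌊log₂ m ⌋ ℕ.+ ⌊log₂ n ⌋}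
    (ℕ.≤-trans (ℕ.≤-reflexive (ℕ.^-distribˡ-+-* 2 ⌊log₂ m ⌋ ⌊log₂ n ⌋))
               (ℕ.*-mono-≤ (2^⌊log₂⌋≤ m 1≤m) (2^⌊log₂⌋≤ n 1≤n)))

  ⌊log₂⌋-subadditive : ∀ m n → ⌊log₂ m ℕ.* n ⌋ ℕ.≤ suc (⌊log₂ m ⌋ ℕ.+ ⌊log₂ n ⌋)
  ⌊log₂⌋-subadditive m n = ⌊log₂⌋< _ _ (begin-strict
    m ℕ.* n                                            <⟨ ℕ.*-mono-< (<2^⌊log₂⌋ m) (<2^⌊log₂⌋ n) ⟩
    2 ℕ.^ suc ⌊log₂ m ⌋ ℕ.* 2 ℕ.^ suc ⌊log₂ n ⌋        ≡⟨ sym (ℕ.^-distribˡ-+-* 2 (suc ⌊log₂ m ⌋) (suc ⌊log₂ n ⌋)) ⟩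
    2 ℕ.^ (suc ⌊log₂ m ⌋ ℕ.+ suc ⌊log₂ n ⌋)            ≡⟨ cong (2 ℕ.^_) (ℕ.+-suc (suc ⌊log₂ m ⌋) ⌊log₂ n ⌋) ⟩
    2 ℕ.^ suc (suc (⌊log₂ m ⌋ ℕ.+ ⌊log₂ n ⌋))          ∎)
    where open ℕ.≤-Reasoning

  ⌊log₂⌋-powers : ∀ n j k → 1 ℕ.≤ n →
    ⌊log₂ n ℕ.^ k ⌋ ℕ.* j ℕ.≤ ⌊log₂ n ℕ.^ j ⌋ ℕ.* k ℕ.+ k
  ⌊log₂⌋-powers n j k 1≤n = ℕ.≤-trans (2^-cancel-≤ {⌊log₂ n ℕ.^ k ⌋ ℕ.* j} (begin
    2 ℕ.^ (⌊log₂ n ℕ.^ k ⌋ ℕ.* j)    ≡⟨ sym (ℕ.^-*-assoc 2 ⌊log₂ n ℕ.^ k ⌋ j) ⟩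
    (2 ℕ.^ ⌊log₂ n ℕ.^ k ⌋) ℕ.^ j    ≤⟨ ℕ.^-monoˡ-≤ j (2^⌊log₂⌋≤ (n ℕ.^ k) (1≤^ n k 1≤n)) ⟩
    (n ℕ.^ k) ℕ.^ j                  ≡⟨ ℕ.^-*-assoc n k j ⟩
    n ℕ.^ (k ℕ.* j)                  ≡⟨ cong (n ℕ.^_) (ℕ.*-comm k j) ⟩
    n ℕ.^ (j ℕ.* k)                  ≡⟨ sym (ℕ.^-*-assoc n j k) ⟩
    (n ℕ.^ j) ℕ.^ k                  ≤⟨ ℕ.^-monoˡ-≤ k (ℕ.<⇒≤ (<2^⌊log₂⌋ (n ℕ.^ j))) ⟩
    (2 ℕ.^ suc ⌊log₂ n ℕ.^ j ⌋) ℕ.^ k  ≡⟨ ℕ.^-*-assoc 2 (suc ⌊log₂ n ℕ.^ j ⌋) k ⟩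
    2 ℕ.^ (suc ⌊log₂ n ℕ.^ j ⌋ ℕ.* k)  ∎))
    (ℕ.≤-reflexive (ℕ.+-comm k (⌊log₂ n ℕ.^ j ⌋ ℕ.* k)))
    where open ℕ.≤-Reasoning

  -- (1 + 1/a)ⁱ ≤ a/(a - i)
  ^-bound : ∀ a i e → i ℕ.+ e ≡ a → suc a ℕ.^ i ℕ.* e ℕ.≤ a ℕ.^ i ℕ.* a
  ^-bound a zero    e eq = ℕ.≤-reflexive (cong (ℕ._+ 0) eq)
  ^-bound a (suc i) e eq = begin
    suc a ℕ.* suc a ℕ.^ i ℕ.* e      ≡⟨ solve 3 (λ a x e → a :* x :* e := x :* (a :* e)) refl (suc a) (suc a ℕ.^ i) e ⟩
    suc a ℕ.^ i ℕ.* (suc a ℕ.* e)    ≤⟨ ℕ.*-monoʳ-≤ (suc a ℕ.^ i) step ⟩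
    suc a ℕ.^ i ℕ.* (a ℕ.* suc e)    ≡⟨ solve 3 (λ a x e → x :* (a :* e) := a :* (x :* e)) refl a (suc a ℕ.^ i) (suc e) ⟩
    a ℕ.* (suc a ℕ.^ i ℕ.* suc e)    ≤⟨ ℕ.*-monoʳ-≤ a (^-bound a i (suc e) (trans (ℕ.+-suc i e) eq)) ⟩
    a ℕ.* (a ℕ.^ i ℕ.* a)            ≡⟨ sym (ℕ.*-assoc a (a ℕ.^ i) a) ⟩
    a ℕ.* a ℕ.^ i ℕ.* a              ∎
    where
    open ℕ.≤-Reasoning
    open ℕSolver.+-*-Solver
    step : suc a ℕ.* e ℕ.≤ a ℕ.* suc e
    step = begin
      e ℕ.+ a ℕ.* e    ≤⟨ ℕ.+-monoˡ-≤ (a ℕ.* e) (ℕ.≤-trans (ℕ.m≤n+m e (suc i)) (ℕ.≤-reflexive eq)) ⟩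
      a ℕ.+ a ℕ.* e    ≡⟨ sym (ℕ.*-suc a e) ⟩
      a ℕ.* suc e      ∎

  *-^ : ∀ a b k → (a ℕ.* b) ℕ.^ k ≡ a ℕ.^ k ℕ.* b ℕ.^ k
  *-^ a b zero    = refl
  *-^ a b (suc k) = trans (cong (a ℕ.* b ℕ.*_) (*-^ a b k))
    (solve 4 (λ a b x y → a :* b :* (x :* y) := a :* x :* (b :* y)) refl a b (a ℕ.^ k) (b ℕ.^ k))
    where open ℕSolver.+-*-Solver

  -- If x ≤ (1 + 1/2k) y then xᵏ ≤ 2 yᵏ.
  ^-close : ∀ k .{{_ : ℕ.NonZero k}} x y →
    (2 ℕ.* k) ℕ.* x ℕ.≤ suc (2 ℕ.* k) ℕ.* y → x ℕ.^ k ℕ.≤ 2 ℕ.* y ℕ.^ k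
  ^-close k x y h = ℕ.*-cancelˡ-≤ (a ℕ.^ k ℕ.* k) {{ℕ.m*n≢0 (a ℕ.^ k) k {{ℕ.m^n≢0 a k {{ℕ.m*n≢0 2 k}}}}}} (begin
    a ℕ.^ k ℕ.* k ℕ.* x ℕ.^ k             ≡⟨ solve 3 (λ u k v → u :* k :* v := u :* v :* k) refl (a ℕ.^ k) k (x ℕ.^ k) ⟩
    a ℕ.^ k ℕ.* x ℕ.^ k ℕ.* k             ≡⟨ cong (ℕ._* k) (sym (*-^ a x k)) ⟩
    (a ℕ.* x) ℕ.^ k ℕ.* k                 ≤⟨ ℕ.*-monoˡ-≤ k (ℕ.^-monoˡ-≤ k h) ⟩
    (suc a ℕ.* y) ℕ.^ k ℕ.* k             ≡⟨ cong (ℕ._* k) (*-^ (suc a) y k) ⟩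
    suc a ℕ.^ k ℕ.* y ℕ.^ k ℕ.* k         ≡⟨ solve 3 (λ u v k → u :* v :* k := u :* k :* v) refl (suc a ℕ.^ k) (y ℕ.^ k) k ⟩
    suc a ℕ.^ k ℕ.* k ℕ.* y ℕ.^ k         ≤⟨ ℕ.*-monoˡ-≤ (y ℕ.^ k) (^-bound a k k (cong (k ℕ.+_) (sym (ℕ.+-identityʳ k)))) ⟩
    a ℕ.^ k ℕ.* (2 ℕ.* k) ℕ.* y ℕ.^ k     ≡⟨ solve 4 (λ u k v t → u :* (t :* k) :* v := u :* k :* (t :* v)) refl (a ℕ.^ k) k (y ℕ.^ k) 2 ⟩
    a ℕ.^ k ℕ.* k ℕ.* (2 ℕ.* y ℕ.^ k)     ∎)
    where
    a = 2 ℕ.* k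
    open ℕ.≤-Reasoning
    open ℕSolver.+-*-Solver

  ⌊log₂⌋-close : ∀ k .{{_ : ℕ.NonZero k}} p q r s → 1 ℕ.≤ p → 1 ℕ.≤ q → 1 ℕ.≤ r → 1 ℕ.≤ s →
    (2 ℕ.* k) ℕ.* (p ℕ.* s) ℕ.≤ suc (2 ℕ.* k) ℕ.* (r ℕ.* q) →
    ⌊log₂ p ℕ.^ k ⌋ ℕ.+ ⌊log₂ s ℕ.^ k ⌋ ℕ.≤ 2 ℕ.+ (⌊log₂ r ℕ.^ k ⌋ ℕ.+ ⌊log₂ q ℕ.^ k ⌋)
  ⌊log₂⌋-close k p q r s 1≤p 1≤q 1≤r 1≤s h = begin
    ⌊log₂ p ℕ.^ k ⌋ ℕ.+ ⌊log₂ s ℕ.^ k ⌋    ≤⟨ ⌊log₂⌋-superadditive (p ℕ.^ k) (s ℕ.^ k) (1≤^ p k 1≤p) (1≤^ s k 1≤s) ⟩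
    ⌊log₂ p ℕ.^ k ℕ.* s ℕ.^ k ⌋            ≡⟨ cong ⌊log₂_⌋ (sym (*-^ p s k)) ⟩
    ⌊log₂ (p ℕ.* s) ℕ.^ k ⌋                ≤⟨ ⌊log₂⌋-mono-≤ (^-close k (p ℕ.* s) (r ℕ.* q) h) ⟩
    ⌊log₂ 2 ℕ.* (r ℕ.* q) ℕ.^ k ⌋          ≡⟨ ⌊log₂[2*b]⌋≡1+⌊log₂b⌋ ((r ℕ.* q) ℕ.^ k) {{ℕ.>-nonZero (1≤^ (r ℕ.* q) k (ℕ.*-mono-≤ 1≤r 1≤q))}} ⟩
    suc ⌊log₂ (r ℕ.* q) ℕ.^ k ⌋            ≡⟨ cong (λ x → suc ⌊log₂ x ⌋) (*-^ r q k) ⟩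
    suc ⌊log₂ r ℕ.^ k ℕ.* q ℕ.^ k ⌋        ≤⟨ ℕ.s≤s (⌊log₂⌋-subadditive (r ℕ.^ k) (q ℕ.^ k)) ⟩
    2 ℕ.+ (⌊log₂ r ℕ.^ k ⌋ ℕ.+ ⌊log₂ q ℕ.^ k ⌋)  ∎
    where open ℕ.≤-Reasoning

  unit : ℕ → ℚ
  unit n = + 1 ℚ./ suc n

  /-close : ∀ i j m n → i ℤ.* + suc n ℤ.≤ j ℤ.* + suc m ℤ.+ (+ suc n ℤ.+ + suc m) →
    i ℚ./ suc m ℚ.≤ j ℚ./ suc n ℚ.+ (unit m ℚ.+ unit n)
  /-close i j m n h = ℚ.toℚᵘ-cancel-≤ (begin
    ℚ.toℚᵘ (i ℚ./ suc m)                                   ≃⟨ ℚ.toℚᵘ-fromℚᵘ (mkℚᵘ i m) ⟩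
    mkℚᵘ i m                                               ≤⟨ ℚᵘ.*≤* cross ⟩
    mkℚᵘ j n ℚᵘ.+ (mkℚᵘ (+ 1) m ℚᵘ.+ mkℚᵘ (+ 1) n)         ≃⟨ ℚᵘ.≃-sym (ℚᵘ.+-cong (ℚ.toℚᵘ-fromℚᵘ (mkℚᵘ j n))
                                                                (ℚᵘ.+-cong (ℚ.toℚᵘ-fromℚᵘ (mkℚᵘ (+ 1) m)) (ℚ.toℚᵘ-fromℚᵘ (mkℚᵘ (+ 1) n)))) ⟩
    ℚ.toℚᵘ W ℚᵘ.+ (ℚ.toℚᵘ U ℚᵘ.+ ℚ.toℚᵘ V)                 ≃⟨ ℚᵘ.≃-sym (ℚᵘ.+-cong (ℚᵘ.≃-refl {ℚ.toℚᵘ W}) (ℚ.toℚᵘ-homo-+ U V)) ⟩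
    ℚ.toℚᵘ W ℚᵘ.+ ℚ.toℚᵘ (U ℚ.+ V)                         ≃⟨ ℚᵘ.≃-sym (ℚ.toℚᵘ-homo-+ W (U ℚ.+ V)) ⟩
    ℚ.toℚᵘ (W ℚ.+ (U ℚ.+ V))                               ∎)
    where
    open ℚᵘ.≤-Reasoning
    W U V : ℚ
    W = j ℚ./ suc n
    U = unit m
    V = unit n
    N M : ℤ
    N = + suc n
    M = + suc m
    cross : i ℤ.* (N ℤ.* (M ℤ.* N)) ℤ.≤ (j ℤ.* (M ℤ.* N) ℤ.+ (+ 1 ℤ.* N ℤ.+ + 1 ℤ.* M) ℤ.* N) ℤ.* M
    cross = ℤR.begin
      i ℤ.* (N ℤ.* (M ℤ.* N))                                     ℤR.≡⟨ solve 3 (λ i m n → i :* (n :* (m :* n)) := i :* n :* (m :* n)) refl i M N ⟩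
      i ℤ.* N ℤ.* (M ℤ.* N)                                       ℤR.≤⟨ ℤ.*-monoʳ-≤-nonNeg (M ℤ.* N) h ⟩
      (j ℤ.* M ℤ.+ (N ℤ.+ M)) ℤ.* (M ℤ.* N)                       ℤR.≡⟨ solve 3 (λ j m n → (j :* m :+ (n :+ m)) :* (m :* n) := (j :* (m :* n) :+ (n :+ m) :* n) :* m) refl j M N ⟩
      (j ℤ.* (M ℤ.* N) ℤ.+ (N ℤ.+ M) ℤ.* N) ℤ.* M                 ℤR.≡⟨ cong (λ x → (j ℤ.* (M ℤ.* N) ℤ.+ x ℤ.* N) ℤ.* M) (sym (cong₂ ℤ._+_ (ℤ.*-identityˡ N) (ℤ.*-identityˡ M))) ⟩
      (j ℤ.* (M ℤ.* N) ℤ.+ (+ 1 ℤ.* N ℤ.+ + 1 ℤ.* M) ℤ.* N) ℤ.* M ℤR.∎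
      where
      module ℤR = ℤ.≤-Reasoning
      open ℤSolver.+-*-Solver

  -- The ℤ form of an inequality a + d ≤ c + b + e between naturals.
  ⊖-≤ : ∀ a b c d e → a ℕ.+ d ℕ.≤ (c ℕ.+ b) ℕ.+ e → + a ℤ.- + b ℤ.≤ (+ c ℤ.- + d) ℤ.+ + e
  ⊖-≤ a b c d e h = begin
    + a ℤ.- + b                                      ≡⟨ solve 3 (λ a b d → a :- b := (a :+ d) :- (b :+ d)) refl (+ a) (+ b) (+ d) ⟩
    (+ a ℤ.+ + d) ℤ.- (+ b ℤ.+ + d)                  ≤⟨ ℤ.+-monoˡ-≤ (ℤ.- (+ b ℤ.+ + d)) (ℤ.+≤+ h) ⟩
    ((+ c ℤ.+ + b) ℤ.+ + e) ℤ.- (+ b ℤ.+ + d)        ≡⟨ solve 4 (λ b c d e → ((c :+ b) :+ e) :- (b :+ d) := (c :- d) :+ e) refl (+ b) (+ c) (+ d) (+ e) ⟩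
    (+ c ℤ.- + d) ℤ.+ + e                            ∎
    where
    open ℤ.≤-Reasoning
    open ℤSolver.+-*-Solver

  1≤∣↥∣ : ∀ q → 0ℚ ℚ.< q → 1 ℕ.≤ ℤ.∣ ↥ q ∣
  1≤∣↥∣ q 0<q = go q (ℚ.positive 0<q)
    where
    go : ∀ q → ℚ.Positive q → 1 ℕ.≤ ℤ.∣ ↥ q ∣
    go (mkℚ (ℤ.+[1+ _ ]) _ _) _ = ℕ.s≤s ℕ.z≤n

  +∣↥∣ : ∀ q → 0ℚ ℚ.< q → + ℤ.∣ ↥ q ∣ ≡ ↥ q
  +∣↥∣ q 0<q = go q (ℚ.positive 0<q)
    where
    go : ∀ q → ℚ.Positive q → + ℤ.∣ ↥ q ∣ ≡ ↥ q
    go (mkℚ (ℤ.+[1+ _ ]) _ _) _ = refl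

  ratLog-exponents : ∀ q → 0ℚ ℚ.< q → ∀ m n → ratLog q m ℚ.≤ ratLog q n ℚ.+ (unit m ℚ.+ unit n)
  ratLog-exponents q 0<q m n = /-close (logNum q M) (logNum q N) m n (begin
    (+ a ℤ.- + b) ℤ.* + N                       ≡⟨ distrib a b N ⟩
    + (a ℕ.* N) ℤ.- + (b ℕ.* N)                 ≤⟨ ⊖-≤ (a ℕ.* N) (b ℕ.* N) (c ℕ.* M) (d ℕ.* M) (N ℕ.+ M) nat ⟩
    (+ (c ℕ.* M) ℤ.- + (d ℕ.* M)) ℤ.+ + (N ℕ.+ M)   ≡⟨ cong (ℤ._+ + (N ℕ.+ M)) (sym (distrib c d M)) ⟩
    (+ c ℤ.- + d) ℤ.* + M ℤ.+ (+ N ℤ.+ + M)     ∎)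
    where
    open ℤ.≤-Reasoning
    M N a b c d : ℕ
    M = suc m
    N = suc n
    a = ⌊log₂ ℤ.∣ ↥ q ∣ ℕ.^ M ⌋
    b = ⌊log₂ ↧ₙ q ℕ.^ M ⌋
    c = ⌊log₂ ℤ.∣ ↥ q ∣ ℕ.^ N ⌋
    d = ⌊log₂ ↧ₙ q ℕ.^ N ⌋
    distrib : ∀ x y z → (+ x ℤ.- + y) ℤ.* + z ≡ + (x ℕ.* z) ℤ.- + (y ℕ.* z)
    distrib x y z = trans (ℤ.*-distribʳ-+ (+ z) (+ x) (ℤ.- + y))
      (cong₂ ℤ._+_ (sym (ℤ.pos-* x z))
        (trans (sym (ℤ.neg-distribˡ-* (+ y) (+ z))) (cong ℤ.-_ (sym (ℤ.pos-* y z)))))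
    nat : a ℕ.* N ℕ.+ d ℕ.* M ℕ.≤ (c ℕ.* M ℕ.+ b ℕ.* N) ℕ.+ (N ℕ.+ M)
    nat = ℕ.≤-trans
      (ℕ.+-mono-≤ (⌊log₂⌋-powers ℤ.∣ ↥ q ∣ N M (1≤∣↥∣ q 0<q)) (⌊log₂⌋-powers (↧ₙ q) M N (ℕ.s≤s ℕ.z≤n)))
      (ℕ.≤-reflexive (solve 4 (λ x y m n → (x :+ m) :+ (y :+ n) := (x :+ y) :+ (n :+ m)) refl
        (c ℕ.* M) (b ℕ.* N) M N))
      where open ℕSolver.+-*-Solver

  cross-≤ : ∀ x y k → 0ℚ ℚ.< x → 0ℚ ℚ.< y → x ℚ.≤ y ℚ.+ y ℚ.* unit k →
    suc k ℕ.* (ℤ.∣ ↥ x ∣ ℕ.* ↧ₙ y) ℕ.≤ suc (suc k) ℕ.* (ℤ.∣ ↥ y ∣ ℕ.* ↧ₙ x)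
  cross-≤ x y k 0<x 0<y h = go x y (ℚ.positive 0<x) (ℚ.positive 0<y) (ℚᵘ.drop-*≤* (begin
    ℚ.toℚᵘ x                                                ≤⟨ ℚ.toℚᵘ-mono-≤ h ⟩
    ℚ.toℚᵘ (y ℚ.+ y ℚ.* unit k)                             ≃⟨ ℚ.toℚᵘ-homo-+ y (y ℚ.* unit k) ⟩
    ℚ.toℚᵘ y ℚᵘ.+ ℚ.toℚᵘ (y ℚ.* unit k)                     ≃⟨ ℚᵘ.+-cong (ℚᵘ.≃-refl {ℚ.toℚᵘ y}) (ℚ.toℚᵘ-homo-* y (unit k)) ⟩
    ℚ.toℚᵘ y ℚᵘ.+ ℚ.toℚᵘ y ℚᵘ.* ℚ.toℚᵘ (unit k)             ≃⟨ ℚᵘ.+-cong (ℚᵘ.≃-refl {ℚ.toℚᵘ y}) (ℚᵘ.*-cong (ℚᵘ.≃-refl {ℚ.toℚᵘ y}) (ℚ.toℚᵘ-fromℚᵘ (mkℚᵘ (+ 1) k))) ⟩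
    ℚ.toℚᵘ y ℚᵘ.+ ℚ.toℚᵘ y ℚᵘ.* mkℚᵘ (+ 1) k                ∎))
    where
    open ℚᵘ.≤-Reasoning
    go : ∀ x y → ℚ.Positive x → ℚ.Positive y →
      let Y = ℚ.toℚᵘ y ℚᵘ.+ ℚ.toℚᵘ y ℚᵘ.* mkℚᵘ (+ 1) k in
      ℚᵘ.↥ ℚ.toℚᵘ x ℤ.* ℚᵘ.↧ Y ℤ.≤ ℚᵘ.↥ Y ℤ.* ℚᵘ.↧ ℚ.toℚᵘ x →
      suc k ℕ.* (ℤ.∣ ↥ x ∣ ℕ.* ↧ₙ y) ℕ.≤ suc (suc k) ℕ.* (ℤ.∣ ↥ y ∣ ℕ.* ↧ₙ x)
    go (mkℚ (ℤ.+[1+ p ]) q _) (mkℚ (ℤ.+[1+ r ]) s _) _ _ h = ℤ.drop‿+≤+ (ℤ.*-cancelˡ-≤-pos (+ (suc k ℕ.* (suc p ℕ.* suc s))) (+ (suc (suc k) ℕ.* (suc r ℕ.* suc q))) S (ℤR.begin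
      S ℤ.* + (suc k ℕ.* (suc p ℕ.* suc s))                   ℤR.≡⟨ cong (S ℤ.*_) (trans (ℤ.pos-* (suc k) (suc p ℕ.* suc s)) (cong (T ℤ.*_) (ℤ.pos-* (suc p) (suc s)))) ⟩
      S ℤ.* (T ℤ.* (P ℤ.* S))                                 ℤR.≡⟨ solve 3 (λ s t p → s :* (t :* (p :* s)) := p :* (s :* (s :* t))) refl S T P ⟩
      P ℤ.* (S ℤ.* (S ℤ.* T))                                 ℤR.≤⟨ h ⟩
      (R ℤ.* (S ℤ.* T) ℤ.+ R ℤ.* + 1 ℤ.* S) ℤ.* Q             ℤR.≡⟨ solve 4 (λ r s t q → (r :* (s :* t) :+ r :* con (+ 1) :* s) :* q := s :* ((con (+ 1) :+ t) :* (r :* q))) refl R S T Q ⟩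
      S ℤ.* (+ suc (suc k) ℤ.* (R ℤ.* Q))                     ℤR.≡⟨ cong (S ℤ.*_) (sym (trans (ℤ.pos-* (suc (suc k)) (suc r ℕ.* suc q)) (cong (+ suc (suc k) ℤ.*_) (ℤ.pos-* (suc r) (suc q))))) ⟩
      S ℤ.* + (suc (suc k) ℕ.* (suc r ℕ.* suc q))             ℤR.∎))
      where
      module ℤR = ℤ.≤-Reasoning
      open ℤSolver.+-*-Solver
      P Q R S T : ℤ
      P = + suc p
      Q = + suc q
      R = + suc r
      S = + suc s
      T = + suc k

  ratLog-arguments : ∀ x y k → 0ℚ ℚ.< x → 0ℚ ℚ.< y → x ℚ.≤ y ℚ.+ y ℚ.* unit (2 ℕ.* suc k ℕ.∸ 1) →
    ratLog x k ℚ.≤ ratLog y k ℚ.+ (unit k ℚ.+ unit k)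
  ratLog-arguments x y k 0<x 0<y h = /-close (logNum x K) (logNum y K) k k (begin
    (+ a ℤ.- + b) ℤ.* + K                         ≤⟨ ℤ.*-monoʳ-≤-nonNeg (+ K) (⊖-≤ a b c d 2 nat) ⟩
    ((+ c ℤ.- + d) ℤ.+ + 2) ℤ.* + K               ≡⟨ solve 2 (λ z k → (z :+ con (+ 2)) :* k := z :* k :+ (k :+ k)) refl (+ c ℤ.- + d) (+ K) ⟩
    (+ c ℤ.- + d) ℤ.* + K ℤ.+ (+ K ℤ.+ + K)       ∎)
    where
    open ℤ.≤-Reasoning
    open ℤSolver.+-*-Solver
    K a b c d : ℕ
    K = suc k
    a = ⌊log₂ ℤ.∣ ↥ x ∣ ℕ.^ K ⌋
    b = ⌊log₂ ↧ₙ x ℕ.^ K ⌋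
    c = ⌊log₂ ℤ.∣ ↥ y ∣ ℕ.^ K ⌋
    d = ⌊log₂ ↧ₙ y ℕ.^ K ⌋
    nat : a ℕ.+ d ℕ.≤ (c ℕ.+ b) ℕ.+ 2
    nat = ℕ.≤-trans
      (⌊log₂⌋-close K ℤ.∣ ↥ x ∣ (↧ₙ x) ℤ.∣ ↥ y ∣ (↧ₙ y)
        (1≤∣↥∣ x 0<x) (ℕ.s≤s ℕ.z≤n) (1≤∣↥∣ y 0<y) (ℕ.s≤s ℕ.z≤n)
        (cross-≤ x y (2 ℕ.* K ℕ.∸ 1) 0<x 0<y h))
      (ℕ.≤-reflexive (ℕ.+-comm 2 (c ℕ.+ b)))

  unit-pos : ∀ n → 0ℚ ℚ.< unit n
  unit-pos n = ℚ.positive⁻¹ (unit n) {{ℚ.normalize-pos 1 (suc n)}}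

  unit-antimono : ∀ {m n} → m ℕ.≤ n → unit n ℚ.≤ unit m
  unit-antimono {m} {n} m≤n = ℚ.toℚᵘ-cancel-≤ (begin
    ℚ.toℚᵘ (unit n)   ≃⟨ ℚ.toℚᵘ-fromℚᵘ (mkℚᵘ (+ 1) n) ⟩
    mkℚᵘ (+ 1) n      ≤⟨ ℚᵘ.*≤* (ℤ.*-monoˡ-≤-nonNeg (+ 1) (ℤ.+≤+ (ℕ.s≤s m≤n))) ⟩
    mkℚᵘ (+ 1) m      ≃⟨ ℚᵘ.≃-sym (ℚ.toℚᵘ-fromℚᵘ (mkℚᵘ (+ 1) m)) ⟩
    ℚ.toℚᵘ (unit m)   ∎)
    where open ℚᵘ.≤-Reasoning

  archimedean : ∀ ε → 0ℚ ℚ.< ε → ∃[ n ] unit n ℚ.≤ ε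
  archimedean ε 0<ε = ℚ.ℚ.denominator-1 ε , ℚ.toℚᵘ-cancel-≤ (begin
    ℚ.toℚᵘ (unit (ℚ.ℚ.denominator-1 ε))  ≃⟨ ℚ.toℚᵘ-fromℚᵘ (mkℚᵘ (+ 1) (ℚ.ℚ.denominator-1 ε)) ⟩
    mkℚᵘ (+ 1) (ℚ.ℚ.denominator-1 ε)     ≤⟨ go ε (ℚ.positive 0<ε) ⟩
    ℚ.toℚᵘ ε                             ∎)
    where
    open ℚᵘ.≤-Reasoning
    go : ∀ q → ℚ.Positive q → mkℚᵘ (+ 1) (ℚ.ℚ.denominator-1 q) ℚᵘ.≤ ℚ.toℚᵘ q
    go (mkℚ (ℤ.+[1+ p ]) d _) _ = ℚᵘ.*≤* (ℤ.*-monoʳ-≤-nonNeg (+ suc d) (ℤ.+≤+ (ℕ.s≤s (ℕ.z≤n {p}))))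

  ∣∣≤ : ∀ x y c → x ℚ.≤ y ℚ.+ c → y ℚ.≤ x ℚ.+ c → ∣ x ℚ.- y ∣ ℚ.≤ c
  ∣∣≤ x y c x≤ y≤ = [ (λ eq → ℚ.≤-trans (ℚ.≤-reflexive eq) (flip x y x≤))
                    , (λ eq → ℚ.≤-trans (ℚ.≤-reflexive (trans eq (solve 2 (λ x y → :- (x :- y) := y :- x) refl x y))) (flip y x y≤))
                    ]′ (ℚ.∣p∣≡p∨∣p∣≡-p (x ℚ.- y))
    where
    open ℚSolver.+-*-Solver
    flip : ∀ u v → u ℚ.≤ v ℚ.+ c → u ℚ.- v ℚ.≤ c
    flip u v h = ℚ.≤-trans (ℚ.+-monoˡ-≤ (ℚ.- v) h)
      (ℚ.≤-reflexive (solve 2 (λ v c → (v :+ c) :- v := c) refl v c))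

  six : ℚ
  six = + 6 ℚ./ 1

  ratLog-close : ∀ x y k m n ε → 0ℚ ℚ.< x → 0ℚ ℚ.< y → k ℕ.≤ m → k ℕ.≤ n → unit k ℚ.≤ ε →
    x ℚ.≤ y ℚ.+ y ℚ.* unit (2 ℕ.* suc k ℕ.∸ 1) → ratLog x m ℚ.≤ ratLog y n ℚ.+ six ℚ.* ε
  ratLog-close x y k m n ε 0<x 0<y k≤m k≤n u≤ε h = begin
    ratLog x m                                          ≤⟨ ratLog-exponents x 0<x m k ⟩
    ratLog x k ℚ.+ (unit m ℚ.+ unit k)                  ≤⟨ ℚ.+-mono-≤ (ratLog-arguments x y k 0<x 0<y h) (ℚ.+-mono-≤ (u m k≤m) u≤ε) ⟩
    ratLog y k ℚ.+ (unit k ℚ.+ unit k) ℚ.+ (ε ℚ.+ ε)    ≤⟨ ℚ.+-monoˡ-≤ (ε ℚ.+ ε) (ℚ.+-mono-≤ (ratLog-exponents y 0<y k n) (ℚ.+-mono-≤ u≤ε u≤ε)) ⟩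
    ratLog y n ℚ.+ (unit k ℚ.+ unit n) ℚ.+ (ε ℚ.+ ε) ℚ.+ (ε ℚ.+ ε)
      ≤⟨ ℚ.+-monoˡ-≤ (ε ℚ.+ ε) (ℚ.+-monoˡ-≤ (ε ℚ.+ ε) (ℚ.+-monoʳ-≤ (ratLog y n) (ℚ.+-mono-≤ u≤ε (u n k≤n)))) ⟩
    ratLog y n ℚ.+ (ε ℚ.+ ε) ℚ.+ (ε ℚ.+ ε) ℚ.+ (ε ℚ.+ ε)
      ≡⟨ solve 2 (λ l e → l :+ (e :+ e) :+ (e :+ e) :+ (e :+ e) := l :+ con six :* e) refl (ratLog y n) ε ⟩
    ratLog y n ℚ.+ six ℚ.* ε  ∎
    where
    open ℚ.≤-Reasoning
    open ℚSolver.+-*-Solver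
    u : ∀ j → k ℕ.≤ j → unit j ℚ.≤ ε
    u j k≤j = ℚ.≤-trans (unit-antimono k≤j) u≤ε

  abstract
    log-cauchy : ∀ s → IsCauchy s → EventuallyPos s → IsCauchy (λ n → ratLog (s n) n)
    log-cauchy s cs (δ , 0<δ , P , δ≤s) = fromScaled (λ n → ratLog (s n) n) six (ℚ.positive⁻¹ six) λ ε 0<ε →
      let k , u≤ε = archimedean ε 0<ε
          w = unit (2 ℕ.* suc k ℕ.∸ 1)
          0<w : 0ℚ ℚ.< w
          0<w = unit-pos (2 ℕ.* suc k ℕ.∸ 1)
          N , close = cs (δ ℚ.* w) (*-pos 0<δ 0<w)
          a : ∀ {j} → (N ℕ.⊔ P) ℕ.⊔ k ℕ.≤ j → N ℕ.≤ j
          a h = ℕ.m⊔n≤o⇒m≤o N P (ℕ.m⊔n≤o⇒m≤o (N ℕ.⊔ P) k h)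
          b : ∀ {j} → (N ℕ.⊔ P) ℕ.⊔ k ℕ.≤ j → P ℕ.≤ j
          b h = ℕ.m⊔n≤o⇒n≤o N P (ℕ.m⊔n≤o⇒m≤o (N ℕ.⊔ P) k h)
          c : ∀ {j} → (N ℕ.⊔ P) ℕ.⊔ k ℕ.≤ j → k ℕ.≤ j
          c h = ℕ.m⊔n≤o⇒n≤o (N ℕ.⊔ P) k h
          one : ∀ m n → (N ℕ.⊔ P) ℕ.⊔ k ℕ.≤ m → (N ℕ.⊔ P) ℕ.⊔ k ℕ.≤ n →
            ratLog (s m) m ℚ.≤ ratLog (s n) n ℚ.+ six ℚ.* ε
          one m n m≥ n≥ = ratLog-close (s m) (s n) k m n ε
            (ℚ.<-≤-trans 0<δ (δ≤s m (b m≥))) (ℚ.<-≤-trans 0<δ (δ≤s n (b n≥)))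
            (c m≥) (c n≥) u≤ε
            (near (s m) (s n) w (ℚ.<⇒≤ 0<w) (δ≤s n (b n≥)) (close m n (a m≥) (a n≥)))
      in (N ℕ.⊔ P) ℕ.⊔ k , λ m n m≥ n≥ →
        ∣∣≤ (ratLog (s m) m) (ratLog (s n) n) (six ℚ.* ε) (one m n m≥ n≥) (one n m n≥ m≥)
      where
      near : ∀ x y w → 0ℚ ℚ.≤ w → δ ℚ.≤ y → ∣ x ℚ.- y ∣ ℚ.≤ δ ℚ.* w → x ℚ.≤ y ℚ.+ y ℚ.* w
      near x y w 0≤w δ≤y h = begin
        x                          ≡⟨ solve 2 (λ x y → x := y :+ (x :- y)) refl x y ⟩
        y ℚ.+ (x ℚ.- y)            ≤⟨ ℚ.+-monoʳ-≤ y (≤∣∣ (x ℚ.- y)) ⟩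
        y ℚ.+ ∣ x ℚ.- y ∣          ≤⟨ ℚ.+-monoʳ-≤ y (ℚ.≤-trans h (*-monoʳ 0≤w δ≤y)) ⟩
        y ℚ.+ y ℚ.* w              ∎
        where
        open ℚ.≤-Reasoning
        open ℚSolver.+-*-Solver
        ≤∣∣ : ∀ z → z ℚ.≤ ∣ z ∣
        ≤∣∣ z = [ (λ 0≤z → ℚ.≤-reflexive (sym (ℚ.0≤p⇒∣p∣≡p 0≤z))) , (λ z≤0 → ℚ.≤-trans z≤0 (ℚ.0≤∣p∣ z)) ]′ (ℚ.≤-total 0ℚ z)

record ℝ : Set where
  constructor mkℝ
  field
    seq    : ℕ → ℚ
    cauchy : IsCauchy seq

open ℝ public

infix  4 _<_ _≤_ _≈_
infixl 6 _+_ _-_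
infixl 7 _*_
infix  8 -_

_<_ : ℝ → ℝ → Set
x < y = ∃[ δ ] 0ℚ ℚ.< δ × ∃[ N ] ∀ n → N ℕ.≤ n → seq x n ℚ.+ δ ℚ.≤ seq y n

_≤_ : ℝ → ℝ → Set
x ≤ y = ¬ (y < x)

_≈_ : ℝ → ℝ → Set
x ≈ y = x ≤ y × y ≤ x

fromℚ : ℚ → ℝ
fromℚ q = mkℝ (λ _ → q) (CauchyLemmas.const-cauchy q)

fromℕ : ℕ → ℝ
fromℕ n = fromℚ (+ n ℚ./ 1)

0ℝ 1ℝ : ℝ
0ℝ = fromℚ 0ℚ
1ℝ = fromℚ 1ℚ

_+_ : ℝ → ℝ → ℝ
x + y = mkℝ (λ n → seq x n ℚ.+ seq y n) (CauchyLemmas.+-cauchy (seq x) (seq y) (cauchy x) (cauchy y))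

-_ : ℝ → ℝ
- x = mkℝ (λ n → ℚ.- seq x n) (CauchyLemmas.neg-cauchy (seq x) (cauchy x))

_-_ : ℝ → ℝ → ℝ
x - y = x + (- y)

_*_ : ℝ → ℝ → ℝ
x * y = mkℝ (λ n → seq x n ℚ.* seq y n) (CauchyLemmas.*-cauchy (seq x) (seq y) (cauchy x) (cauchy y))

0<⇒eventuallyPos : ∀ x → 0ℝ < x → EventuallyPos (seq x)
0<⇒eventuallyPos x (δ , 0<δ , N , δ≤x) = δ , 0<δ , N , λ n N≤n →
  ℚ.≤-trans (ℚ.≤-reflexive (sym (ℚ.+-identityˡ δ))) (δ≤x n N≤n)

eventuallyPos⇒0< : ∀ x → EventuallyPos (seq x) → 0ℝ < x
eventuallyPos⇒0< x (δ , 0<δ , N , δ≤x) = δ , 0<δ , N , λ n N≤n →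
  ℚ.≤-trans (ℚ.≤-reflexive (ℚ.+-identityˡ δ)) (δ≤x n N≤n)

inv : (x : ℝ) → 0ℝ < x → ℝ
inv x 0<x = mkℝ (λ n → recip (seq x n))
  (CauchyLemmas.recip-cauchy (seq x) (cauchy x) (0<⇒eventuallyPos x 0<x))

inv-pos : (x : ℝ) (0<x : 0ℝ < x) → 0ℝ < inv x 0<x
inv-pos x 0<x = eventuallyPos⇒0< (inv x 0<x)
  (CauchyLemmas.recip-eventuallyPos (seq x) (cauchy x) (0<⇒eventuallyPos x 0<x))

log₂ : (x : ℝ) → 0ℝ < x → ℝ
log₂ x 0<x = mkℝ (λ n → ratLog (seq x n) n)
  (LogLemmas.log-cauchy (seq x) (cauchy x) (0<⇒eventuallyPos x 0<x))

∑ : {A : Set} → List A → (A → ℝ) → ℝ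
∑ as f = foldr _+_ 0ℝ (map f as)

infix 5 ∑
syntax ∑ as (λ a → e) = ∑[ a ← as ] e

∏ : ∀ {n} → (Fin n → ℝ) → ℝ
∏ f = foldr _*_ 1ℝ (tabulate f)

words : {A : Set} → List A → ∀ n → List (Vec A n)
words as zero    = [] ∷ []
words as (suc n) = cartesianProductWith _∷_ as (words as n)

bits : List Bool
bits = false ∷ true ∷ []

Input : ℕ → Set
Input n = Vec Bool n

inputs : ∀ n → List (Input n)
inputs = words bits

BoolFun : ℕ → Set
BoolFun n = Input n → Bool

record Distribution (n : ℕ) : Set where
  field
    pmf    : Input n → ℝ
    nonNeg : ∀ x → 0ℝ ≤ pmf x
    total  : ∑[ x ← inputs n ] pmf x ≈ 1ℝ

open Distribution public

Pr : ∀ {n} → Distribution n → {E : Input n → Set} → (∀ x → Dec (E x)) → ℝ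
Pr {n} μ E? = ∑[ x ← filter E? (inputs n) ] pmf μ x

IsProduct : ∀ {n} → Distribution n → Set
IsProduct {n} μ = Σ[ m ∈ (Fin n → Bool → ℝ) ]
  (∀ i b → 0ℝ ≤ m i b × m i b ≤ 1ℝ) ×
  (∀ i → m i false + m i true ≈ 1ℝ) ×
  (∀ x → pmf μ x ≈ ∏ (λ i → m i (lookup x i)))

data DecisionTree (n : ℕ) : Set where
  leaf  : Bool → DecisionTree n
  query : Fin n → (Bool → DecisionTree n) → DecisionTree n

output : ∀ {n} → DecisionTree n → Input n → Bool
output (leaf b)        x = b
output (query i child) x = output (child (lookup x i)) x

queries : ∀ {n} → DecisionTree n → Input n → ℕ
queries (leaf b)        x = 0
queries (query i child) x = suc (queries (child (lookup x i)) x)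

worstCase : ∀ {n} → DecisionTree n → ℕ
worstCase {n} t = max 0 (map (queries t) (inputs n))

Computes : ∀ {n} → Distribution n → ℝ → BoolFun n → DecisionTree n → Set
Computes μ δ f t = 1ℝ - δ ≤ Pr μ (λ x → output t x Bool.≟ f x)

-- d is D^μ_δ(f).  The minimum is given by its defining property: which trees
-- compete for it depends on comparisons of reals, which are not decidable.
IsDistributionalComplexity : ∀ {n} → Distribution n → ℝ → BoolFun n → ℕ → Set
IsDistributionalComplexity μ δ f d =
  (∃[ t ] Computes μ δ f t × worstCase t ≡ d) ×
  (∀ t → Computes μ δ f t → d ℕ.≤ worstCase t)

-- nothing plays the role of *.
Assignment : ℕ → Set
Assignment n = Vec (Maybe Bool) n

assignments : ∀ n → List (Assignment n)
assignments = words (nothing ∷ map just bits)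

infix 4 _∈_ _∈?_

_∈_ : ∀ {n} → Input n → Assignment n → Set
x ∈ A = ∀ i → just (lookup x i) ≡ lookup A i ⊎ lookup A i ≡ nothing

_∈?_ : ∀ {n} (x : Input n) (A : Assignment n) → Dec (x ∈ A)
x ∈? A = Fin.all? λ i →
  Maybe.≡-dec Bool._≟_ (just (lookup x i)) (lookup A i) ⊎-dec
  Maybe.≡-dec Bool._≟_ (lookup A i) nothing

codim : ∀ {n} → Assignment n → ℕ
codim = count (λ a → ¬? (Maybe.≡-dec Bool._≟_ a nothing))

containing : ∀ {n} → Input n → List (Assignment n)
containing {n} x = filter (x ∈?_) (assignments n)

Weights : ℕ → Set
Weights n = Bool → Assignment n → ℝ

objective : ∀ {n} → Weights n → ℝ
objective {n} w = ∑[ z ← bits ] ∑[ A ← assignments n ] w z A * fromℕ (2 ℕ.^ codim A)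

record Feasible {n} (f : BoolFun n) (ε : ℝ) (w : Weights n) : Set where
  field
    covering  : ∀ x → 1ℝ - ε ≤ ∑[ A ← containing x ] w (f x) A
    partition : ∀ x → ∑[ z ← bits ] ∑[ A ← containing x ] w z A ≈ 1ℝ
    nonNeg    : ∀ z A → 0ℝ ≤ w z A

IsOptimalValue : ∀ {n} → BoolFun n → ℝ → ℝ → Set
IsOptimalValue f ε v =
  (∃[ w ] Feasible f ε w × objective w ≈ v) ×
  (∀ w → Feasible f ε w → v ≤ objective w)

IsPartitionBound : ∀ {n} → BoolFun n → ℝ → ℝ → Set
IsPartitionBound f ε p =
  ∃[ v ] ∃[ 0<v ] IsOptimalValue f ε v × p ≈ log₂ v 0<v

{-# OPTIONS --safe #-}
-- Fix a feasible solution w and a subcube reached after some queries, and let Φ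
-- be the average, over a labelled subcube drawn with probability w(z,A) μ(A), of
-- the number of coordinates A still fixes.  Under a product distribution two
-- subcubes that share no unqueried coordinate are independent, while every input
-- carries weight at most ε of the wrong label.  Hence a 0-subcube and a 1-subcube
-- drawn independently mostly share a coordinate, unless one value of f has
-- probability O(ε), in which case the tree stops.  Subcubes of codimension above
-- p + O(1) carry little weight and are discarded, so Φ ≤ O(p), and some coordinate
-- has influence Ω(1/p): querying it lowers Φ by that much on average.
-- Thus 2κ + Φ (κ = p + O(1)) shrinks by a factor 1 - Ω(1/p²) per query, and
-- O(p² log (1/ε)) queries leave the tree unfinished with probability O(ε).
-- A nonconstant f has p ≥ 1, which absorbs the additive constants.  The argument
-- is run over ℚ, on approximations of w, μ and ε, where comparisons are decidable.
module Submission where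

open import Data.Bool using (Bool; true; false; not; if_then_else_)
import Data.Bool.Properties as Bool
open import Data.Fin using (Fin; zero; suc)
import Data.Fin.Properties as Fin
open import Data.Integer as ℤ using (+_)
import Data.Integer.Properties as ℤ
open import Data.List using (List; []; _∷_; _++_; map; filter; foldr; allFin)
open import Data.List.Extrema.Nat using (max≤v⁺)
open import Data.List.Properties using (map-tabulate)
open import Data.List.Relation.Unary.All as All using (All)
import Data.List.Relation.Unary.All.Properties as All
open import Data.Maybe using (Maybe; just; nothing)
open import Data.Nat as ℕ using (ℕ)
open import Data.Nat.Logarithm using (⌊log₂_⌋; ⌊log₂⌋-mono-≤; ⌊log₂[2^n]⌋≡n)
import Data.Nat.Properties as ℕ
open import Data.Product using (_,_; _×_; ∃-syntax; proj₁; proj₂)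
open import Data.Sum using (_⊎_; inj₁; inj₂)
open import Data.Vec as Vec using (Vec; []; _∷_; lookup; _[_]≔_)
open import Function using (_∘_; id)
open import Level using (0ℓ)
open import Relation.Binary.PropositionalEquality using (_≡_; refl; sym; trans; cong; cong₂; subst; subst₂; module ≡-Reasoning)
open import Relation.Nullary using (Dec; yes; no; does; ¬_; contradiction)
open import Relation.Nullary.Decidable using (dec⇒maybe)
open import Tactic.RingSolver using (solve-∀)
open import Tactic.RingSolver.Core.AlmostCommutativeRing using (AlmostCommutativeRing; fromCommutativeRing)
import Defs as R

-- Averaging the drops of `Φ` alone would bound only the expected number of queries, and Markov's
-- inequality would then cost a factor 1/ε. Geometric decay comes from `Φ ≤ 2κ` holding at every
-- reachable state, not only at the root. The summand 2κ gives the potential a floor: scaled so that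
-- 2κ counts as 1, it bounds the error of an unfinished branch however small `Φ` has become, and
-- since 2κ + `Φ` ≤ 4κ, an expected drop of τ is a fixed fraction of it.
--
-- Approximation is uneven. The marginals of μ are approximated, not μ itself, so independence is
-- exact over ℚ. The weights satisfy their constraints only with slack. Where the slack enters the
-- wrong-label weight or the error probability, it must be proportional to ε, so a positive rational
-- e within 1/16 of ε (relatively) is fixed first. All other requirements hold from some index on,
-- and one large index serves them all.
--
-- Error budget: 5e at stopped leaves, e/2 from exhausted branches and e from approximating μ,
-- against 8ε ≥ 15/2 e.

module Development where

  open import Data.Rational
  open import Data.Rational.Properties
  import Data.Rational.Unnormalised as ℚᵘ
  import Data.Rational.Unnormalised.Properties as ℚᵘ
  open R using (Input; inputs; Assignment; assignments; codim; bits; containing; _∈_; _∈?_; BoolFun; DecisionTree; leaf; query; queries; output; worstCase; seq; cauchy; ratLog; logNum; recip; module CauchyLemmas; module LogLemmas)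
  open CauchyLemmas using (*-monoˡ) renaming (*-mono to *-mono-≤)

  -- Rational inequalities and finite sums

  ring : AlmostCommutativeRing 0ℓ 0ℓ
  ring = fromCommutativeRing +-*-commutativeRing (λ x → dec⇒maybe (0ℚ ≟ x))

  0≤+ : ∀ {a b} → 0ℚ ≤ a → 0ℚ ≤ b → 0ℚ ≤ a + b
  0≤+ 0≤a 0≤b = +-mono-≤ 0≤a 0≤b

  0≤* : ∀ {a b} → 0ℚ ≤ a → 0ℚ ≤ b → 0ℚ ≤ a * b
  0≤* {a} {b} 0≤a 0≤b = ≤-trans (≤-reflexive (sym (*-zeroʳ a))) (*-monoˡ-≤-nonNeg a {{nonNegative 0≤a}} 0≤b)

  gap : ∀ {a b} → a ≤ b → 0ℚ ≤ b - a
  gap {a} a≤b = ≤-trans (≤-reflexive (sym (+-inverseʳ a))) (+-monoˡ-≤ (- a) a≤b)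

  p+q-p≡q : ∀ p q → p + q - p ≡ q
  p+q-p≡q = solve-∀ ring

  p+q-q≡p : ∀ p q → p + q - q ≡ p
  p+q-q≡p = solve-∀ ring

  -- A linear inequality is certified by writing its gap as a nonnegative
  -- combination of the gaps of the hypotheses.
  ≤-since : ∀ {a b x} → 0ℚ ≤ x → b - a ≡ x → a ≤ b
  ≤-since {a} {b} {x} 0≤x eq = begin
    a            ≡⟨ sym (+-identityʳ a) ⟩
    a + 0ℚ       ≤⟨ +-monoʳ-≤ a (≤-trans 0≤x (≤-reflexive (sym eq))) ⟩
    a + (b - a)  ≡⟨ cancel a b ⟩
    b            ∎
    where
    open ≤-Reasoning
    cancel : ∀ a b → a + (b - a) ≡ b
    cancel = solve-∀ ring

  infix 5 ∑
  syntax ∑ as (λ a → e) = ∑[ a ← as ] e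

  ∑ : {A : Set} → List A → (A → ℚ) → ℚ
  ∑ as f = foldr _+_ 0ℚ (map f as)

  module _ {A : Set} where

    ∑-cong : ∀ (as : List A) {f g} → (∀ a → f a ≡ g a) → ∑ as f ≡ ∑ as g
    ∑-cong []       f≡g = refl
    ∑-cong (a ∷ as) f≡g = cong₂ _+_ (f≡g a) (∑-cong as f≡g)

    ∑-mono-All : ∀ {P : A → Set} {as} {f g} → All P as → (∀ a → P a → f a ≤ g a) → ∑ as f ≤ ∑ as g
    ∑-mono-All All.[]           f≤g = ≤-refl
    ∑-mono-All (pa All.∷ pas) f≤g = +-mono-≤ (f≤g _ pa) (∑-mono-All pas f≤g)

    ∑-mono : ∀ (as : List A) {f g} → (∀ a → f a ≤ g a) → ∑ as f ≤ ∑ as g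
    ∑-mono []       f≤g = ≤-refl
    ∑-mono (a ∷ as) f≤g = +-mono-≤ (f≤g a) (∑-mono as f≤g)

    ∑-nonNeg : ∀ (as : List A) {f} → (∀ a → 0ℚ ≤ f a) → 0ℚ ≤ ∑ as f
    ∑-nonNeg []       0≤f = ≤-refl
    ∑-nonNeg (a ∷ as) 0≤f = 0≤+ (0≤f a) (∑-nonNeg as 0≤f)

    ∑-+ : ∀ (as : List A) f g → ∑[ a ← as ] (f a + g a) ≡ ∑ as f + ∑ as g
    ∑-+ []       f g = refl
    ∑-+ (a ∷ as) f g = trans (cong (_+_ (f a + g a)) (∑-+ as f g)) (rearrange (f a) (g a) (∑ as f) (∑ as g))
      where
      rearrange : ∀ w x y z → (w + x) + (y + z) ≡ (w + y) + (x + z)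
      rearrange = solve-∀ ring

    ∑-*ˡ : ∀ c (as : List A) f → ∑[ a ← as ] (c * f a) ≡ c * ∑ as f
    ∑-*ˡ c []       f = sym (*-zeroʳ c)
    ∑-*ˡ c (a ∷ as) f = trans (cong (_+_ (c * f a)) (∑-*ˡ c as f)) (sym (*-distribˡ-+ c (f a) (∑ as f)))

    ∑-*ʳ : ∀ c (as : List A) f → ∑[ a ← as ] (f a * c) ≡ ∑ as f * c
    ∑-*ʳ c as f = trans (∑-cong as (λ a → *-comm (f a) c)) (trans (∑-*ˡ c as f) (*-comm c (∑ as f)))

    ∑-zero : ∀ (as : List A) → ∑[ a ← as ] 0ℚ ≡ 0ℚ
    ∑-zero []       = refl
    ∑-zero (a ∷ as) = trans (+-identityˡ _) (∑-zero as)

    ∑-++ : ∀ (as bs : List A) f → ∑ (as ++ bs) f ≡ ∑ as f + ∑ bs f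
    ∑-++ []       bs f = sym (+-identityˡ _)
    ∑-++ (a ∷ as) bs f = trans (cong (_+_ (f a)) (∑-++ as bs f)) (sym (+-assoc (f a) _ _))

    ∑-filter : ∀ {P : A → Set} (P? : ∀ a → Dec (P a)) as f →
      ∑ (filter P? as) f ≡ ∑[ a ← as ] (if does (P? a) then f a else 0ℚ)
    ∑-filter P? []       f = refl
    ∑-filter P? (a ∷ as) f with P? a
    ... | yes _ = cong (_+_ (f a)) (∑-filter P? as f)
    ... | no  _ = trans (∑-filter P? as f) (sym (+-identityˡ _))

    ∑-map : ∀ {B : Set} (h : B → A) bs f → ∑ (map h bs) f ≡ ∑ bs (f ∘ h)
    ∑-map h []       f = refl
    ∑-map h (b ∷ bs) f = cong (_+_ (f (h b))) (∑-map h bs f)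

  ∑-comm : ∀ {A B : Set} (as : List A) (bs : List B) (f : A → B → ℚ) →
    ∑[ a ← as ] ∑[ b ← bs ] f a b ≡ ∑[ b ← bs ] ∑[ a ← as ] f a b
  ∑-comm []       bs f = sym (∑-zero bs)
  ∑-comm (a ∷ as) bs f = trans (cong (_+_ (∑ bs (f a))) (∑-comm as bs f)) (sym (∑-+ bs (f a) _))

  ∑-product : ∀ {A B : Set} (as : List A) (bs : List B) f g →
    ∑ as f * ∑ bs g ≡ ∑[ b ← bs ] ∑[ a ← as ] (f a * g b)
  ∑-product as bs f g = trans (sym (∑-*ˡ (∑ as f) bs g)) (∑-cong bs (λ b → sym (∑-*ʳ (g b) as f)))

  ∑-allFin-suc : ∀ n (f : Fin (ℕ.suc n) → ℚ) → ∑ (allFin (ℕ.suc n)) f ≡ f zero + ∑ (allFin n) (f ∘ suc)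
  ∑-allFin-suc n f = cong (_+_ (f zero)) (cong (foldr _+_ 0ℚ)
    (trans (map-tabulate suc f) (sym (map-tabulate id (f ∘ suc)))))

  -- Partially queried inputs and subcubes

  -- A coordinate of a partially queried input: unqueried and true with
  -- probability q, or already answered.
  data Coord : Set where
    free  : (q : ℚ) → 0ℚ ≤ q → q ≤ 1ℚ → Coord
    fixed : Bool → Coord

  δ : Bool → Bool → ℚ
  δ false false = 1ℚ
  δ false true  = 0ℚ
  δ true  false = 0ℚ
  δ true  true  = 1ℚ

  δ-nonNeg : ∀ b c → 0ℚ ≤ δ b c
  δ-nonNeg false false = nonNegative⁻¹ 1ℚ
  δ-nonNeg false true  = ≤-refl
  δ-nonNeg true  false = ≤-refl
  δ-nonNeg true  true  = nonNegative⁻¹ 1ℚ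

  prob : Coord → Bool → ℚ
  prob (free q _ _) true  = q
  prob (free q _ _) false = 1ℚ - q
  prob (fixed b)    c     = δ b c

  prob-nonNeg : ∀ c b → 0ℚ ≤ prob c b
  prob-nonNeg (free q 0≤q q≤1) true  = 0≤q
  prob-nonNeg (free q 0≤q q≤1) false = gap q≤1
  prob-nonNeg (fixed b)        c     = δ-nonNeg b c

  prob-total : ∀ c → prob c false + prob c true ≡ 1ℚ
  prob-total (free q _ _)  = cancel q
    where
    cancel : ∀ q → 1ℚ - q + q ≡ 1ℚ
    cancel = solve-∀ ring
  prob-total (fixed false) = refl
  prob-total (fixed true)  = refl

  State : ℕ → Set
  State = Vec Coord

  -- A fixed coordinate carries a point mass, so this is the product measure conditioned on the
  -- answers so far. Nothing is normalised, and answers of probability zero need no special case.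
  mass : ∀ {n} → State n → Input n → ℚ
  mass []      []      = 1ℚ
  mass (c ∷ s) (b ∷ x) = prob c b * mass s x

  mass-nonNeg : ∀ {n} (s : State n) x → 0ℚ ≤ mass s x
  mass-nonNeg []      []      = nonNegative⁻¹ 1ℚ
  mass-nonNeg (c ∷ s) (b ∷ x) = 0≤* (prob-nonNeg c b) (mass-nonNeg s x)

  module _ {n : ℕ} (s : State n) where

    𝔼 : (Input n → ℚ) → ℚ
    𝔼 F = ∑[ x ← inputs n ] mass s x * F x

    𝔼-cong : ∀ {F G} → (∀ x → F x ≡ G x) → 𝔼 F ≡ 𝔼 G
    𝔼-cong F≡G = ∑-cong (inputs n) (λ x → cong ((mass s x) *_) (F≡G x))

    𝔼-mono : ∀ {F G} → (∀ x → F x ≤ G x) → 𝔼 F ≤ 𝔼 G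
    𝔼-mono F≤G = ∑-mono (inputs n) (λ x → *-monoˡ (mass-nonNeg s x) (F≤G x))

    𝔼-nonNeg : ∀ {F} → (∀ x → 0ℚ ≤ F x) → 0ℚ ≤ 𝔼 F
    𝔼-nonNeg 0≤F = ∑-nonNeg (inputs n) (λ x → 0≤* (mass-nonNeg s x) (0≤F x))

    𝔼-+ : ∀ F G → 𝔼 (λ x → F x + G x) ≡ 𝔼 F + 𝔼 G
    𝔼-+ F G = trans (∑-cong (inputs n) (λ x → *-distribˡ-+ (mass s x) (F x) (G x))) (∑-+ (inputs n) (λ x → mass s x * F x) (λ x → mass s x * G x))

    𝔼-*ˡ : ∀ c F → 𝔼 (λ x → c * F x) ≡ c * 𝔼 F
    𝔼-*ˡ c F = trans (∑-cong (inputs n) (λ x → swap (mass s x) c (F x))) (∑-*ˡ c (inputs n) (λ x → mass s x * F x))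
      where
      swap : ∀ u v w → u * (v * w) ≡ v * (u * w)
      swap = solve-∀ ring

    𝔼-∑ : ∀ {A : Set} (as : List A) (F : Input n → A → ℚ) → 𝔼 (λ x → ∑ as (F x)) ≡ ∑[ a ← as ] 𝔼 (λ x → F x a)
    𝔼-∑ as F = trans (∑-cong (inputs n) (λ x → sym (∑-*ˡ (mass s x) as (F x))))
      (∑-comm (inputs n) as (λ x a → mass s x * F x a))

  𝔼-∷ : ∀ {n} c (s : State n) F →
    𝔼 (c ∷ s) F ≡ prob c false * 𝔼 s (F ∘ (false ∷_)) + prob c true * 𝔼 s (F ∘ (true ∷_))
  𝔼-∷ {n} c s F = begin
    𝔼 (c ∷ s) F
      ≡⟨ ∑-++ (map (false ∷_) (inputs n)) (map (true ∷_) (inputs n) ++ []) G ⟩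
    ∑ (map (false ∷_) (inputs n)) G + ∑ (map (true ∷_) (inputs n) ++ []) G
      ≡⟨ cong (_+_ (∑ (map (false ∷_) (inputs n)) G)) (trans (∑-++ (map (true ∷_) (inputs n)) [] G) (+-identityʳ (∑ (map (true ∷_) (inputs n)) G))) ⟩
    ∑ (map (false ∷_) (inputs n)) G + ∑ (map (true ∷_) (inputs n)) G
      ≡⟨ cong₂ _+_ (half false) (half true) ⟩
    prob c false * 𝔼 s (F ∘ (false ∷_)) + prob c true * 𝔼 s (F ∘ (true ∷_)) ∎
    where
    open ≡-Reasoning
    G : Input (ℕ.suc n) → ℚ
    G x = mass (c ∷ s) x * F x
    half : ∀ b → ∑ (map (b ∷_) (inputs n)) G ≡ prob c b * 𝔼 s (F ∘ (b ∷_))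
    half b = trans (∑-map (b ∷_) (inputs n) G)
      (trans (∑-cong (inputs n) (λ x → *-assoc (prob c b) (mass s x) (F (b ∷ x)))) (∑-*ˡ (prob c b) (inputs n) (λ x → mass s x * F (b ∷ x))))

  𝔼-1 : ∀ {n} (s : State n) → 𝔼 s (λ _ → 1ℚ) ≡ 1ℚ
  𝔼-1 []      = refl
  𝔼-1 (c ∷ s) = trans (𝔼-∷ c s (λ _ → 1ℚ))
    (trans (cong₂ (λ u v → prob c false * u + prob c true * v) (𝔼-1 s) (𝔼-1 s))
      (trans (cong₂ _+_ (*-identityʳ (prob c false)) (*-identityʳ (prob c true))) (prob-total c)))

  -- Total probability over the answer at `i`. If `i` is already fixed, one weight is 0 and the
  -- surviving state is `s` itself.
  𝔼-split : ∀ {n} (s : State n) i F →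
    𝔼 s F ≡ prob (lookup s i) false * 𝔼 (s [ i ]≔ fixed false) F + prob (lookup s i) true * 𝔼 (s [ i ]≔ fixed true) F
  𝔼-split (c ∷ s) zero F = trans (𝔼-∷ c s F)
    (cong₂ (λ u v → prob c false * u + prob c true * v)
      (sym (trans (𝔼-∷ (fixed false) s F) (left (𝔼 s (F ∘ (false ∷_))) (𝔼 s (F ∘ (true ∷_)))))) (sym (trans (𝔼-∷ (fixed true) s F) (right (𝔼 s (F ∘ (false ∷_))) (𝔼 s (F ∘ (true ∷_)))))))
    where
    left : ∀ u v → 1ℚ * u + 0ℚ * v ≡ u
    left = solve-∀ ring
    right : ∀ u v → 0ℚ * u + 1ℚ * v ≡ v
    right = solve-∀ ring
  𝔼-split (c ∷ s) (suc i) F = begin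
    𝔼 (c ∷ s) F                                      ≡⟨ 𝔼-∷ c s F ⟩
    prob c false * 𝔼 s (F ∘ (false ∷_)) + prob c true * 𝔼 s (F ∘ (true ∷_))
      ≡⟨ cong₂ (λ u v → prob c false * u + prob c true * v) (𝔼-split s i (F ∘ (false ∷_))) (𝔼-split s i (F ∘ (true ∷_))) ⟩
    prob c false * (a * e false false + b * e true false) + prob c true * (a * e false true + b * e true true)
      ≡⟨ rearrange (prob c false) (prob c true) a b (e false false) (e true false) (e false true) (e true true) ⟩
    a * (prob c false * e false false + prob c true * e false true) + b * (prob c false * e true false + prob c true * e true true)
      ≡⟨ cong₂ (λ u v → a * u + b * v) (sym (𝔼-∷ c (s [ i ]≔ fixed false) F)) (sym (𝔼-∷ c (s [ i ]≔ fixed true) F)) ⟩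
    a * 𝔼 (c ∷ (s [ i ]≔ fixed false)) F + b * 𝔼 (c ∷ (s [ i ]≔ fixed true)) F ∎
    where
    open ≡-Reasoning
    a b : ℚ
    a = prob (lookup s i) false
    b = prob (lookup s i) true
    e : Bool → Bool → ℚ
    e u v = 𝔼 (s [ i ]≔ fixed u) (F ∘ (v ∷_))
    rearrange : ∀ p q a b w x y z →
      p * (a * w + b * x) + q * (a * y + b * z) ≡ a * (p * w + q * y) + b * (p * x + q * z)
    rearrange = solve-∀ ring

  mass-off : ∀ {n} (s : State n) i b x → ¬ (lookup x i ≡ b) → mass (s [ i ]≔ fixed b) x ≡ 0ℚ
  mass-off (c ∷ s) zero    false (false ∷ x) x≢b = contradiction refl x≢b
  mass-off (c ∷ s) zero    false (true  ∷ x) x≢b = *-zeroˡ (mass s x)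
  mass-off (c ∷ s) zero    true  (false ∷ x) x≢b = *-zeroˡ (mass s x)
  mass-off (c ∷ s) zero    true  (true  ∷ x) x≢b = contradiction refl x≢b
  mass-off (c ∷ s) (suc i) b     (d     ∷ x) x≢b = trans (cong ((prob c d) *_) (mass-off s i b x x≢b)) (*-zeroʳ (prob c d))

  -- Inputs that contradict the answer have mass 0. This lets a query node be replaced by the child
  -- that the answer selects.
  𝔼-fixed-cong : ∀ {n} (s : State n) i b {F G} → (∀ x → lookup x i ≡ b → F x ≡ G x) →
    𝔼 (s [ i ]≔ fixed b) F ≡ 𝔼 (s [ i ]≔ fixed b) G
  𝔼-fixed-cong {n} s i b {F} {G} F≡G = ∑-cong (inputs n) pointwise
    where
    pointwise : ∀ x → mass (s [ i ]≔ fixed b) x * F x ≡ mass (s [ i ]≔ fixed b) x * G x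
    pointwise x with lookup x i Bool.≟ b
    ... | yes x≡b = cong (mass (s [ i ]≔ fixed b) x *_) (F≡G x x≡b)
    ... | no  x≢b rewrite mass-off s i b x x≢b = trans (*-zeroˡ (F x)) (sym (*-zeroˡ (G x)))

  -- Subcubes: indicators, measures and shared coordinates

  hit : Bool → Maybe Bool → ℚ
  hit b nothing  = 1ℚ
  hit b (just c) = δ b c

  -- Membership as a product over coordinates rather than a decision, so that the measure of a
  -- subcube factorises along with `mass`.
  ind : ∀ {n} → Input n → Assignment n → ℚ
  ind []      []      = 1ℚ
  ind (b ∷ x) (a ∷ A) = hit b a * ind x A

  hit-nonNeg : ∀ b a → 0ℚ ≤ hit b a
  hit-nonNeg b nothing  = nonNegative⁻¹ 1ℚ
  hit-nonNeg b (just c) = δ-nonNeg b c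

  ind-nonNeg : ∀ {n} (x : Input n) A → 0ℚ ≤ ind x A
  ind-nonNeg []      []      = nonNegative⁻¹ 1ℚ
  ind-nonNeg (b ∷ x) (a ∷ A) = 0≤* (hit-nonNeg b a) (ind-nonNeg x A)

  ind-∈ : ∀ {n} (x : Input n) A → x ∈ A → ind x A ≡ 1ℚ
  ind-∈ []      []      x∈A = refl
  ind-∈ (b ∷ x) (a ∷ A) x∈A = cong₂ _*_ (head b a (x∈A zero)) (ind-∈ x A (x∈A ∘ suc))
    where
    head : ∀ b a → just b ≡ a ⊎ a ≡ nothing → hit b a ≡ 1ℚ
    head false _ (inj₁ refl) = refl
    head true  _ (inj₁ refl) = refl
    head b     _ (inj₂ refl) = refl

  ind-∉ : ∀ {n} (x : Input n) A → ¬ (x ∈ A) → ind x A ≡ 0ℚ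
  ind-∉ []      []      x∉A = contradiction (λ ()) x∉A
  ind-∉ (b ∷ x) (a ∷ A) x∉A = head b a x∉A
    where
    extend : ∀ {b a} → just b ≡ a ⊎ a ≡ nothing → ¬ ((b ∷ x) ∈ (a ∷ A)) → ¬ (x ∈ A)
    extend ba x∉A x∈A = x∉A λ { zero → ba ; (suc i) → x∈A i }
    tail : ∀ {b a} → just b ≡ a ⊎ a ≡ nothing → ¬ ((b ∷ x) ∈ (a ∷ A)) → hit b a * ind x A ≡ 0ℚ
    tail {b} {a} ba x∉A = trans (cong ((hit b a) *_) (ind-∉ x A (extend ba x∉A))) (*-zeroʳ (hit b a))
    head : ∀ b a → ¬ ((b ∷ x) ∈ (a ∷ A)) → hit b a * ind x A ≡ 0ℚ
    head b     nothing      x∉A = tail (inj₂ refl) x∉A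
    head false (just false) x∉A = tail (inj₁ refl) x∉A
    head false (just true)  x∉A = *-zeroˡ (ind x A)
    head true  (just false) x∉A = *-zeroˡ (ind x A)
    head true  (just true)  x∉A = tail (inj₁ refl) x∉A

  ind-dec : ∀ {n} (x : Input n) A → ind x A ≡ (if does (x ∈? A) then 1ℚ else 0ℚ)
  ind-dec x A = go (x ∈? A)
    where
    go : (d : Dec (x ∈ A)) → ind x A ≡ (if does d then 1ℚ else 0ℚ)
    go (yes x∈A) = ind-∈ x A x∈A
    go (no  x∉A) = ind-∉ x A x∉A

  meas : ∀ {n} → State n → Assignment n → ℚ
  meas s A = 𝔼 s (λ x → ind x A)

  meas-nonNeg : ∀ {n} (s : State n) A → 0ℚ ≤ meas s A
  meas-nonNeg s A = 𝔼-nonNeg s (λ x → ind-nonNeg x A)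

  -- The factor of one coordinate in the product formula `meas-∷`.
  face : Coord → Maybe Bool → ℚ
  face c a = prob c false * hit false a + prob c true * hit true a

  face-nonNeg : ∀ c a → 0ℚ ≤ face c a
  face-nonNeg c a = 0≤+ (0≤* (prob-nonNeg c false) (hit-nonNeg false a)) (0≤* (prob-nonNeg c true) (hit-nonNeg true a))

  face-nothing : ∀ c → face c nothing ≡ 1ℚ
  face-nothing c = trans (cong₂ _+_ (*-identityʳ (prob c false)) (*-identityʳ (prob c true))) (prob-total c)

  meas-∷ : ∀ {n} c (s : State n) a A → meas (c ∷ s) (a ∷ A) ≡ face c a * meas s A
  meas-∷ c s a A = trans (𝔼-∷ c s (λ x → ind x (a ∷ A)))
    (trans (cong₂ (λ u v → prob c false * u + prob c true * v)
              (𝔼-*ˡ s (hit false a) (λ x → ind x A)) (𝔼-*ˡ s (hit true a) (λ x → ind x A)))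
           (factor (prob c false) (prob c true) (hit false a) (hit true a) (meas s A)))
    where
    factor : ∀ p q g h m → p * (g * m) + q * (h * m) ≡ (p * g + q * h) * m
    factor = solve-∀ ring

  touch : Coord → Maybe Bool → ℚ
  touch (free _ _ _) (just _) = 1ℚ
  touch _            _        = 0ℚ

  touch-nonNeg : ∀ c a → 0ℚ ≤ touch c a
  touch-nonNeg (free _ _ _) (just _) = nonNegative⁻¹ 1ℚ
  touch-nonNeg (free _ _ _) nothing  = ≤-refl
  touch-nonNeg (fixed _)    _        = ≤-refl

  touchAt : ∀ {n} → Fin n → State n → Assignment n → ℚ
  touchAt i s A = touch (lookup s i) (lookup A i)

  touchAt-nonNeg : ∀ {n} i (s : State n) A → 0ℚ ≤ touchAt i s A
  touchAt-nonNeg i s A = touch-nonNeg (lookup s i) (lookup A i)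

  size : ∀ {n} → State n → Assignment n → ℚ
  size {n} s A = ∑[ i ← allFin n ] touchAt i s A

  size-nonNeg : ∀ {n} (s : State n) A → 0ℚ ≤ size s A
  size-nonNeg {n} s A = ∑-nonNeg (allFin n) (λ i → touchAt-nonNeg i s A)

  shared : ∀ {n} → State n → Assignment n → Assignment n → ℚ
  shared {n} s A B = ∑[ i ← allFin n ] touchAt i s A * touchAt i s B

  shared-nonNeg : ∀ {n} (s : State n) A B → 0ℚ ≤ shared s A B
  shared-nonNeg {n} s A B = ∑-nonNeg (allFin n) (λ i → 0≤* (touchAt-nonNeg i s A) (touchAt-nonNeg i s B))

  -- The drop depends neither on the answer nor on whether `A` agrees with it; `Φ-split` rests on
  -- this uniformity.
  size-fix : ∀ {n} (s : State n) i b A → size s A ≡ size (s [ i ]≔ fixed b) A + touchAt i s A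
  size-fix {ℕ.suc n} (c ∷ s) zero b (a ∷ A) = trans (∑-allFin-suc n (λ i → touchAt i (c ∷ s) (a ∷ A)))
    (trans (move (touch c a) (size s A))
      (cong (_+ touch c a) (sym (∑-allFin-suc n (λ i → touchAt i (fixed b ∷ s) (a ∷ A))))))
    where
    move : ∀ t z → t + z ≡ (0ℚ + z) + t
    move = solve-∀ ring
  size-fix {ℕ.suc n} (c ∷ s) (suc i) b (a ∷ A) = trans (∑-allFin-suc n (λ i → touchAt i (c ∷ s) (a ∷ A)))
    (trans (cong (_+_ (touch c a)) (size-fix s i b A))
      (trans (sym (+-assoc (touch c a) (size (s [ i ]≔ fixed b) A) (touchAt i s A)))
        (cong (_+ touchAt i s A) (sym (∑-allFin-suc n (λ j → touchAt j (c ∷ (s [ i ]≔ fixed b)) (a ∷ A)))))))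

  -- Subcubes that share no free coordinate are independent.
  meas-product : ∀ {n} (s : State n) A B →
    meas s A * meas s B ≤ 𝔼 s (λ x → ind x A * ind x B) + meas s A * meas s B * shared s A B
  meas-product []      []      []      = ≤-refl
  meas-product {ℕ.suc n} (c ∷ s) (a ∷ A) (b ∷ B) = begin
    meas (c ∷ s) (a ∷ A) * meas (c ∷ s) (b ∷ B)
      ≡⟨ cong₂ _*_ (meas-∷ c s a A) (meas-∷ c s b B) ⟩
    face c a * meas s A * (face c b * meas s B)
      ≤⟨ step (face-or-touch c a b) ⟩
    κ * J + face c a * meas s A * (face c b * meas s B) * (touch c a * touch c b + shared s A B)
      ≡⟨ cong₂ _+_ (sym joint) (cong₂ _*_ (cong₂ _*_ (sym (meas-∷ c s a A)) (sym (meas-∷ c s b B)))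
           (sym (∑-allFin-suc n (λ i → touchAt i (c ∷ s) (a ∷ A) * touchAt i (c ∷ s) (b ∷ B))))) ⟩
    𝔼 (c ∷ s) (λ x → ind x (a ∷ A) * ind x (b ∷ B)) + meas (c ∷ s) (a ∷ A) * meas (c ∷ s) (b ∷ B) * shared (c ∷ s) (a ∷ A) (b ∷ B) ∎
    where
    open ≤-Reasoning
    J κ : ℚ
    J = 𝔼 s (λ x → ind x A * ind x B)
    κ = prob c false * (hit false a * hit false b) + prob c true * (hit true a * hit true b)
    joint : 𝔼 (c ∷ s) (λ x → ind x (a ∷ A) * ind x (b ∷ B)) ≡ κ * J
    joint = trans (𝔼-∷ c s (λ x → ind x (a ∷ A) * ind x (b ∷ B)))
      (trans (cong₂ (λ u v → prob c false * u + prob c true * v) (half false) (half true))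
        (factor (prob c false) (prob c true) (hit false a * hit false b) (hit true a * hit true b) J))
      where
      factor : ∀ p q g h m → p * (g * m) + q * (h * m) ≡ (p * g + q * h) * m
      factor = solve-∀ ring
      interchange : ∀ g u h v → g * u * (h * v) ≡ g * h * (u * v)
      interchange = solve-∀ ring
      half : ∀ d → 𝔼 s (λ x → hit d a * ind x A * (hit d b * ind x B)) ≡ hit d a * hit d b * J
      half d = trans (𝔼-cong s (λ x → interchange (hit d a) (ind x A) (hit d b) (ind x B)))
        (𝔼-*ˡ s (hit d a * hit d b) (λ x → ind x A * ind x B))
    -- Two constraints on one coordinate are independent when one is vacuous or the coordinate is
    -- already deterministic; otherwise both fix a free coordinate. The right-hand side of the first
    -- case is the local `κ`, the joint probability of both constraints there.
    face-or-touch : ∀ c a b →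
      face c a * face c b ≡ prob c false * (hit false a * hit false b) + prob c true * (hit true a * hit true b)
      ⊎ touch c a * touch c b ≡ 1ℚ
    face-or-touch c nothing b = inj₁ (trans (cong (_* face c b) (face-nothing c)) (left (prob c false) (prob c true) (hit false b) (hit true b)))
      where
      left : ∀ p q u v → 1ℚ * (p * u + q * v) ≡ p * (1ℚ * u) + q * (1ℚ * v)
      left = solve-∀ ring
    face-or-touch c (just a) nothing = inj₁ (trans (cong (_*_ (face c (just a))) (face-nothing c)) (right (prob c false) (prob c true) (δ false a) (δ true a)))
      where
      right : ∀ p q u v → (p * u + q * v) * 1ℚ ≡ p * (u * 1ℚ) + q * (v * 1ℚ)
      right = solve-∀ ring
    face-or-touch (free q _ _)  (just _)     (just _)     = inj₂ refl
    face-or-touch (fixed false) (just false) (just false) = inj₁ refl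
    face-or-touch (fixed false) (just false) (just true)  = inj₁ refl
    face-or-touch (fixed false) (just true)  (just false) = inj₁ refl
    face-or-touch (fixed false) (just true)  (just true)  = inj₁ refl
    face-or-touch (fixed true)  (just false) (just false) = inj₁ refl
    face-or-touch (fixed true)  (just false) (just true)  = inj₁ refl
    face-or-touch (fixed true)  (just true)  (just false) = inj₁ refl
    face-or-touch (fixed true)  (just true)  (just true)  = inj₁ refl
    g h m k t S : ℚ
    g = face c a
    h = face c b
    m = meas s A
    k = meas s B
    t = touch c a * touch c b
    S = shared s A B
    0≤gh : 0ℚ ≤ g * h
    0≤gh = 0≤* (face-nonNeg c a) (face-nonNeg c b)
    0≤mk : 0ℚ ≤ m * k
    0≤mk = 0≤* (meas-nonNeg s A) (meas-nonNeg s B)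
    step : g * h ≡ κ ⊎ t ≡ 1ℚ → g * m * (h * k) ≤ κ * J + g * m * (h * k) * (t + S)
    step (inj₁ gh≡κ) = ≤-since
      (0≤+ (0≤* 0≤gh (gap (meas-product s A B))) (0≤* (0≤* 0≤gh 0≤mk) (0≤* (touch-nonNeg c a) (touch-nonNeg c b))))
      (trans (cong (λ z → z * J + g * m * (h * k) * (t + S) - g * m * (h * k)) (sym gh≡κ)) (certificate g h m k J t S))
      where
      certificate : ∀ g h m k J t S → g * h * J + g * m * (h * k) * (t + S) - g * m * (h * k)
        ≡ g * h * (J + m * k * S - m * k) + g * h * (m * k) * t
      certificate = solve-∀ ring
    -- A common free coordinate makes the last term alone at least the left side.
    step (inj₂ t≡1) = ≤-since
      (0≤+ (0≤* 0≤κ (𝔼-nonNeg s (λ x → 0≤* (ind-nonNeg x A) (ind-nonNeg x B)))) (0≤* (0≤* 0≤gh 0≤mk) (shared-nonNeg s A B)))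
      (trans (cong (λ z → κ * J + g * m * (h * k) * (z + S) - g * m * (h * k)) t≡1) (certificate g h m k (κ * J) S))
      where
      0≤κ : 0ℚ ≤ κ
      0≤κ = 0≤+ (0≤* (prob-nonNeg c false) (0≤* (hit-nonNeg false a) (hit-nonNeg false b)))
                 (0≤* (prob-nonNeg c true) (0≤* (hit-nonNeg true a) (hit-nonNeg true b)))
      certificate : ∀ g h m k z S → z + g * m * (h * k) * (1ℚ + S) - g * m * (h * k) ≡ z + g * h * (m * k) * S
      certificate = solve-∀ ring

  -- The potential argument

  infixr 8 _^_

  _^_ : ℚ → ℕ → ℚ
  ρ ^ ℕ.zero  = 1ℚ
  ρ ^ ℕ.suc t = ρ * ρ ^ t

  ^-nonNeg : ∀ {ρ} → 0ℚ ≤ ρ → ∀ t → 0ℚ ≤ ρ ^ t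
  ^-nonNeg 0≤ρ ℕ.zero    = nonNegative⁻¹ 1ℚ
  ^-nonNeg 0≤ρ (ℕ.suc t) = 0≤* 0≤ρ (^-nonNeg 0≤ρ t)

  2ℚ 4ℚ ¼ ¾ : ℚ
  2ℚ = + 2 / 1
  4ℚ = + 4 / 1
  ¼ = + 1 / 4
  ¾ = + 3 / 4

  -- Two booleans differ exactly when one equals the negation of the other, so this is the indicator
  -- of an error.
  err : ∀ {n} → BoolFun n → DecisionTree n → Input n → ℚ
  err f t x = δ (not (output t x)) (f x)

  -- `κ` bounds the codimension of the listed subcubes, `e` the product of the two label weights at
  -- an input, `τ` is the influence at or below which every coordinate must lie for the tree to
  -- stop, and `ρ` the contraction of the potential per query.
  module Learning {n : ℕ} (f : BoolFun n) (As : List (Assignment n)) (w : Bool → Assignment n → ℚ)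
    (κ e τ ρ : ℚ) where

    W : Bool → Input n → ℚ
    W z x = ∑[ A ← As ] w z A * ind x A

    -- The constants ¾ and 2 stand for 1 - ε and 1: they leave room for discarding large subcubes
    -- and for rational approximation.
    module Bounds
      (w-nonNeg : ∀ z A → 0ℚ ≤ w z A)
      (small    : All (λ A → ∀ s → size s A ≤ κ) As)
      (covering : ∀ x → ¾ ≤ W (f x) x)
      (both     : ∀ x → W false x * W true x ≤ e)
      (total    : ∀ x → W false x + W true x ≤ 2ℚ)
      (0≤κ : 0ℚ ≤ κ) (0≤e : 0ℚ ≤ e) (0≤τ : 0ℚ ≤ τ) (κτ≤ : κ * τ ≤ + 1 / 24)
      (0≤ρ : 0ℚ ≤ ρ) (ρ≤1 : ρ ≤ 1ℚ) (ρ-gap : (1ℚ - ρ) * (4ℚ * κ) ≤ τ)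
      where

      W-nonNeg : ∀ z x → 0ℚ ≤ W z x
      W-nonNeg z x = ∑-nonNeg As (λ A → 0≤* (w-nonNeg z A) (ind-nonNeg x A))

      u : Assignment n → ℚ
      u A = w false A + w true A

      u-nonNeg : ∀ A → 0ℚ ≤ u A
      u-nonNeg A = 0≤+ (w-nonNeg false A) (w-nonNeg true A)

      w≤u : ∀ z A → w z A ≤ u A
      w≤u false A = ≤-since (w-nonNeg true A) (p+q-p≡q (w false A) (w true A))
      w≤u true A = ≤-since (w-nonNeg false A) (p+q-q≡p (w false A) (w true A))

      module _ (s : State n) where

        Q : Bool → ℚ
        Q z = 𝔼 s (W z)

        P : Bool → ℚ
        P z = 𝔼 s (λ x → δ z (f x))

        Φ : ℚ
        Φ = ∑[ A ← As ] u A * meas s A * size s A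

        -- By `Φ-split`, this is the expected decrease of `Φ` when `i` is queried.
        influence : Fin n → ℚ
        influence i = ∑[ A ← As ] u A * meas s A * touchAt i s A

        Q-meas : ∀ z → Q z ≡ ∑[ A ← As ] w z A * meas s A
        Q-meas z = trans (𝔼-∑ s As (λ x A → w z A * ind x A)) (∑-cong As (λ A → 𝔼-*ˡ s (w z A) (λ x → ind x A)))

        Q-nonNeg : ∀ z → 0ℚ ≤ Q z
        Q-nonNeg z = 𝔼-nonNeg s (W-nonNeg z)

        Q+Q≤2 : Q false + Q true ≤ 2ℚ
        Q+Q≤2 = begin
          Q false + Q true                    ≡⟨ sym (𝔼-+ s (W false) (W true)) ⟩
          𝔼 s (λ x → W false x + W true x)    ≤⟨ 𝔼-mono s total ⟩
          𝔼 s (λ x → 2ℚ * 1ℚ)                 ≡⟨ 𝔼-*ˡ s 2ℚ (λ _ → 1ℚ) ⟩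
          2ℚ * 𝔼 s (λ _ → 1ℚ)                 ≡⟨ cong (2ℚ *_) (𝔼-1 s) ⟩
          2ℚ                                  ∎
          where open ≤-Reasoning

        Φ-nonNeg : 0ℚ ≤ Φ
        Φ-nonNeg = ∑-nonNeg As (λ A → 0≤* (0≤* (u-nonNeg A) (meas-nonNeg s A)) (size-nonNeg s A))

        -- Every size is at most `κ` and the weighted measures add up to at most 2. Neither fact
        -- depends on the state, so the bound survives all queries.
        Φ≤2κ : Φ ≤ 2ℚ * κ
        Φ≤2κ = begin
          Φ
            ≤⟨ ∑-mono-All small (λ A A≤κ → *-monoˡ (0≤* (u-nonNeg A) (meas-nonNeg s A)) (A≤κ s)) ⟩
          ∑[ A ← As ] (w false A + w true A) * meas s A * κ
            ≡⟨ ∑-cong As (λ A → distribute (w false A) (w true A) (meas s A) κ) ⟩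
          ∑[ A ← As ] κ * (w false A * meas s A + w true A * meas s A)
            ≡⟨ ∑-*ˡ κ As (λ A → w false A * meas s A + w true A * meas s A) ⟩
          κ * (∑[ A ← As ] (w false A * meas s A + w true A * meas s A))
            ≡⟨ cong (κ *_) (∑-+ As (λ A → w false A * meas s A) (λ A → w true A * meas s A)) ⟩
          κ * ((∑[ A ← As ] w false A * meas s A) + (∑[ A ← As ] w true A * meas s A))
            ≡⟨ cong₂ (λ a b → κ * (a + b)) (sym (Q-meas false)) (sym (Q-meas true)) ⟩
          κ * (Q false + Q true)
            ≤⟨ *-monoˡ 0≤κ Q+Q≤2 ⟩
          κ * 2ℚ
            ≡⟨ *-comm κ 2ℚ ⟩
          2ℚ * κ ∎
          where
          open ≤-Reasoning
          distribute : ∀ a b m k → (a + b) * m * k ≡ k * (a * m + b * m)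
          distribute = solve-∀ ring

        -- Converts the weight of a label into the probability of the corresponding value: wherever
        -- f takes the value `z`, that label has weight at least ¾.
        covering-mass : ∀ z → ¾ * P z ≤ Q z
        covering-mass z = ≤-trans (≤-reflexive (sym (𝔼-*ˡ s ¾ (λ x → δ z (f x)))))
          (𝔼-mono s (λ x → pointwise z (f x) x (covering x)))
          where
          pointwise : ∀ z y x → ¾ ≤ W y x → ¾ * δ z y ≤ W z x
          pointwise false false x h = h
          pointwise false true  x h = W-nonNeg false x
          pointwise true  false x h = W-nonNeg true x
          pointwise true  true  x h = h

        P-total : P false + P true ≡ 1ℚ
        P-total = trans (sym (𝔼-+ s (λ x → δ false (f x)) (λ x → δ true (f x))))
          (trans (𝔼-cong s (λ x → one (f x))) (𝔼-1 s))
          where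
          one : ∀ y → δ false y + δ true y ≡ 1ℚ
          one false = refl
          one true  = refl

        P≤1 : ∀ z → P z ≤ 1ℚ
        P≤1 z = ≤-trans (𝔼-mono s (λ x → δ≤1 z (f x))) (≤-reflexive (𝔼-1 s))
          where
          δ≤1 : ∀ b c → δ b c ≤ 1ℚ
          δ≤1 false false = ≤-refl
          δ≤1 false true  = nonNegative⁻¹ 1ℚ
          δ≤1 true  false = nonNegative⁻¹ 1ℚ
          δ≤1 true  true  = ≤-refl

        both′ : ∀ z x → W z x * W (not z) x ≤ e
        both′ false x = both x
        both′ true  x = ≤-trans (≤-reflexive (*-comm (W true x) (W false x))) (both x)

        -- Pairs of z- and (not z)-subcubes are either independent, and then
        -- rarely chosen since every input carries little weight of the wrong
        -- label, or they share a coordinate, which the influences account for.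
        Q*Q≤ : (∀ i → influence i ≤ τ) → ∀ z → Q z * Q (not z) ≤ e + Q (not z) * (κ * τ)
        Q*Q≤ low z = begin
          Q z * Q z′
            ≡⟨ cong₂ _*_ (Q-meas z) (Q-meas z′) ⟩
          (∑[ A ← As ] w z A * meas s A) * (∑[ B ← As ] w z′ B * meas s B)
            ≡⟨ ∑-product As As (λ A → w z A * meas s A) (λ B → w z′ B * meas s B) ⟩
          ∑[ B ← As ] ∑[ A ← As ] w z A * meas s A * (w z′ B * meas s B)
            ≤⟨ ∑-mono As (λ B → ∑-mono As (λ A → pair A B)) ⟩
          ∑[ B ← As ] ∑[ A ← As ] (joint A B + clash A B)
            ≡⟨ ∑-cong As (λ B → ∑-+ As (λ A → joint A B) (λ A → clash A B)) ⟩
          ∑[ B ← As ] ((∑[ A ← As ] joint A B) + (∑[ A ← As ] clash A B))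
            ≡⟨ ∑-+ As (λ B → ∑[ A ← As ] joint A B) (λ B → ∑[ A ← As ] clash A B) ⟩
          (∑[ B ← As ] ∑[ A ← As ] joint A B) + (∑[ B ← As ] ∑[ A ← As ] clash A B)
            ≤⟨ +-mono-≤ joint≤e clashes ⟩
          e + Q z′ * (κ * τ) ∎
          where
          open ≤-Reasoning
          z′ : Bool
          z′ = not z
          joint clash : Assignment n → Assignment n → ℚ
          joint A B = w z A * w z′ B * 𝔼 s (λ x → ind x A * ind x B)
          clash A B = w z A * meas s A * (w z′ B * meas s B) * shared s A B
          pair : ∀ A B → w z A * meas s A * (w z′ B * meas s B) ≤ joint A B + clash A B
          pair A B = ≤-since (0≤* (0≤* (w-nonNeg z A) (w-nonNeg z′ B)) (gap (meas-product s A B)))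
            (certificate (w z A) (meas s A) (w z′ B) (meas s B) (𝔼 s (λ x → ind x A * ind x B)) (shared s A B))
            where
            certificate : ∀ a m b k J S → a * b * J + a * m * (b * k) * S - a * m * (b * k) ≡ a * b * (J + m * k * S - m * k)
            certificate = solve-∀ ring
          -- Exchanging the sums with `𝔼` turns pairs of subcubes into the product of the two label
          -- weights at a single input, which `both` bounds.
          joint≤e : ∑[ B ← As ] (∑[ A ← As ] joint A B) ≤ e
          joint≤e = begin
            ∑[ B ← As ] ∑[ A ← As ] joint A B
              ≡⟨ ∑-cong As (λ B → ∑-cong As (λ A → trans (sym (𝔼-*ˡ s (w z A * w z′ B) (λ x → ind x A * ind x B)))
                   (𝔼-cong s (λ x → interchange (w z A) (w z′ B) (ind x A) (ind x B))))) ⟩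
            ∑[ B ← As ] ∑[ A ← As ] 𝔼 s (λ x → w z A * ind x A * (w z′ B * ind x B))
              ≡⟨ ∑-cong As (λ B → sym (𝔼-∑ s As (λ x A → w z A * ind x A * (w z′ B * ind x B)))) ⟩
            ∑[ B ← As ] 𝔼 s (λ x → ∑[ A ← As ] w z A * ind x A * (w z′ B * ind x B))
              ≡⟨ sym (𝔼-∑ s As (λ x B → ∑[ A ← As ] w z A * ind x A * (w z′ B * ind x B))) ⟩
            𝔼 s (λ x → ∑[ B ← As ] ∑[ A ← As ] w z A * ind x A * (w z′ B * ind x B))
              ≡⟨ 𝔼-cong s (λ x → sym (∑-product As As (λ A → w z A * ind x A) (λ B → w z′ B * ind x B))) ⟩
            𝔼 s (λ x → W z x * W z′ x)
              ≤⟨ 𝔼-mono s (λ x → ≤-trans (both′ z x) (≤-reflexive (sym (*-identityʳ e)))) ⟩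
            𝔼 s (λ x → e * 1ℚ)
              ≡⟨ trans (𝔼-*ˡ s e (λ _ → 1ℚ)) (trans (cong (e *_) (𝔼-1 s)) (*-identityʳ e)) ⟩
            e ∎
            where
            interchange : ∀ a b i j → a * b * (i * j) ≡ a * i * (b * j)
            interchange = solve-∀ ring
          low′ : ∀ i → ∑[ A ← As ] w z A * meas s A * touchAt i s A ≤ τ
          low′ i = ≤-trans (∑-mono As (λ A → *-mono-≤ (0≤* (u-nonNeg A) (meas-nonNeg s A)) (touchAt-nonNeg i s A)
            (*-mono-≤ (u-nonNeg A) (meas-nonNeg s A) (w≤u z A) ≤-refl) ≤-refl)) (low i)
          -- A union bound: `B` has at most `κ` free coordinates, and the z-subcubes fixing any
          -- given one of them have total weighted measure at most `τ`.
          clash-B : ∀ B → (∀ s → size s B ≤ κ) → ∑[ A ← As ] clash A B ≤ w z′ B * meas s B * (κ * τ)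
          clash-B B B≤κ = begin
            ∑[ A ← As ] w z A * meas s A * k * shared s A B
              ≡⟨ ∑-cong As (λ A → trans (swap (w z A * meas s A) k (shared s A B))
                   (cong (k *_) (sym (∑-*ˡ (w z A * meas s A) (allFin n) (λ i → touchAt i s A * touchAt i s B))))) ⟩
            ∑[ A ← As ] k * (∑[ i ← allFin n ] w z A * meas s A * (touchAt i s A * touchAt i s B))
              ≡⟨ ∑-*ˡ k As (λ A → ∑[ i ← allFin n ] w z A * meas s A * (touchAt i s A * touchAt i s B)) ⟩
            k * (∑[ A ← As ] ∑[ i ← allFin n ] w z A * meas s A * (touchAt i s A * touchAt i s B))
              ≡⟨ cong (k *_) (∑-comm As (allFin n) (λ A i → w z A * meas s A * (touchAt i s A * touchAt i s B))) ⟩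
            k * (∑[ i ← allFin n ] ∑[ A ← As ] w z A * meas s A * (touchAt i s A * touchAt i s B))
              ≡⟨ cong (k *_) (∑-cong (allFin n) (λ i → trans
                   (∑-cong As (λ A → pull (w z A * meas s A) (touchAt i s A) (touchAt i s B)))
                   (∑-*ˡ (touchAt i s B) As (λ A → w z A * meas s A * touchAt i s A)))) ⟩
            k * (∑[ i ← allFin n ] touchAt i s B * (∑[ A ← As ] w z A * meas s A * touchAt i s A))
              ≤⟨ *-monoˡ 0≤k (∑-mono (allFin n) (λ i → *-monoˡ (touchAt-nonNeg i s B) (low′ i))) ⟩
            k * (∑[ i ← allFin n ] touchAt i s B * τ)
              ≡⟨ cong (k *_) (∑-*ʳ τ (allFin n) (λ i → touchAt i s B)) ⟩
            k * (size s B * τ)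
              ≤⟨ *-monoˡ 0≤k (*-mono-≤ 0≤κ 0≤τ (B≤κ s) ≤-refl) ⟩
            k * (κ * τ) ∎
            where
            k : ℚ
            k = w z′ B * meas s B
            0≤k : 0ℚ ≤ k
            0≤k = 0≤* (w-nonNeg z′ B) (meas-nonNeg s B)
            swap : ∀ a b c → a * b * c ≡ b * (a * c)
            swap = solve-∀ ring
            pull : ∀ a b c → a * (b * c) ≡ c * (a * b)
            pull = solve-∀ ring
          clashes : ∑[ B ← As ] (∑[ A ← As ] clash A B) ≤ Q z′ * (κ * τ)
          clashes = begin
            ∑[ B ← As ] ∑[ A ← As ] clash A B               ≤⟨ ∑-mono-All small clash-B ⟩
            ∑[ B ← As ] w z′ B * meas s B * (κ * τ)         ≡⟨ ∑-*ʳ (κ * τ) As (λ B → w z′ B * meas s B) ⟩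
            (∑[ B ← As ] w z′ B * meas s B) * (κ * τ)       ≡⟨ cong (_* (κ * τ)) (sym (Q-meas z′)) ⟩
            Q z′ * (κ * τ)                                  ∎

        -- Covering gives Q z ≥ ¾ · ½ = 3/8. Since κτ ≤ 1/24, `Q*Q≤` yields Q (not z) · (3/8 - 1/24)
        -- ≤ e, that is Q (not z) ≤ 3e, and covering once more gives 4/3 · 3e = 4e.
        minority : (∀ i → influence i ≤ τ) → ∀ z → ½ ≤ P z → P (not z) ≤ 4ℚ * e
        minority low z half = ≤-since
          (0≤+ (0≤+ (0≤+ (0≤+ (0≤* 0≤4 (gap (Q*Q≤ low z))) (0≤* 0≤4Q (gap κτ≤))) (0≤* 0≤4Q (gap (covering-mass z))))
            (0≤* (0≤* 0≤4Q (nonNegative⁻¹ ¾)) (gap half)))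
            (0≤* (nonNegative⁻¹ (+ 4 / 3)) (gap (covering-mass (not z)))))
          (certificate e (Q z) (Q (not z)) (P z) (P (not z)) (κ * τ))
          where
          0≤4 : 0ℚ ≤ 4ℚ
          0≤4 = nonNegative⁻¹ 4ℚ
          0≤4Q : 0ℚ ≤ 4ℚ * Q (not z)
          0≤4Q = 0≤* 0≤4 (Q-nonNeg (not z))
          certificate : ∀ e q q′ p p′ k → 4ℚ * e - p′ ≡
            4ℚ * (e + q′ * k - q * q′) + 4ℚ * q′ * (+ 1 / 24 - k) + 4ℚ * q′ * (q - ¾ * p)
            + 4ℚ * q′ * ¾ * (p - ½) + + 4 / 3 * (q′ - ¾ * p′)
          certificate = solve-∀ ring

      -- The measure of a subcube is a martingale under queries, while its size falls by the same
      -- amount for either answer; so the average drop is exactly the influence.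
      Φ-split : ∀ s i → Φ s ≡ prob (lookup s i) false * Φ (s [ i ]≔ fixed false)
        + prob (lookup s i) true * Φ (s [ i ]≔ fixed true) + influence s i
      Φ-split s i = begin
        Φ s
          ≡⟨ ∑-cong As pointwise ⟩
        ∑[ A ← As ] (a * v false A + b * v true A + t A)
          ≡⟨ ∑-+ As (λ A → a * v false A + b * v true A) t ⟩
        (∑[ A ← As ] (a * v false A + b * v true A)) + influence s i
          ≡⟨ cong (_+ influence s i) (trans (∑-+ As (λ A → a * v false A) (λ A → b * v true A))
               (cong₂ _+_ (∑-*ˡ a As (v false)) (∑-*ˡ b As (v true)))) ⟩
        a * Φ (s [ i ]≔ fixed false) + b * Φ (s [ i ]≔ fixed true) + influence s i ∎
        where
        open ≡-Reasoning
        a b : ℚ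
        a = prob (lookup s i) false
        b = prob (lookup s i) true
        v : Bool → Assignment n → ℚ
        v c A = u A * meas (s [ i ]≔ fixed c) A * size (s [ i ]≔ fixed c) A
        t : Assignment n → ℚ
        t A = u A * meas s A * touchAt i s A
        pointwise : ∀ A → u A * meas s A * size s A ≡ a * v false A + b * v true A + t A
        pointwise A = begin
          u A * meas s A * size s A
            ≡⟨ cong (λ m → u A * m * size s A) split ⟩
          u A * (a * x + b * y) * size s A
            ≡⟨ expand (u A) a b x y (size s A) ⟩
          a * (u A * x * size s A) + b * (u A * y * size s A)
            ≡⟨ cong₂ (λ k l → a * (u A * x * k) + b * (u A * y * l)) (size-fix s i false A) (size-fix s i true A) ⟩
          a * (u A * x * (k + τᵢ)) + b * (u A * y * (l + τᵢ))
            ≡⟨ collect (u A) a b x y k l τᵢ ⟩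
          a * (u A * x * k) + b * (u A * y * l) + u A * (a * x + b * y) * τᵢ
            ≡⟨ cong (λ m → a * (u A * x * k) + b * (u A * y * l) + u A * m * τᵢ) (sym split) ⟩
          a * v false A + b * v true A + t A ∎
          where
          x y k l τᵢ : ℚ
          x = meas (s [ i ]≔ fixed false) A
          y = meas (s [ i ]≔ fixed true) A
          k = size (s [ i ]≔ fixed false) A
          l = size (s [ i ]≔ fixed true) A
          τᵢ = touchAt i s A
          split : meas s A ≡ a * x + b * y
          split = 𝔼-split s i (λ x → ind x A)
          expand : ∀ u a b x y z → u * (a * x + b * y) * z ≡ a * (u * x * z) + b * (u * y * z)
          expand = solve-∀ ring
          collect : ∀ u a b x y k l t → a * (u * x * (k + t)) + b * (u * y * (l + t))
            ≡ a * (u * x * k) + b * (u * y * l) + u * (a * x + b * y) * t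
          collect = solve-∀ ring

      half-total : ∀ {p q} → p + q ≡ 1ℚ → (½ ≤ p) ⊎ (½ ≤ q)
      half-total {p} {q} p+q≡1 with ½ ≤? p
      ... | yes ½≤p = inj₁ ½≤p
      ... | no  ½≰p = inj₂ (≤-since (gap (<⇒≤ (≰⇒> ½≰p))) (trans (shift p q) (trans (cong (λ z → z - ½ - p) p+q≡1) (halve p))))
        where
        shift : ∀ p q → q - ½ ≡ p + q - ½ - p
        shift = solve-∀ ring
        halve : ∀ p → 1ℚ - ½ - p ≡ ½ - p
        halve = solve-∀ ring

      good-leaf : ∀ s → (∀ i → influence s i ≤ τ) → ∃[ b ] 𝔼 s (err f (leaf b)) ≤ 4ℚ * e
      good-leaf s low with half-total (P-total s)
      -- The error of `leaf b` is by definition `P s (not b)`, so the majority value is output.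
      ... | inj₁ ½≤P = false , minority s low false ½≤P
      ... | inj₂ ½≤P = true  , minority s low true ½≤P

      𝔼-query : ∀ s i child → 𝔼 s (err f (query i child)) ≡
        prob (lookup s i) false * 𝔼 (s [ i ]≔ fixed false) (err f (child false))
        + prob (lookup s i) true * 𝔼 (s [ i ]≔ fixed true) (err f (child true))
      𝔼-query s i child = trans (𝔼-split s i (err f (query i child)))
        (cong₂ (λ a b → prob (lookup s i) false * a + prob (lookup s i) true * b) (branch false) (branch true))
        where
        branch : ∀ b → 𝔼 (s [ i ]≔ fixed b) (err f (query i child)) ≡ 𝔼 (s [ i ]≔ fixed b) (err f (child b))
        branch b = 𝔼-fixed-cong s i b (λ x x≡b → cong (λ c → err f (child c) x) x≡b)

      -- The hypothesis on `r` makes the scaled potential at least 1 everywhere, so it dominates the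
      -- error of a branch cut off by the budget `T`; each query multiplies its expectation by at
      -- most `ρ`.
      tree : ∀ r → 0ℚ ≤ r → 1ℚ ≤ r * (2ℚ * κ) → ∀ T s →
        ∃[ t ] (∀ x → queries t x ℕ.≤ T) × 𝔼 s (err f t) ≤ 4ℚ * e + r * ρ ^ T * (2ℚ * κ + Φ s)
      -- The budget is exhausted: an arbitrary answer is given and its error bounded by 1.
      tree r 0≤r 1≤r ℕ.zero s = leaf false , (λ _ → ℕ.z≤n) , ≤-trans (P≤1 s true) (≤-since
        (0≤+ (0≤+ (0≤* (nonNegative⁻¹ 4ℚ) 0≤e) (gap 1≤r)) (0≤* 0≤r (Φ-nonNeg s)))
        (certificate e r κ (Φ s)))
        where
        certificate : ∀ e r k φ → 4ℚ * e + r * 1ℚ * (2ℚ * k + φ) - 1ℚ ≡ 4ℚ * e + (r * (2ℚ * k) - 1ℚ) + r * φ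
        certificate = solve-∀ ring
      tree r 0≤r 1≤r (ℕ.suc T) s with Fin.all? (λ i → influence s i ≤? τ)
      ... | yes low = leaf (proj₁ (good-leaf s low)) , (λ _ → ℕ.z≤n) ,
        ≤-since (0≤+ (gap (proj₂ (good-leaf s low))) (0≤* 0≤R (0≤+ (0≤* (nonNegative⁻¹ 2ℚ) 0≤κ) (Φ-nonNeg s))))
          (move (4ℚ * e) (r * (ρ * ρ ^ T) * (2ℚ * κ + Φ s)) (𝔼 s (err f (leaf (proj₁ (good-leaf s low))))))
        where
        0≤R : 0ℚ ≤ r * (ρ * ρ ^ T)
        0≤R = 0≤* 0≤r (0≤* 0≤ρ (^-nonNeg 0≤ρ T))
        move : ∀ a b c → a + b - c ≡ (a - c) + b
        move = solve-∀ ring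
      ... | no ¬low = query i child , (λ x → ℕ.s≤s (proj₁ (proj₂ (IH (lookup x i))) x)) , (begin
        𝔼 s (err f (query i child))
          ≡⟨ 𝔼-query s i child ⟩
        a * 𝔼 (s [ i ]≔ fixed false) (err f (child false)) + b * 𝔼 (s [ i ]≔ fixed true) (err f (child true))
          ≤⟨ +-mono-≤ (*-monoˡ (prob-nonNeg (lookup s i) false) (proj₂ (proj₂ (IH false))))
                      (*-monoˡ (prob-nonNeg (lookup s i) true) (proj₂ (proj₂ (IH true)))) ⟩
        a * (4ℚ * e + R * (2ℚ * κ + φ false)) + b * (4ℚ * e + R * (2ℚ * κ + φ true))
          ≡⟨ average a b (4ℚ * e) R (2ℚ * κ) (φ false) (φ true) (influence s i) ⟩
        (a + b) * (4ℚ * e + R * (2ℚ * κ)) + R * (a * φ false + b * φ true + influence s i) - R * influence s i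
          ≡⟨ cong₂ (λ c d → c * (4ℚ * e + R * (2ℚ * κ)) + R * d - R * influence s i) (prob-total (lookup s i)) (sym (Φ-split s i)) ⟩
        1ℚ * (4ℚ * e + R * (2ℚ * κ)) + R * Φ s - R * influence s i
          -- The contraction: (1 - ρ)(2κ + Φ) ≤ (1 - ρ) · 4κ ≤ τ, and the influence of the queried
          -- coordinate exceeds τ.
          ≤⟨ ≤-since (0≤* 0≤R (0≤+ (0≤+ (0≤* (gap ρ≤1) (gap (Φ≤2κ s))) (gap ρ-gap)) (gap (<⇒≤ (≰⇒> i-high)))))
               (certificate (4ℚ * e) r (ρ ^ T) ρ κ (Φ s) (influence s i) τ) ⟩
        4ℚ * e + r * (ρ * ρ ^ T) * (2ℚ * κ + Φ s) ∎)
        where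
        open ≤-Reasoning
        exceeding = Fin.¬∀⟶∃¬ n (λ i → influence s i ≤ τ) (λ i → influence s i ≤? τ) ¬low
        i : Fin n
        i = proj₁ exceeding
        i-high = proj₂ exceeding
        IH : ∀ c → ∃[ t ] (∀ x → queries t x ℕ.≤ T) ×
          𝔼 (s [ i ]≔ fixed c) (err f t) ≤ 4ℚ * e + r * ρ ^ T * (2ℚ * κ + Φ (s [ i ]≔ fixed c))
        IH c = tree r 0≤r 1≤r T (s [ i ]≔ fixed c)
        child : Bool → DecisionTree n
        child c = proj₁ (IH c)
        a b R : ℚ
        a = prob (lookup s i) false
        b = prob (lookup s i) true
        R = r * ρ ^ T
        φ : Bool → ℚ
        φ c = Φ (s [ i ]≔ fixed c)
        0≤R : 0ℚ ≤ R
        0≤R = 0≤* 0≤r (^-nonNeg 0≤ρ T)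
        average : ∀ a b c R k p q ι → a * (c + R * (k + p)) + b * (c + R * (k + q)) ≡
          (a + b) * (c + R * k) + R * (a * p + b * q + ι) - R * ι
        average = solve-∀ ring
        certificate : ∀ c r g ρ k φ ι τ →
          c + r * (ρ * g) * (2ℚ * k + φ) - (1ℚ * (c + r * g * (2ℚ * k)) + r * g * φ - r * g * ι) ≡
          r * g * ((1ℚ - ρ) * (2ℚ * k - φ) + (τ - (1ℚ - ρ) * (4ℚ * k)) + (ι - τ))
        certificate = solve-∀ ring

  -- Truncation to small subcubes and the depth of the tree

  -- Sealed, since unfolding + n / 1 computes a gcd.
  abstract
    ι : ℕ → ℚ
    ι n = + n / 1

    ι-≡ : ∀ n → ι n ≡ + n / 1
    ι-≡ n = refl

    toℚᵘ-ι : ∀ n → toℚᵘ (ι n) ℚᵘ.≃ ℚᵘ.mkℚᵘ (+ n) 0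
    toℚᵘ-ι n = toℚᵘ-fromℚᵘ (ℚᵘ.mkℚᵘ (+ n) 0)

    ι-+ : ∀ m n → ι (m ℕ.+ n) ≡ ι m + ι n
    ι-+ m n = toℚᵘ-injective (begin
      toℚᵘ (ι (m ℕ.+ n))                          ≈⟨ toℚᵘ-ι (m ℕ.+ n) ⟩
      ℚᵘ.mkℚᵘ (+ (m ℕ.+ n)) 0                     ≈⟨ ℚᵘ.*≡* (cong (ℤ._* + 1) (cong₂ ℤ._+_ (sym (ℤ.*-identityʳ (+ m))) (sym (ℤ.*-identityʳ (+ n))))) ⟩
      ℚᵘ.mkℚᵘ (+ m) 0 ℚᵘ.+ ℚᵘ.mkℚᵘ (+ n) 0        ≈⟨ ℚᵘ.≃-sym (ℚᵘ.+-cong (toℚᵘ-ι m) (toℚᵘ-ι n)) ⟩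
      toℚᵘ (ι m) ℚᵘ.+ toℚᵘ (ι n)                  ≈⟨ ℚᵘ.≃-sym (toℚᵘ-homo-+ (ι m) (ι n)) ⟩
      toℚᵘ (ι m + ι n)                            ∎)
      where open ℚᵘ.≃-Reasoning

    ι-* : ∀ m n → ι (m ℕ.* n) ≡ ι m * ι n
    ι-* m n = toℚᵘ-injective (begin
      toℚᵘ (ι (m ℕ.* n))                          ≈⟨ toℚᵘ-ι (m ℕ.* n) ⟩
      ℚᵘ.mkℚᵘ (+ (m ℕ.* n)) 0                     ≈⟨ ℚᵘ.*≡* (cong (ℤ._* + 1) (ℤ.pos-* m n)) ⟩
      ℚᵘ.mkℚᵘ (+ m) 0 ℚᵘ.* ℚᵘ.mkℚᵘ (+ n) 0        ≈⟨ ℚᵘ.≃-sym (ℚᵘ.*-cong (toℚᵘ-ι m) (toℚᵘ-ι n)) ⟩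
      toℚᵘ (ι m) ℚᵘ.* toℚᵘ (ι n)                  ≈⟨ ℚᵘ.≃-sym (toℚᵘ-homo-* (ι m) (ι n)) ⟩
      toℚᵘ (ι m * ι n)                            ∎)
      where open ℚᵘ.≃-Reasoning

    ι-mono : ∀ {m n} → m ℕ.≤ n → ι m ≤ ι n
    ι-mono {m} {n} m≤n = toℚᵘ-cancel-≤ (begin
      toℚᵘ (ι m)         ≃⟨ toℚᵘ-ι m ⟩
      ℚᵘ.mkℚᵘ (+ m) 0    ≤⟨ ℚᵘ.*≤* (ℤ.*-monoʳ-≤-nonNeg (+ 1) (ℤ.+≤+ m≤n)) ⟩
      ℚᵘ.mkℚᵘ (+ n) 0    ≃⟨ ℚᵘ.≃-sym (toℚᵘ-ι n) ⟩
      toℚᵘ (ι n)         ∎)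
      where open ℚᵘ.≤-Reasoning

  ι-nonNeg : ∀ n → 0ℚ ≤ ι n
  ι-nonNeg n = ≤-trans (≤-reflexive (sym (ι-≡ 0))) (ι-mono {0} ℕ.z≤n)

  ι-suc : ∀ n → ι (ℕ.suc n) ≡ 1ℚ + ι n
  ι-suc n = trans (ι-+ 1 n) (cong (_+ ι n) (ι-≡ 1))

  1≤ι : ∀ {n} → 1 ℕ.≤ n → 1ℚ ≤ ι n
  1≤ι 1≤n = ≤-trans (≤-reflexive (sym (ι-≡ 1))) (ι-mono 1≤n)

  ι-2^suc : ∀ k → ι (2 ℕ.^ ℕ.suc k) ≡ 2ℚ * ι (2 ℕ.^ k)
  ι-2^suc k = trans (ι-* 2 (2 ℕ.^ k)) (cong (_* ι (2 ℕ.^ k)) (ι-≡ 2))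

  ι-2^0 : ι (2 ℕ.^ 0) ≡ 1ℚ
  ι-2^0 = ι-≡ 1

  -- Bernoulli's inequality in reciprocal form, an upper bound on powers of 1 - y that needs no
  -- exponential function.
  bernoulli : ∀ y → 0ℚ ≤ y → y ≤ 1ℚ → ∀ t → (1ℚ - y) ^ t * (1ℚ + ι t * y) ≤ 1ℚ
  bernoulli y 0≤y y≤1 ℕ.zero    = ≤-reflexive (trans (cong (λ z → 1ℚ * (1ℚ + z * y)) (ι-≡ 0)) (vanish y))
    where
    vanish : ∀ y → 1ℚ * (1ℚ + 0ℚ * y) ≡ 1ℚ
    vanish = solve-∀ ring
  bernoulli y 0≤y y≤1 (ℕ.suc t) = ≤-since
    (0≤+ (gap (bernoulli y 0≤y y≤1 t))
         (0≤* (^-nonNeg (gap y≤1) t) (0≤* 0≤y (0≤+ (0≤* (ι-nonNeg t) 0≤y) 0≤y))))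
    (trans (cong (λ j → 1ℚ - (1ℚ - y) * g * (1ℚ + j * y)) (ι-suc t)) (certificate g y (ι t)))
    where
    g : ℚ
    g = (1ℚ - y) ^ t
    certificate : ∀ g y t → 1ℚ - (1ℚ - y) * g * (1ℚ + (1ℚ + t) * y) ≡ (1ℚ - g * (1ℚ + t * y)) + g * (y * (t * y + y))
    certificate = solve-∀ ring

  ^-+ : ∀ ρ a b → ρ ^ (a ℕ.+ b) ≡ ρ ^ a * ρ ^ b
  ^-+ ρ ℕ.zero    b = sym (*-identityˡ (ρ ^ b))
  ^-+ ρ (ℕ.suc a) b = trans (cong (ρ *_) (^-+ ρ a b)) (sym (*-assoc ρ (ρ ^ a) (ρ ^ b)))

  -- With ι M · y = 1, `bernoulli` bounds each block of `M` factors by ½. The power of 2 is kept on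
  -- the left to avoid a division.
  halving : ∀ y M → 0ℚ ≤ y → y ≤ 1ℚ → ι M * y ≡ 1ℚ → ∀ m → (1ℚ - y) ^ (m ℕ.* M) * ι (2 ℕ.^ m) ≤ 1ℚ
  halving y M 0≤y y≤1 My≡1 ℕ.zero = ≤-reflexive (cong (1ℚ *_) ι-2^0)
  halving y M 0≤y y≤1 My≡1 (ℕ.suc m) = begin
    ρ ^ (M ℕ.+ m ℕ.* M) * ι (2 ℕ.^ ℕ.suc m)             ≡⟨ cong₂ _*_ (^-+ ρ M (m ℕ.* M)) (ι-2^suc m) ⟩
    ρ ^ M * ρ ^ (m ℕ.* M) * (2ℚ * ι (2 ℕ.^ m))          ≡⟨ interchange (ρ ^ M) (ρ ^ (m ℕ.* M)) 2ℚ (ι (2 ℕ.^ m)) ⟩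
    ρ ^ M * 2ℚ * (ρ ^ (m ℕ.* M) * ι (2 ℕ.^ m))          ≤⟨ *-mono-≤ (nonNegative⁻¹ 1ℚ) (0≤* (^-nonNeg 0≤ρ (m ℕ.* M)) (ι-nonNeg (2 ℕ.^ m))) half (halving y M 0≤y y≤1 My≡1 m) ⟩
    1ℚ * 1ℚ                                             ∎
    where
    open ≤-Reasoning
    ρ : ℚ
    ρ = 1ℚ - y
    0≤ρ : 0ℚ ≤ ρ
    0≤ρ = gap y≤1
    half : ρ ^ M * 2ℚ ≤ 1ℚ
    half = ≤-trans (≤-reflexive (cong (λ z → ρ ^ M * (1ℚ + z)) (sym My≡1))) (bernoulli y 0≤y y≤1 M)
    interchange : ∀ a b c d → a * b * (c * d) ≡ a * c * (b * d)
    interchange = solve-∀ ring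

  ind≤1 : ∀ {n} (x : Input n) A → ind x A ≤ 1ℚ
  ind≤1 []      []      = ≤-refl
  ind≤1 (b ∷ x) (a ∷ A) = *-mono-≤ (nonNegative⁻¹ 1ℚ) (ind-nonNeg x A) (hit≤1 b a) (ind≤1 x A)
    where
    hit≤1 : ∀ b a → hit b a ≤ 1ℚ
    hit≤1 b     nothing      = ≤-refl
    hit≤1 false (just false) = ≤-refl
    hit≤1 false (just true)  = nonNegative⁻¹ 1ℚ
    hit≤1 true  (just false) = nonNegative⁻¹ 1ℚ
    hit≤1 true  (just true)  = ≤-refl

  size≤codim : ∀ {n} (s : State n) A → size s A ≤ ι (codim A)
  size≤codim []      []      = ι-nonNeg 0
  size≤codim {ℕ.suc n} (c ∷ s) (a ∷ A) = ≤-trans (≤-reflexive (∑-allFin-suc n (λ i → touchAt i (c ∷ s) (a ∷ A)))) (step c a)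
    where
    touch≤1 : ∀ c a → touch c a ≤ 1ℚ
    touch≤1 (free _ _ _) (just _) = ≤-refl
    touch≤1 (free _ _ _) nothing  = nonNegative⁻¹ 1ℚ
    touch≤1 (fixed _)    _        = nonNegative⁻¹ 1ℚ
    touch-nothing : ∀ c → touch c nothing ≡ 0ℚ
    touch-nothing (free _ _ _) = refl
    touch-nothing (fixed _)    = refl
    step : ∀ c a → touch c a + size s A ≤ ι (codim (a ∷ A))
    step c (just b) = ≤-trans (+-mono-≤ (touch≤1 c (just b)) (size≤codim s A)) (≤-reflexive (sym (ι-suc (codim A))))
    step c nothing  = ≤-trans (≤-reflexive (trans (cong (_+ size s A) (touch-nothing c)) (+-identityˡ (size s A)))) (size≤codim s A)

  codim-0 : ∀ {n} (x : Input n) A → codim A ≡ 0 → ind x A ≡ 1ℚ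
  codim-0 []      []            _  = refl
  codim-0 (b ∷ x) (nothing ∷ A) eq = trans (*-identityˡ (ind x A)) (codim-0 x A eq)

  module Weights {n : ℕ} (w : Bool → Assignment n → ℚ) where

    weight : Bool → Input n → ℚ
    weight z x = ∑[ A ← assignments n ] w z A * ind x A

    cost : Bool → ℚ
    cost z = ∑[ A ← assignments n ] w z A * ι (2 ℕ.^ codim A)

  module _ {n : ℕ} (f : BoolFun n) (w : Bool → Assignment n → ℚ) (w-nonNeg : ∀ z A → 0ℚ ≤ w z A) where

    open Weights w

    cost-nonNeg : ∀ z → 0ℚ ≤ cost z
    cost-nonNeg z = ∑-nonNeg (assignments n) (λ A → 0≤* (w-nonNeg z A) (ι-nonNeg (2 ℕ.^ codim A)))

    -- A subcube of codimension 0 contains both points and cancels in the difference; every other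
    -- one pays at least 2 per unit of weight.
    cost-lower : ∀ z x y → 2ℚ * (weight z x - weight z y) ≤ cost z
    cost-lower z x y = begin
      2ℚ * (weight z x - weight z y)
        ≤⟨ ≤-since (∑-nonNeg (assignments n) (λ A → 0≤* (w-nonNeg z A) (gap (separate A))))
             (trans (certificate (cost z) (weight z x) (weight z y)) (sym combine)) ⟩
      cost z ∎
      where
      open ≤-Reasoning
      separate′ : ∀ A c → codim A ≡ c → 2ℚ * (ind x A - ind y A) ≤ ι (2 ℕ.^ c)
      separate′ A ℕ.zero    eq = ≤-trans (≤-reflexive (cong₂ (λ a b → 2ℚ * (a - b)) (codim-0 x A eq) (codim-0 y A eq))) (ι-nonNeg 1)
      separate′ A (ℕ.suc c) eq = ≤-trans
        (≤-since (0≤* (nonNegative⁻¹ 2ℚ) (0≤+ (gap (ind≤1 x A)) (ind-nonNeg y A))) (flip (ind x A) (ind y A)))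
        (≤-trans (*-monoˡ {c = 2ℚ} (nonNegative⁻¹ 2ℚ) (1≤ι (ℕ.m^n>0 2 c))) (≤-reflexive (sym (ι-2^suc c))))
        where
        flip : ∀ a b → 2ℚ - 2ℚ * (a - b) ≡ 2ℚ * ((1ℚ - a) + b)
        flip = solve-∀ ring
      separate : ∀ A → 2ℚ * (ind x A - ind y A) ≤ ι (2 ℕ.^ codim A)
      separate A = separate′ A (codim A) refl
      certificate : ∀ c a b → c - 2ℚ * (a - b) ≡ c + - 2ℚ * a + 2ℚ * b
      certificate = solve-∀ ring
      expand : ∀ w c i j → w * (c - 2ℚ * (i - j)) ≡ w * c + - 2ℚ * (w * i) + 2ℚ * (w * j)
      expand = solve-∀ ring
      combine : ∑[ A ← assignments n ] w z A * (ι (2 ℕ.^ codim A) - 2ℚ * (ind x A - ind y A))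
        ≡ cost z + - 2ℚ * weight z x + 2ℚ * weight z y
      combine = trans (∑-cong (assignments n) (λ A → expand (w z A) (ι (2 ℕ.^ codim A)) (ind x A) (ind y A)))
        (trans (∑-+ (assignments n) (λ A → w z A * ι (2 ℕ.^ codim A) + - 2ℚ * (w z A * ind x A)) (λ A → 2ℚ * (w z A * ind y A)))
          (cong₂ _+_ (trans (∑-+ (assignments n) (λ A → w z A * ι (2 ℕ.^ codim A)) (λ A → - 2ℚ * (w z A * ind x A)))
                       (cong (_+_ (cost z)) (∑-*ˡ (- 2ℚ) (assignments n) (λ A → w z A * ind x A))))
                     (∑-*ˡ 2ℚ (assignments n) (λ A → w z A * ind y A))))

    -- Markov's inequality for 2 to the codimension: each discarded subcube pays at least 2^K per
    -- unit of weight.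
    truncation : ∀ z x K → ι (2 ℕ.^ K) * weight z x ≤
      ι (2 ℕ.^ K) * (∑[ A ← filter (λ A → codim A ℕ.≤? K) (assignments n) ] w z A * ind x A) + cost z
    truncation z x K = begin
      p * weight z x
        ≡⟨ sym (∑-*ˡ p (assignments n) (λ A → w z A * ind x A)) ⟩
      ∑[ A ← assignments n ] p * (w z A * ind x A)
        ≤⟨ ∑-mono (assignments n) (λ A → pointwise A (codim A ℕ.≤? K)) ⟩
      ∑[ A ← assignments n ] (p * kept A + w z A * ι (2 ℕ.^ codim A))
        ≡⟨ ∑-+ (assignments n) (λ A → p * kept A) (λ A → w z A * ι (2 ℕ.^ codim A)) ⟩
      (∑[ A ← assignments n ] p * kept A) + cost z
        ≡⟨ cong (_+ cost z) (trans (∑-*ˡ p (assignments n) kept)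
             (cong (p *_) (sym (∑-filter (λ A → codim A ℕ.≤? K) (assignments n) (λ A → w z A * ind x A))))) ⟩
      p * (∑[ A ← filter (λ A → codim A ℕ.≤? K) (assignments n) ] w z A * ind x A) + cost z ∎
      where
      open ≤-Reasoning
      p : ℚ
      p = ι (2 ℕ.^ K)
      kept : Assignment n → ℚ
      kept A = if does (codim A ℕ.≤? K) then w z A * ind x A else 0ℚ
      pointwise : ∀ A (d : Dec (codim A ℕ.≤ K)) →
        p * (w z A * ind x A) ≤ p * (if does d then w z A * ind x A else 0ℚ) + w z A * ι (2 ℕ.^ codim A)
      pointwise A (yes _) = ≤-since (0≤* (w-nonNeg z A) (ι-nonNeg (2 ℕ.^ codim A)))
        (p+q-p≡q (p * (w z A * ind x A)) (w z A * ι (2 ℕ.^ codim A)))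
      pointwise A (no A≰K) = ≤-since
        (0≤* (w-nonNeg z A) (0≤+ (gap (ι-mono (ℕ.^-monoʳ-≤ 2 (ℕ.<⇒≤ (ℕ.≰⇒> A≰K)))))
          (0≤* (ι-nonNeg (2 ℕ.^ K)) (gap (ind≤1 x A)))))
        (certificate p (w z A) (ind x A) (ι (2 ℕ.^ codim A)))
        where
        certificate : ∀ p w i c → p * 0ℚ + w * c - p * (w * i) ≡ w * ((c - p) + p * (1ℚ - i))
        certificate = solve-∀ ring

    -- K and M are variables with defining equations because the type checker
    -- would unfold the products into unary numerals.
    module _ (e : ℚ) (0≤e : 0ℚ ≤ e) (k K l M : ℕ) (K≡ : K ≡ 4 ℕ.+ k) (M≡ : M ≡ 96 ℕ.* (K ℕ.* K))
      (covering : ∀ x → + 13 / 16 ≤ weight (f x) x)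
      (wrong    : ∀ x → weight (not (f x)) x ≤ + 9 / 8 * e)
      (total    : ∀ x → weight false x + weight true x ≤ + 17 / 16)
      (cost≤    : cost false + cost true ≤ ι (2 ℕ.^ k))
      (timeout  : 1ℚ ≤ e * ι (2 ℕ.^ l))
      where

      private
        κ : ℚ
        κ = ι K
        1≤κ : 1ℚ ≤ κ
        1≤κ = 1≤ι (ℕ.≤-trans (ℕ.s≤s ℕ.z≤n) (ℕ.≤-reflexive (sym K≡)))
        0<κ : 0ℚ < κ
        0<κ = <-≤-trans (positive⁻¹ 1ℚ) 1≤κ
        κ⁻¹ : ℚ
        κ⁻¹ = proj₁ (CauchyLemmas.inverse κ 0<κ)
        0≤κ⁻¹ : 0ℚ ≤ κ⁻¹
        0≤κ⁻¹ = <⇒≤ (proj₁ (proj₂ (CauchyLemmas.inverse κ 0<κ)))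
        κκ⁻¹ : κ * κ⁻¹ ≡ 1ℚ
        κκ⁻¹ = proj₂ (proj₂ (CauchyLemmas.inverse κ 0<κ))
        κ⁻¹≤1 : κ⁻¹ ≤ 1ℚ
        κ⁻¹≤1 = ≤-since (0≤* 0≤κ⁻¹ (gap 1≤κ)) (trans (cong (_- κ⁻¹) (sym κκ⁻¹)) (factor κ κ⁻¹))
          where
          factor : ∀ a b → a * b - b ≡ b * (a - 1ℚ)
          factor = solve-∀ ring
        -- τ makes the loss κτ in minority at most 1/24, and 1 - ρ = τ / 4κ is then
        -- the relative drop of 2κ + Φ ≤ 4κ caused by a query of influence τ.
        y τ ρ r : ℚ
        y = + 1 / 96 * (κ⁻¹ * κ⁻¹)
        τ = + 1 / 24 * κ⁻¹
        ρ = 1ℚ - y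
        r = ½ * κ⁻¹
        0≤y : 0ℚ ≤ y
        0≤y = 0≤* (nonNegative⁻¹ (+ 1 / 96)) (0≤* 0≤κ⁻¹ 0≤κ⁻¹)
        y≤1 : y ≤ 1ℚ
        y≤1 = ≤-since
          (0≤+ (nonNegative⁻¹ (+ 95 / 96)) (0≤* (nonNegative⁻¹ (+ 1 / 96)) (0≤+ (gap κ⁻¹≤1) (0≤* 0≤κ⁻¹ (gap κ⁻¹≤1)))))
          (certificate κ⁻¹)
          where
          certificate : ∀ j → 1ℚ - + 1 / 96 * (j * j) ≡ + 95 / 96 + + 1 / 96 * ((1ℚ - j) + j * (1ℚ - j))
          certificate = solve-∀ ring
        0≤ρ : 0ℚ ≤ ρ
        0≤ρ = gap y≤1
        My≡1 : ι M * y ≡ 1ℚ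
        My≡1 = trans (cong (_* y) (trans (cong ι M≡) (trans (ι-* 96 (K ℕ.* K)) (cong₂ _*_ (ι-≡ 96) (ι-* K K)))))
          (trans (regroup κ κ⁻¹) (cong (λ z → z * z) κκ⁻¹))
          where
          regroup : ∀ k j → + 96 / 1 * (k * k) * (+ 1 / 96 * (j * j)) ≡ k * j * (k * j)
          regroup = solve-∀ ring
        As : List (Assignment n)
        As = filter (λ A → codim A ℕ.≤? K) (assignments n)

      open Learning f As w κ (+ 5 / 4 * e) τ ρ

      private
        W≤weight : ∀ z x → W z x ≤ weight z x
        W≤weight z x = ≤-trans (≤-reflexive (∑-filter (λ A → codim A ℕ.≤? K) (assignments n) (λ A → w z A * ind x A)))
          (∑-mono (assignments n) (λ A → keep A (does (codim A ℕ.≤? K))))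
          where
          keep : ∀ A b → (if b then w z A * ind x A else 0ℚ) ≤ w z A * ind x A
          keep A true  = ≤-refl
          keep A false = 0≤* (w-nonNeg z A) (ind-nonNeg x A)

        W-nonNeg′ : ∀ z x → 0ℚ ≤ W z x
        W-nonNeg′ z x = ∑-nonNeg As (λ A → 0≤* (w-nonNeg z A) (ind-nonNeg x A))

        small : All (λ A → ∀ s → size s A ≤ κ) As
        small = All.map (λ {A} A≤K s → ≤-trans (size≤codim s A) (ι-mono A≤K)) (All.all-filter (λ A → codim A ℕ.≤? K) (assignments n))

        cost-z≤ : ∀ z → cost z ≤ ι (2 ℕ.^ k)
        cost-z≤ false = ≤-trans (≤-since (cost-nonNeg true) (p+q-p≡q (cost false) (cost true))) cost≤
        cost-z≤ true = ≤-trans (≤-since (cost-nonNeg false) (p+q-q≡p (cost false) (cost true))) cost≤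

        ι2^K : ι (2 ℕ.^ K) ≡ + 16 / 1 * ι (2 ℕ.^ k)
        ι2^K = trans (cong ι (trans (cong (2 ℕ.^_) K≡) (ℕ.^-distribˡ-+-* 2 4 k))) (trans (ι-* 16 (2 ℕ.^ k)) (cong (_* ι (2 ℕ.^ k)) (ι-≡ 16)))

        0<2^k : 0ℚ < ι (2 ℕ.^ k)
        0<2^k = <-≤-trans (positive⁻¹ 1ℚ) (1≤ι (ℕ.m^n>0 2 k))

        -- The 4 in K = 4 + k makes 2^K sixteen times the cost bound, so the discarded weight is at
        -- most 1/16, which takes the covering from 13/16 to ¾.
        weight≤ : ∀ z x → weight z x ≤ W z x + + 1 / 16
        weight≤ z x = *-cancelˡ-≤-pos (+ 16 / 1 * c) {{positive 0<16c}} (begin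
          + 16 / 1 * c * weight z x              ≡⟨ cong (_* weight z x) (sym ι2^K) ⟩
          ι (2 ℕ.^ K) * weight z x               ≤⟨ truncation z x K ⟩
          ι (2 ℕ.^ K) * W z x + cost z           ≤⟨ +-monoʳ-≤ (ι (2 ℕ.^ K) * W z x) (cost-z≤ z) ⟩
          ι (2 ℕ.^ K) * W z x + c                ≡⟨ cong (λ p → p * W z x + c) ι2^K ⟩
          + 16 / 1 * c * W z x + c               ≡⟨ factor c (W z x) ⟩
          + 16 / 1 * c * (W z x + + 1 / 16)      ∎)
          where
          open ≤-Reasoning
          c : ℚ
          c = ι (2 ℕ.^ k)
          0<16c : 0ℚ < + 16 / 1 * c
          0<16c = CauchyLemmas.*-pos (positive⁻¹ (+ 16 / 1)) 0<2^k
          factor : ∀ c v → + 16 / 1 * c * v + c ≡ + 16 / 1 * c * (v + + 1 / 16)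
          factor = solve-∀ ring

        covering′ : ∀ x → ¾ ≤ W (f x) x
        covering′ x = ≤-since (0≤+ (gap (covering x)) (gap (weight≤ (f x) x))) (certificate (weight (f x) x) (W (f x) x))
          where
          certificate : ∀ a b → b - ¾ ≡ (a - + 13 / 16) + (b + + 1 / 16 - a)
          certificate = solve-∀ ring

        sum≤ : ∀ x → W false x + W true x ≤ + 17 / 16
        sum≤ x = ≤-trans (+-mono-≤ (W≤weight false x) (W≤weight true x)) (total x)

        -- One factor belongs to the wrong label and is at most 9/8 e, the other is at most 17/16;
        -- the product 153/128 e is below 5/4 e.
        both : ∀ x → W false x * W true x ≤ + 5 / 4 * e
        both x = ≤-trans (pick (f x) (wrong x)) (≤-since (0≤* (nonNegative⁻¹ (+ 7 / 128)) 0≤e) (slack e))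
          where
          slack : ∀ e → + 5 / 4 * e - + 9 / 8 * e * (+ 17 / 16) ≡ + 7 / 128 * e
          slack = solve-∀ ring
          0≤9/8e : 0ℚ ≤ + 9 / 8 * e
          0≤9/8e = 0≤* (nonNegative⁻¹ (+ 9 / 8)) 0≤e
          pick : ∀ z → weight (not z) x ≤ + 9 / 8 * e → W false x * W true x ≤ + 9 / 8 * e * (+ 17 / 16)
          pick true  h = *-mono-≤ 0≤9/8e (W-nonNeg′ true x) (≤-trans (W≤weight false x) h)
            (≤-trans (≤-since (W-nonNeg′ false x) (p+q-q≡p (W false x) (W true x))) (sum≤ x))
          pick false h = ≤-trans (≤-reflexive (*-comm (W false x) (W true x)))
            (*-mono-≤ 0≤9/8e (W-nonNeg′ false x) (≤-trans (W≤weight true x) h)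
              (≤-trans (≤-since (W-nonNeg′ true x) (p+q-p≡q (W false x) (W true x))) (sum≤ x)))

        sum≤2 : ∀ x → W false x + W true x ≤ 2ℚ
        sum≤2 x = ≤-trans (sum≤ x) (≤-since (nonNegative⁻¹ (+ 15 / 16)) refl)

        κτ≡ : κ * τ ≡ + 1 / 24
        κτ≡ = trans (regroup κ κ⁻¹) (trans (cong (_* (+ 1 / 24)) κκ⁻¹) refl)
          where
          regroup : ∀ a b → a * (+ 1 / 24 * b) ≡ a * b * (+ 1 / 24)
          regroup = solve-∀ ring

        ρ-gap : (1ℚ - ρ) * (4ℚ * κ) ≡ τ
        ρ-gap = trans (regroup κ κ⁻¹) (trans (cong (_* τ) κκ⁻¹) (*-identityˡ τ))
          where
          regroup : ∀ a b → (1ℚ - (1ℚ - + 1 / 96 * (b * b))) * (4ℚ * a) ≡ a * b * (+ 1 / 24 * b)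
          regroup = solve-∀ ring

        -- The normalisation under which the floor 2κ of the potential counts as probability 1.
        r-unit : r * (2ℚ * κ) ≡ 1ℚ
        r-unit = trans (regroup κ κ⁻¹) κκ⁻¹
          where
          regroup : ∀ a b → ½ * b * (2ℚ * a) ≡ a * b
          regroup = solve-∀ ring

        0≤r : 0ℚ ≤ r
        0≤r = 0≤* (nonNegative⁻¹ ½) 0≤κ⁻¹

        ρ≤1 : ρ ≤ 1ℚ
        ρ≤1 = ≤-since 0≤y (cancel y)
          where
          cancel : ∀ y → 1ℚ - (1ℚ - y) ≡ y
          cancel = solve-∀ ring

        -- Each block of `M` queries halves: `l` blocks bring the power down to e by `timeout`, and
        -- two more give the factor ¼.
        tail : ρ ^ ((2 ℕ.+ l) ℕ.* M) ≤ ¼ * e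
        tail = begin
          g                                      ≡⟨ sym (*-identityʳ g) ⟩
          g * 1ℚ                                 ≤⟨ *-monoˡ 0≤g timeout ⟩
          g * (e * ι (2 ℕ.^ l))                  ≡⟨ regroup g e (ι (2 ℕ.^ l)) ⟩
          g * (4ℚ * ι (2 ℕ.^ l)) * (¼ * e)       ≡⟨ cong (λ p → g * p * (¼ * e)) (sym ι2^2+l) ⟩
          g * ι (2 ℕ.^ (2 ℕ.+ l)) * (¼ * e)      ≤⟨ *-mono-≤ (nonNegative⁻¹ 1ℚ) 0≤¼e (halving y M 0≤y y≤1 My≡1 (2 ℕ.+ l)) ≤-refl ⟩
          1ℚ * (¼ * e)                           ≡⟨ *-identityˡ (¼ * e) ⟩
          ¼ * e                                  ∎
          where
          open ≤-Reasoning
          g : ℚ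
          g = ρ ^ ((2 ℕ.+ l) ℕ.* M)
          0≤g : 0ℚ ≤ g
          0≤g = ^-nonNeg 0≤ρ (((2 ℕ.+ l) ℕ.* M))
          0≤¼e : 0ℚ ≤ ¼ * e
          0≤¼e = 0≤* (nonNegative⁻¹ ¼) 0≤e
          ι2^2+l : ι (2 ℕ.^ (2 ℕ.+ l)) ≡ 4ℚ * ι (2 ℕ.^ l)
          ι2^2+l = trans (cong ι (ℕ.^-distribˡ-+-* 2 2 l)) (trans (ι-* 4 (2 ℕ.^ l)) (cong (_* ι (2 ℕ.^ l)) (ι-≡ 4)))
          regroup : ∀ g e p → g * (e * p) ≡ g * (4ℚ * p) * (¼ * e)
          regroup = solve-∀ ring

      open Bounds w-nonNeg small covering′ both sum≤2 (<⇒≤ 0<κ) (0≤* (nonNegative⁻¹ (+ 5 / 4)) 0≤e)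
        (0≤* (nonNegative⁻¹ (+ 1 / 24)) 0≤κ⁻¹) (≤-reflexive κτ≡) 0≤ρ ρ≤1 (≤-reflexive ρ-gap)

      -- Stopped leaves cost 4 · 5/4 e = 5e. The scaled potential starts at r · 4κ = 2 at most, so
      -- exhausted branches cost at most 2 · ¼ e.
      shallow-tree : ∀ s → ∃[ t ] (∀ x → queries t x ℕ.≤ (2 ℕ.+ l) ℕ.* M) × 𝔼 s (err f t) ≤ + 11 / 2 * e
      shallow-tree s = proj₁ found , proj₁ (proj₂ found) , ≤-trans (proj₂ (proj₂ found)) (error-budget ((2 ℕ.+ l) ℕ.* M) tail)
        where
        open ≤-Reasoning
        found : ∃[ t ] (∀ x → queries t x ℕ.≤ (2 ℕ.+ l) ℕ.* M) ×
          𝔼 s (err f t) ≤ 4ℚ * (+ 5 / 4 * e) + r * ρ ^ ((2 ℕ.+ l) ℕ.* M) * (2ℚ * κ + Φ s)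
        found = tree r 0≤r (≤-reflexive (sym r-unit)) ((2 ℕ.+ l) ℕ.* M) s
        error-budget : ∀ T → ρ ^ T ≤ ¼ * e → 4ℚ * (+ 5 / 4 * e) + r * ρ ^ T * (2ℚ * κ + Φ s) ≤ + 11 / 2 * e
        error-budget T tail = begin
          4ℚ * (+ 5 / 4 * e) + r * ρ ^ T * (2ℚ * κ + Φ s)
            ≤⟨ +-monoʳ-≤ (4ℚ * (+ 5 / 4 * e)) (*-monoˡ (0≤* 0≤r (^-nonNeg 0≤ρ T)) (+-monoʳ-≤ (2ℚ * κ) (Φ≤2κ s))) ⟩
          4ℚ * (+ 5 / 4 * e) + r * ρ ^ T * (2ℚ * κ + 2ℚ * κ)
            ≡⟨ regroup e r (ρ ^ T) κ ⟩
          + 5 / 1 * e + 2ℚ * (r * (2ℚ * κ)) * ρ ^ T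
            ≡⟨ cong (λ z → + 5 / 1 * e + 2ℚ * z * ρ ^ T) r-unit ⟩
          + 5 / 1 * e + 2ℚ * 1ℚ * ρ ^ T
            ≤⟨ +-monoʳ-≤ (+ 5 / 1 * e) (*-monoˡ {c = 2ℚ * 1ℚ} (nonNegative⁻¹ 2ℚ) tail) ⟩
          + 5 / 1 * e + 2ℚ * 1ℚ * (¼ * e)
            ≡⟨ collect e ⟩
          + 11 / 2 * e ∎
          where
          regroup : ∀ e r g κ → 4ℚ * (+ 5 / 4 * e) + r * g * (2ℚ * κ + 2ℚ * κ) ≡ + 5 / 1 * e + 2ℚ * (r * (2ℚ * κ)) * g
          regroup = solve-∀ ring
          collect : ∀ e → + 5 / 1 * e + 2ℚ * 1ℚ * (¼ * e) ≡ + 11 / 2 * e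
          collect = solve-∀ ring

  -- Rational approximation of the reals

  Ev : (ℕ → Set) → Set
  Ev P = ∃[ N ] ∀ m → N ℕ.≤ m → P m

  Ev-map : ∀ {P Q : ℕ → Set} → (∀ m → P m → Q m) → Ev P → Ev Q
  Ev-map f (N , p) = N , λ m N≤m → f m (p m N≤m)

  Ev-zip : ∀ {P Q S : ℕ → Set} → (∀ m → P m → Q m → S m) → Ev P → Ev Q → Ev S
  Ev-zip f (M , p) (N , q) = M ℕ.⊔ N , λ m M⊔N≤m →
    f m (p m (ℕ.m⊔n≤o⇒m≤o M N M⊔N≤m)) (q m (ℕ.m⊔n≤o⇒n≤o M N M⊔N≤m))

  -- There are finitely many inputs, so their thresholds have a maximum.
  Ev-Input : ∀ n {P : Input n → ℕ → Set} → (∀ x → Ev (P x)) → Ev (λ m → ∀ x → P x m)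
  Ev-Input ℕ.zero    p = Ev-map (λ { m q [] → q }) (p [])
  Ev-Input (ℕ.suc n) p = Ev-zip (λ { m q r (false ∷ x) → q x ; m q r (true ∷ x) → r x })
    (Ev-Input n (λ x → p (false ∷ x))) (Ev-Input n (λ x → p (true ∷ x)))

  ½-pos : ∀ {η} → 0ℚ < η → 0ℚ < ½ * η
  ½-pos = CauchyLemmas.*-pos (positive⁻¹ ½)

  infix 4 _≲_ _~_

  -- The order of the reals on arbitrary rational sequences, so that clamped or truncated
  -- approximations can be compared without being shown to be Cauchy.
  _≲_ : (ℕ → ℚ) → (ℕ → ℚ) → Set
  s ≲ t = ∀ η → 0ℚ < η → Ev (λ m → s m ≤ t m + η)

  ≤⇒≲ : ∀ {s t} → (∀ m → s m ≤ t m) → s ≲ t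
  ≤⇒≲ {s} {t} s≤t η 0<η = 0 , λ m _ →
    ≤-trans (s≤t m) (≤-trans (≤-reflexive (sym (+-identityʳ (t m)))) (+-monoʳ-≤ (t m) (<⇒≤ 0<η)))

  ≲-trans : ∀ {s t u} → s ≲ t → t ≲ u → s ≲ u
  ≲-trans {s} {t} {u} s≲t t≲u η 0<η = Ev-zip
    (λ m s≤t t≤u → ≤-since (0≤+ (gap s≤t) (gap t≤u)) (certificate (s m) (t m) (u m) η))
    (s≲t (½ * η) (½-pos 0<η)) (t≲u (½ * η) (½-pos 0<η))
    where
    certificate : ∀ s t u η → u + η - s ≡ (t + ½ * η - s) + (u + ½ * η - t)
    certificate = solve-∀ ring

  ≲-+ : ∀ {s s′ t t′} → s ≲ s′ → t ≲ t′ → (λ m → s m + t m) ≲ (λ m → s′ m + t′ m)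
  ≲-+ {s} {s′} {t} {t′} s≲ t≲ η 0<η = Ev-zip
    (λ m s≤ t≤ → ≤-since (0≤+ (gap s≤) (gap t≤)) (certificate (s m) (s′ m) (t m) (t′ m) η))
    (s≲ (½ * η) (½-pos 0<η)) (t≲ (½ * η) (½-pos 0<η))
    where
    certificate : ∀ s s′ t t′ η → s′ + t′ + η - (s + t) ≡ (s′ + ½ * η - s) + (t′ + ½ * η - t)
    certificate = solve-∀ ring

  ≲-*ʳ : ∀ {s t} c → 0ℚ ≤ c → s ≲ t → (λ m → s m * c) ≲ (λ m → t m * c)
  ≲-*ʳ {s} {t} c 0≤c s≲t η 0<η = Ev-map
    (λ m s≤t → ≤-since (0≤+ (0≤* 0≤c (gap s≤t)) (0≤* 0≤d (<⇒≤ 0<η)))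
      (trans (cong (λ z → t m * c + z - s m * c) (η-split η)) (certificate (s m) (t m) c d η)))
    (s≲t (d * η) (CauchyLemmas.*-pos 0<d 0<η))
    where
    0<1+c : 0ℚ < 1ℚ + c
    0<1+c = +-mono-<-≤ (positive⁻¹ 1ℚ) 0≤c
    -- The slack is divided by 1 + c because c itself may be 0.
    d : ℚ
    d = proj₁ (CauchyLemmas.inverse (1ℚ + c) 0<1+c)
    0<d : 0ℚ < d
    0<d = proj₁ (proj₂ (CauchyLemmas.inverse (1ℚ + c) 0<1+c))
    0≤d : 0ℚ ≤ d
    0≤d = <⇒≤ 0<d
    η-split : ∀ η → η ≡ (1ℚ + c) * d * η
    η-split η = sym (trans (cong (_* η) (proj₂ (proj₂ (CauchyLemmas.inverse (1ℚ + c) 0<1+c)))) (*-identityˡ η))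
    certificate : ∀ s t c d η → t * c + (1ℚ + c) * d * η - s * c ≡ c * (t + d * η - s) + d * η
    certificate = solve-∀ ring

  ≲-∑ : ∀ {A : Set} (as : List A) {f g : ℕ → A → ℚ} → (∀ a → (λ m → f m a) ≲ (λ m → g m a)) →
    (λ m → ∑ as (f m)) ≲ (λ m → ∑ as (g m))
  ≲-∑ []       {f} {g} f≲g = ≤⇒≲ {λ _ → 0ℚ} {λ _ → 0ℚ} (λ _ → ≤-refl)
  ≲-∑ (a ∷ as) {f} {g} f≲g = ≲-+ {λ m → f m a} {λ m → g m a} {λ m → ∑ as (f m)} {λ m → ∑ as (g m)} (f≲g a) (≲-∑ as f≲g)

  ≲-⊔ : ∀ {s t u} → s ≲ u → t ≲ u → (λ m → s m ⊔ t m) ≲ u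
  ≲-⊔ {s} {t} {u} s≲u t≲u η 0<η = Ev-zip (λ m s≤ t≤ → ⊔-lub s≤ t≤) (s≲u η 0<η) (t≲u η 0<η)

  p≤∣p∣ : ∀ p → p ≤ ∣ p ∣
  p≤∣p∣ p with ≤-total 0ℚ p
  ... | inj₁ 0≤p = ≤-reflexive (sym (0≤p⇒∣p∣≡p 0≤p))
  ... | inj₂ p≤0 = ≤-trans p≤0 (0≤∣p∣ p)

  module _ (x y : R.ℝ) where

    -- `x ≤ y` is a negation, but one rational comparison at a late index decides: if `x` exceeds
    -- `y` there by ½η, the Cauchy property keeps a gap of ¼η forever, contradicting `x ≤ y`;
    -- otherwise it carries the closeness to all later indices.
    ≤ᴿ⇒≲ : x R.≤ y → seq x ≲ seq y
    ≤ᴿ⇒≲ x≤y η 0<η = decide (seq x N ≤? seq y N + ½ * η)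
      where
      ⅛η : ℚ
      ⅛η = + 1 / 8 * η
      0<⅛η : 0ℚ < ⅛η
      0<⅛η = CauchyLemmas.*-pos (positive⁻¹ (+ 1 / 8)) 0<η
      X = cauchy x ⅛η 0<⅛η
      Y = cauchy y ⅛η 0<⅛η
      N : ℕ
      N = proj₁ X ℕ.⊔ proj₁ Y
      X≤N : proj₁ X ℕ.≤ N
      X≤N = ℕ.m≤m⊔n (proj₁ X) (proj₁ Y)
      Y≤N : proj₁ Y ℕ.≤ N
      Y≤N = ℕ.m≤n⊔m (proj₁ X) (proj₁ Y)
      near-x : ∀ m n → N ℕ.≤ m → N ℕ.≤ n → seq x m - seq x n ≤ ⅛η
      near-x m n N≤m N≤n = ≤-trans (p≤∣p∣ (seq x m - seq x n)) (proj₂ X m n (ℕ.≤-trans X≤N N≤m) (ℕ.≤-trans X≤N N≤n))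
      near-y : ∀ m n → N ℕ.≤ m → N ℕ.≤ n → seq y m - seq y n ≤ ⅛η
      near-y m n N≤m N≤n = ≤-trans (p≤∣p∣ (seq y m - seq y n)) (proj₂ Y m n (ℕ.≤-trans Y≤N N≤m) (ℕ.≤-trans Y≤N N≤n))
      decide : Dec (seq x N ≤ seq y N + ½ * η) → Ev (λ m → seq x m ≤ seq y m + η)
      decide (yes close) = N , λ m N≤m → ≤-since
        (0≤+ (0≤+ (0≤+ (gap close) (gap (near-x m N N≤m ℕ.≤-refl))) (gap (near-y N m ℕ.≤-refl N≤m)))
          (0≤* (nonNegative⁻¹ ¼) (<⇒≤ 0<η)))
        (certificate (seq x m) (seq y m) (seq x N) (seq y N) η)
        where
        certificate : ∀ xm ym xn yn η → ym + η - xm ≡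
          (yn + ½ * η - xn) + (+ 1 / 8 * η - (xm - xn)) + (+ 1 / 8 * η - (yn - ym)) + ¼ * η
        certificate = solve-∀ ring
      decide (no far) = contradiction
        (¼ * η , CauchyLemmas.*-pos (positive⁻¹ ¼) 0<η , N , λ m N≤m → ≤-since
          (0≤+ (0≤+ (gap (<⇒≤ (≰⇒> far))) (gap (near-y m N N≤m ℕ.≤-refl))) (gap (near-x N m ℕ.≤-refl N≤m)))
          (certificate (seq x m) (seq y m) (seq x N) (seq y N) η))
        x≤y
        where
        certificate : ∀ xm ym xn yn η → xm - (ym + ¼ * η) ≡
          (xn - (yn + ½ * η)) + (+ 1 / 8 * η - (ym - yn)) + (+ 1 / 8 * η - (xn - xm))
        certificate = solve-∀ ring

  _~_ : (ℕ → ℚ) → (ℕ → ℚ) → Set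
  s ~ t = ∀ η → 0ℚ < η → Ev (λ m → ∣ s m - t m ∣ ≤ η)

  ≲⇒~ : ∀ {s t} → s ≲ t → t ≲ s → s ~ t
  ≲⇒~ {s} {t} s≲t t≲s η 0<η =
    Ev-zip (λ m s≤t t≤s → LogLemmas.∣∣≤ (s m) (t m) η s≤t t≤s) (s≲t η 0<η) (t≲s η 0<η)

  ∣-∣≤⇒≤ : ∀ p q {η} → ∣ p - q ∣ ≤ η → p ≤ q + η
  ∣-∣≤⇒≤ p q {η} h = ≤-since (gap (≤-trans (p≤∣p∣ (p - q)) h)) (certificate p q η)
    where
    certificate : ∀ p q η → q + η - p ≡ η - (p - q)
    certificate = solve-∀ ring

  ~⇒≲ : ∀ {s t} → s ~ t → s ≲ t
  ~⇒≲ {s} {t} s~t η 0<η = Ev-map (λ m h → ∣-∣≤⇒≤ (s m) (t m) h) (s~t η 0<η)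

  -- Only the approximants lie in the unit interval. The limit sequence `d` is eventually bounded by
  -- 2, being within 1 of `b`, hence the share of a third of η.
  ~-* : ∀ {a b c d} → (∀ m → 0ℚ ≤ a m × a m ≤ 1ℚ) → (∀ m → 0ℚ ≤ b m × b m ≤ 1ℚ) →
    a ~ c → b ~ d → (λ m → a m * b m) ~ (λ m → c m * d m)
  ~-* {a} {b} {c} {d} a-unit b-unit a~c b~d η 0<η = Ev-zip (λ m ac (bd , bd1) → ≤-trans
      (CauchyLemmas.*-close (a m) (b m) (c m) (d m) 1ℚ 2ℚ ⅓η (nonNegative⁻¹ 1ℚ) (<⇒≤ 0<⅓η)
        (≤-trans (≤-reflexive (0≤p⇒∣p∣≡p (proj₁ (a-unit m)))) (proj₂ (a-unit m)))
        (∣d∣≤2 m bd1) ac bd)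
      (≤-reflexive (third η)))
    (a~c ⅓η 0<⅓η) (Ev-zip (λ _ → _,_) (b~d ⅓η 0<⅓η) (b~d 1ℚ (positive⁻¹ 1ℚ)))
    where
    ⅓η : ℚ
    ⅓η = + 1 / 3 * η
    0<⅓η : 0ℚ < ⅓η
    0<⅓η = CauchyLemmas.*-pos (positive⁻¹ (+ 1 / 3)) 0<η
    third : ∀ η → (1ℚ + 2ℚ) * (+ 1 / 3 * η) ≡ η
    third = solve-∀ ring
    ∣d∣≤2 : ∀ m → ∣ b m - d m ∣ ≤ 1ℚ → ∣ d m ∣ ≤ 2ℚ
    ∣d∣≤2 m bd = begin
      ∣ d m ∣                        ≡⟨ cong ∣_∣ (recombine (b m) (d m)) ⟩
      ∣ b m + - (b m - d m) ∣        ≤⟨ ∣p+q∣≤∣p∣+∣q∣ (b m) (- (b m - d m)) ⟩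
      ∣ b m ∣ + ∣ - (b m - d m) ∣    ≡⟨ cong₂ _+_ (0≤p⇒∣p∣≡p (proj₁ (b-unit m))) (∣-p∣≡∣p∣ (b m - d m)) ⟩
      b m + ∣ b m - d m ∣            ≤⟨ +-mono-≤ (proj₂ (b-unit m)) bd ⟩
      1ℚ + 1ℚ                        ≡⟨ refl ⟩
      2ℚ                             ∎
      where
      open ≤-Reasoning
      recombine : ∀ b d → d ≡ b + - (b - d)
      recombine = solve-∀ ring

  -- Rational product measures converging to μ

  clamp : ℚ → ℚ
  clamp q = 0ℚ ⊔ (q ⊓ 1ℚ)

  -- Terms of a sequence for a real in the unit interval may leave it; clamping restores an exact
  -- probability without changing the limit.
  coord : ℚ → Coord
  coord q = free (clamp q) (p≤p⊔q 0ℚ (q ⊓ 1ℚ)) (⊔-lub (nonNegative⁻¹ 1ℚ) (p⊓q≤q q 1ℚ))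

  prob≤1 : ∀ c b → prob c b ≤ 1ℚ
  prob≤1 c false = ≤-since (prob-nonNeg c true) (trans (cong (_- prob c false) (sym (prob-total c))) (p+q-p≡q (prob c false) (prob c true)))
  prob≤1 c true = ≤-since (prob-nonNeg c false) (trans (cong (_- prob c true) (sym (prob-total c))) (p+q-q≡p (prob c false) (prob c true)))

  mass≤1 : ∀ {n} (s : State n) x → mass s x ≤ 1ℚ
  mass≤1 []      []      = ≤-refl
  mass≤1 (c ∷ s) (b ∷ x) = *-mono-≤ {b = 1ℚ} {d = 1ℚ} (nonNegative⁻¹ 1ℚ) (mass-nonNeg s x) (prob≤1 c b) (mass≤1 s x)

  clamp-~ : ∀ {s} → (λ _ → 0ℚ) ≲ s → s ≲ (λ _ → 1ℚ) → (λ m → clamp (s m)) ~ s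
  clamp-~ {s} 0≲s s≲1 = ≲⇒~
    (≲-⊔ {λ _ → 0ℚ} {λ m → s m ⊓ 1ℚ} {s} 0≲s (≤⇒≲ {λ m → s m ⊓ 1ℚ} {s} (λ m → p⊓q≤p (s m) 1ℚ)))
    (λ η 0<η → Ev-map (λ m s≤1+η → ≤-trans (below m (<⇒≤ 0<η) s≤1+η) (+-monoˡ-≤ η (p≤q⊔p 0ℚ (s m ⊓ 1ℚ)))) (s≲1 η 0<η))
    where
    below : ∀ m {η} → 0ℚ ≤ η → s m ≤ 1ℚ + η → s m ≤ s m ⊓ 1ℚ + η
    below m {η} 0≤η h with ≤-total (s m) 1ℚ
    ... | inj₁ s≤1 = ≤-trans (≤-since 0≤η (p+q-p≡q (s m) η)) (≤-reflexive (cong (_+ η) (sym (p≤q⇒p⊓q≡p s≤1))))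
    ... | inj₂ 1≤s = ≤-trans h (≤-reflexive (cong (_+ η) (sym (p≥q⇒p⊓q≡q 1≤s))))

  module _ (m₀ m₁ : R.ℝ) (0≤m₁ : R.0ℝ R.≤ m₁) (m₁≤1 : m₁ R.≤ R.1ℝ)
    (m₀+m₁≤1 : m₀ R.+ m₁ R.≤ R.1ℝ) (1≤m₀+m₁ : R.1ℝ R.≤ m₀ R.+ m₁) where

    coord-true : (λ k → prob (coord (seq m₁ k)) true) ~ seq m₁
    coord-true = clamp-~ (≤ᴿ⇒≲ R.0ℝ m₁ 0≤m₁) (≤ᴿ⇒≲ m₁ R.1ℝ m₁≤1)

    -- Only the marginal at `true` is approximated and the other is its complement, so the rational
    -- marginals sum to exactly 1; convergence follows from m₀ + m₁ = 1.
    coord-false : (λ k → prob (coord (seq m₁ k)) false) ~ seq m₀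
    coord-false η 0<η = Ev-zip
      (λ k close (le , ge) → LogLemmas.∣∣≤ (1ℚ - clamp (seq m₁ k)) (seq m₀ k) η
        (≤-since (0≤+ (gap ge) (gap (∣-∣≤⇒≤ (seq m₁ k) (clamp (seq m₁ k)) (swap k close)))) (upper (clamp (seq m₁ k)) (seq m₀ k) (seq m₁ k) η))
        (≤-since (0≤+ (gap le) (gap (∣-∣≤⇒≤ (clamp (seq m₁ k)) (seq m₁ k) close))) (lower (clamp (seq m₁ k)) (seq m₀ k) (seq m₁ k) η)))
      (coord-true (½ * η) (½-pos 0<η))
      (Ev-zip (λ _ → _,_) (≤ᴿ⇒≲ (m₀ R.+ m₁) R.1ℝ m₀+m₁≤1 (½ * η) (½-pos 0<η))
                                (≤ᴿ⇒≲ R.1ℝ (m₀ R.+ m₁) 1≤m₀+m₁ (½ * η) (½-pos 0<η)))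
      where
      swap : ∀ k → ∣ clamp (seq m₁ k) - seq m₁ k ∣ ≤ ½ * η → ∣ seq m₁ k - clamp (seq m₁ k) ∣ ≤ ½ * η
      swap k h = ≤-trans (≤-reflexive (trans (cong ∣_∣ (negate (clamp (seq m₁ k)) (seq m₁ k))) (∣-p∣≡∣p∣ (clamp (seq m₁ k) - seq m₁ k)))) h
        where
        negate : ∀ c q → q - c ≡ - (c - q)
        negate = solve-∀ ring
      upper : ∀ c a b η → a + η - (1ℚ - c) ≡ (a + b + ½ * η - 1ℚ) + (c + ½ * η - b)
      upper = solve-∀ ring
      lower : ∀ c a b η → 1ℚ - c + η - a ≡ (1ℚ + ½ * η - (a + b)) + (b + ½ * η - c)
      lower = solve-∀ ring

  -- Built from the factors of μ, so each approximating measure is itself a product, as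
  -- `meas-product` requires.
  state : ∀ {n} → (Fin n → Bool → R.ℝ) → ℕ → State n
  state m k = Vec.tabulate (λ i → coord (seq (m i true) k))

  mass-~ : ∀ {n} (m : Fin n → Bool → R.ℝ) → (∀ i b → R.0ℝ R.≤ m i b × m i b R.≤ R.1ℝ) →
    (∀ i → m i false R.+ m i true R.≈ R.1ℝ) → ∀ x →
    (λ k → mass (state m k) x) ~ seq (R.∏ (λ i → m i (lookup x i)))
  mass-~ m bounds sums [] η 0<η = 0 , λ _ _ → <⇒≤ 0<η
  mass-~ m bounds sums (b ∷ x) = ~-*
    (λ k → prob-nonNeg (coord (seq (m zero true) k)) b , prob≤1 (coord (seq (m zero true) k)) b)
    (λ k → mass-nonNeg (state (m ∘ suc) k) x , mass≤1 (state (m ∘ suc) k) x)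
    (head b) (mass-~ (m ∘ suc) (bounds ∘ suc) (sums ∘ suc) x)
    where
    head : ∀ b → (λ k → prob (coord (seq (m zero true) k)) b) ~ seq (m zero b)
    head false = coord-false (m zero false) (m zero true) (proj₁ (bounds zero true)) (proj₂ (bounds zero true)) (proj₁ (sums zero)) (proj₂ (sums zero))
    head true  = coord-true (m zero false) (m zero true) (proj₁ (bounds zero true)) (proj₂ (bounds zero true)) (proj₁ (sums zero)) (proj₂ (sums zero))

  seq-∑ : ∀ {A : Set} (as : List A) f k → seq (R.∑ as f) k ≡ ∑[ a ← as ] seq (f a) k
  seq-∑ []       f k = refl
  seq-∑ (a ∷ as) f k = cong (_+_ (seq (f a) k)) (seq-∑ as f k)

  ∑-containing : ∀ {n} (x : Input n) g → ∑ (containing x) g ≡ ∑[ A ← assignments n ] g A * ind x A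
  ∑-containing {n} x g = trans (∑-filter (x ∈?_) (assignments n) g) (∑-cong (assignments n) (λ A →
    trans (choose (does (x ∈? A)) (g A)) (cong (g A *_) (sym (ind-dec x A)))))
    where
    choose : ∀ b q → (if b then q else 0ℚ) ≡ q * (if b then 1ℚ else 0ℚ)
    choose true  q = sym (*-identityʳ q)
    choose false q = sym (*-zeroʳ q)

  -- A constant f has p = 0 and must be answered without queries; otherwise the two witnesses force
  -- the cost above 2.
  constant-or-not : ∀ n (f : BoolFun n) → (∃[ b ] ∀ x → f x ≡ b) ⊎ (∃[ x ] ∃[ y ] f x ≡ false × f y ≡ true)
  constant-or-not ℕ.zero    f = inj₁ (f [] , λ { [] → refl })
  constant-or-not (ℕ.suc n) f
    with constant-or-not n (λ x → f (false ∷ x)) | constant-or-not n (λ x → f (true ∷ x))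
  ... | inj₂ (x , y , fx , fy) | _                      = inj₂ (false ∷ x , false ∷ y , fx , fy)
  ... | inj₁ _                 | inj₂ (x , y , fx , fy) = inj₂ (true ∷ x , true ∷ y , fx , fy)
  ... | inj₁ (false , h)       | inj₁ (false , h′)      = inj₁ (false , λ { (false ∷ x) → h x ; (true ∷ x) → h′ x })
  ... | inj₁ (true , h)        | inj₁ (true , h′)       = inj₁ (true , λ { (false ∷ x) → h x ; (true ∷ x) → h′ x })
  ... | inj₁ (false , h)       | inj₁ (true , h′)       = inj₂ (false ∷ zeros , true ∷ zeros , h zeros , h′ zeros)
    where
    zeros : Input n
    zeros = Vec.replicate n false
  ... | inj₁ (true , h)        | inj₁ (false , h′)      = inj₂ (true ∷ zeros , false ∷ zeros , h′ zeros , h zeros)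
    where
    zeros : Input n
    zeros = Vec.replicate n false

  worstCase≤ : ∀ {n} (t : DecisionTree n) T → (∀ x → queries t x ℕ.≤ T) → worstCase t ℕ.≤ T
  worstCase≤ {n} t T h = max≤v⁺ ℕ.z≤n (All.map⁺ (All.universal h (inputs n)))

  -- Dyadic scales, logarithms and rational windows

  ≤ι∣↥∣ : ∀ q → q ≤ ι ℤ.∣ ↥ q ∣
  ≤ι∣↥∣ q = ≤-trans (toℚᵘ-cancel-≤ (begin
    toℚᵘ q                          ≤⟨ go q ⟩
    ℚᵘ.mkℚᵘ (+ ℤ.∣ ↥ q ∣) 0         ≃⟨ ℚᵘ.≃-sym (toℚᵘ-fromℚᵘ (ℚᵘ.mkℚᵘ (+ ℤ.∣ ↥ q ∣) 0)) ⟩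
    toℚᵘ (+ ℤ.∣ ↥ q ∣ / 1)          ∎)) (≤-reflexive (sym (ι-≡ ℤ.∣ ↥ q ∣)))
    where
    open ℚᵘ.≤-Reasoning
    go : ∀ q → toℚᵘ q ℚᵘ.≤ ℚᵘ.mkℚᵘ (+ ℤ.∣ ↥ q ∣) 0
    go (mkℚ (+ n) d _)      = ℚᵘ.*≤* (ℤ.*-monoˡ-≤-nonNeg (+ n) (ℤ.+≤+ (ℕ.s≤s ℕ.z≤n)))
    go (mkℚ (ℤ.-[1+ n ]) d _) = ℚᵘ.*≤* ℤ.-≤+

  n≤2^n : ∀ n → n ℕ.≤ 2 ℕ.^ n
  n≤2^n ℕ.zero    = ℕ.z≤n
  n≤2^n (ℕ.suc n) = ℕ.+-mono-≤ (ℕ.m^n>0 2 n) (ℕ.≤-trans (n≤2^n n) (ℕ.≤-reflexive (sym (ℕ.+-identityʳ (2 ℕ.^ n)))))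

  -- Found by searching the exponents downwards from the numerator of `c`. Matching powers of 2 let
  -- depth and logarithm be compared through one integer.
  dyadic : ∀ c → 2ℚ ≤ c → ∃[ j ] ι (2 ℕ.^ (1 ℕ.+ j)) ≤ c × c ≤ ι (2 ℕ.^ (2 ℕ.+ j))
  dyadic c 2≤c = go ℤ.∣ ↥ c ∣ (≤-trans (≤ι∣↥∣ c) (ι-mono (ℕ.≤-trans (n≤2^n ℤ.∣ ↥ c ∣) (ℕ.^-monoʳ-≤ 2 (ℕ.m≤n+m ℤ.∣ ↥ c ∣ 2)))))
    where
    go : ∀ N → c ≤ ι (2 ℕ.^ (2 ℕ.+ N)) → ∃[ j ] ι (2 ℕ.^ (1 ℕ.+ j)) ≤ c × c ≤ ι (2 ℕ.^ (2 ℕ.+ j))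
    go ℕ.zero    c≤ = 0 , ≤-trans (≤-reflexive (ι-≡ 2)) 2≤c , c≤
    go (ℕ.suc N) c≤ with c ≤? ι (2 ℕ.^ (2 ℕ.+ N))
    ... | yes c≤′ = go N c≤′
    ... | no  c≰  = ℕ.suc N , <⇒≤ (≰⇒> c≰) , c≤

  -- There is no error term at any index: for q = a/b, (2^j)^K b^K ≤ a^K, and floors of logarithms
  -- are superadditive and exact on powers of 2.
  ratLog-lower : ∀ j q k → ι (2 ℕ.^ j) ≤ q → ι j ≤ ratLog q k
  ratLog-lower j q k 2^j≤q = ≤-trans (≤-reflexive (ι-≡ j)) (toℚᵘ-cancel-≤ (begin
    toℚᵘ (+ j / 1)               ≃⟨ toℚᵘ-fromℚᵘ (ℚᵘ.mkℚᵘ (+ j) 0) ⟩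
    ℚᵘ.mkℚᵘ (+ j) 0              ≤⟨ ℚᵘ.*≤* scaled ⟩
    ℚᵘ.mkℚᵘ (logNum q K) k       ≃⟨ ℚᵘ.≃-sym (toℚᵘ-fromℚᵘ (ℚᵘ.mkℚᵘ (logNum q K) k)) ⟩
    toℚᵘ (ratLog q k)            ∎))
    where
    open ℚᵘ.≤-Reasoning
    K a b : ℕ
    K = ℕ.suc k
    a = ℤ.∣ ↥ q ∣
    b = ↧ₙ q
    0<q : 0ℚ < q
    0<q = <-≤-trans (positive⁻¹ 1ℚ) (≤-trans (1≤ι (ℕ.m^n>0 2 j)) 2^j≤q)
    cross : ℚᵘ.mkℚᵘ (+ (2 ℕ.^ j)) 0 ℚᵘ.≤ toℚᵘ q
    cross = begin
      ℚᵘ.mkℚᵘ (+ (2 ℕ.^ j)) 0      ≃⟨ ℚᵘ.≃-sym (toℚᵘ-fromℚᵘ (ℚᵘ.mkℚᵘ (+ (2 ℕ.^ j)) 0)) ⟩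
      toℚᵘ (+ (2 ℕ.^ j) / 1)       ≤⟨ toℚᵘ-mono-≤ (≤-trans (≤-reflexive (sym (ι-≡ (2 ℕ.^ j)))) 2^j≤q) ⟩
      toℚᵘ q                       ∎
    2^j*b≤a : 2 ℕ.^ j ℕ.* b ℕ.≤ a
    2^j*b≤a = go q (positive 0<q) cross
      where
      go : ∀ q → Positive q → ℚᵘ.mkℚᵘ (+ (2 ℕ.^ j)) 0 ℚᵘ.≤ toℚᵘ q → 2 ℕ.^ j ℕ.* ↧ₙ q ℕ.≤ ℤ.∣ ↥ q ∣
      go (mkℚ (ℤ.+[1+ p ]) d _) _ h = ℤ.drop‿+≤+
        (subst₂ ℤ._≤_ (sym (ℤ.pos-* (2 ℕ.^ j) (ℕ.suc d))) (ℤ.*-identityʳ (+ ℕ.suc p)) (ℚᵘ.drop-*≤* h))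
    logs : j ℕ.* K ℕ.+ ⌊log₂ b ℕ.^ K ⌋ ℕ.≤ ⌊log₂ a ℕ.^ K ⌋
    logs = ℕR.begin
      j ℕ.* K ℕ.+ ⌊log₂ b ℕ.^ K ⌋                        ℕR.≡⟨ cong (ℕ._+ ⌊log₂ b ℕ.^ K ⌋) (sym (⌊log₂[2^n]⌋≡n (j ℕ.* K))) ⟩
      ⌊log₂ 2 ℕ.^ (j ℕ.* K) ⌋ ℕ.+ ⌊log₂ b ℕ.^ K ⌋        ℕR.≤⟨ LogLemmas.⌊log₂⌋-superadditive (2 ℕ.^ (j ℕ.* K)) (b ℕ.^ K) (ℕ.m^n>0 2 (j ℕ.* K)) (LogLemmas.1≤^ b K (ℕ.s≤s ℕ.z≤n)) ⟩
      ⌊log₂ 2 ℕ.^ (j ℕ.* K) ℕ.* b ℕ.^ K ⌋                ℕR.≡⟨ cong (λ x → ⌊log₂ x ℕ.* b ℕ.^ K ⌋) (sym (ℕ.^-*-assoc 2 j K)) ⟩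
      ⌊log₂ (2 ℕ.^ j) ℕ.^ K ℕ.* b ℕ.^ K ⌋                ℕR.≡⟨ cong ⌊log₂_⌋ (sym (LogLemmas.*-^ (2 ℕ.^ j) b K)) ⟩
      ⌊log₂ (2 ℕ.^ j ℕ.* b) ℕ.^ K ⌋                      ℕR.≤⟨ ⌊log₂⌋-mono-≤ (ℕ.^-monoˡ-≤ K 2^j*b≤a) ⟩
      ⌊log₂ a ℕ.^ K ⌋                                    ℕR.∎
      where module ℕR = ℕ.≤-Reasoning
    scaled : + j ℤ.* + K ℤ.≤ logNum q K ℤ.* + 1
    scaled = subst₂ ℤ._≤_
      (trans (ℤ.+-identityʳ (+ (j ℕ.* K))) (ℤ.pos-* j K))
      (trans (ℤ.+-identityʳ (logNum q K)) (sym (ℤ.*-identityʳ (logNum q K))))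
      (LogLemmas.⊖-≤ (j ℕ.* K) 0 ⌊log₂ a ℕ.^ K ⌋ ⌊log₂ b ℕ.^ K ⌋ 0
        (ℕ.≤-trans logs (ℕ.≤-reflexive (sym (trans (ℕ.+-identityʳ (⌊log₂ a ℕ.^ K ⌋ ℕ.+ 0)) (ℕ.+-identityʳ ⌊log₂ a ℕ.^ K ⌋))))))

  Ev-close : ∀ x η → 0ℚ < η → Ev (λ k → ∀ m → k ℕ.≤ m → seq x k ≤ seq x m + η × seq x m ≤ seq x k + η)
  Ev-close x η 0<η = proj₁ (cauchy x η 0<η) , λ k N≤k m k≤m →
    ∣-∣≤⇒≤ (seq x k) (seq x m) (proj₂ (cauchy x η 0<η) k m N≤k (ℕ.≤-trans N≤k k≤m)) ,
    ∣-∣≤⇒≤ (seq x m) (seq x k) (proj₂ (cauchy x η 0<η) m k (ℕ.≤-trans N≤k k≤m) N≤k)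

  -- A positive lower bound `d` for ε turns the absolute accuracy d/16 into a relative one. The
  -- bound 7/48 is 1/8 plus the slack 1/48.
  ε-window : ∀ ε → R.0ℝ R.< ε → ε R.≤ R.fromℚ (+ 1 / 8) →
    ∃[ e ] 0ℚ < e × e ≤ + 7 / 48 × Ev (λ m → + 15 / 16 * e ≤ seq ε m × seq ε m ≤ + 17 / 16 * e)
  ε-window ε (d , 0<d , N , d≤ε) ε≤⅛ = e , <-≤-trans 0<d d≤e , small , k , λ m k≤m →
    ≤-since (0≤+ (gap (proj₁ (close m k≤m))) (0≤* 0≤1/16 (gap d≤e))) (lower e (seq ε m) d) ,
    ≤-since (0≤+ (gap (proj₂ (close m k≤m))) (0≤* 0≤1/16 (gap d≤e))) (upper e (seq ε m) d)
    where
    0≤1/16 : 0ℚ ≤ + 1 / 16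
    0≤1/16 = nonNegative⁻¹ (+ 1 / 16)
    good = Ev-zip (λ _ → _,_)
      (Ev-close ε (+ 1 / 16 * d) (CauchyLemmas.*-pos (positive⁻¹ (+ 1 / 16)) 0<d))
      (Ev-zip (λ _ → _,_) (N , d≤ε) (≤ᴿ⇒≲ ε (R.fromℚ (+ 1 / 8)) ε≤⅛ (+ 1 / 48) (positive⁻¹ (+ 1 / 48))))
    k : ℕ
    k = proj₁ good
    close = proj₁ (proj₂ good k ℕ.≤-refl)
    e : ℚ
    e = seq ε k
    d≤e : d ≤ e
    d≤e = ≤-trans (≤-reflexive (sym (+-identityˡ d))) (proj₁ (proj₂ (proj₂ good k ℕ.≤-refl)))
    small : e ≤ + 7 / 48
    small = proj₂ (proj₂ (proj₂ good k ℕ.≤-refl))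
    lower : ∀ e x d → x - + 15 / 16 * e ≡ (x + + 1 / 16 * d - e) + + 1 / 16 * (e - d)
    lower = solve-∀ ring
    upper : ∀ e x d → + 17 / 16 * e - x ≡ (e + + 1 / 16 * d - x) + + 1 / 16 * (e - d)
    upper = solve-∀ ring

  window : ∀ x → Ev (λ m → + 9 / 4 ≤ seq x m) → ∃[ c ] 2ℚ ≤ c × Ev (λ m → c ≤ seq x m × seq x m ≤ c + ¼)
  window x low = c , 2≤c , k , λ m k≤m →
    ≤-since (gap (proj₁ (close m k≤m))) (lower (seq x k) (seq x m)) ,
    ≤-since (gap (proj₂ (close m k≤m))) (upper (seq x k) (seq x m))
    where
    good = Ev-zip (λ _ → _,_) low (Ev-close x (+ 1 / 8) (positive⁻¹ (+ 1 / 8)))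
    k : ℕ
    k = proj₁ good
    close = proj₂ (proj₂ good k ℕ.≤-refl)
    c : ℚ
    c = seq x k - + 1 / 8
    2≤c : 2ℚ ≤ c
    2≤c = ≤-since (0≤+ (gap (proj₁ (proj₂ good k ℕ.≤-refl))) (nonNegative⁻¹ (+ 1 / 8))) (shift (seq x k))
      where
      shift : ∀ x → x - + 1 / 8 - 2ℚ ≡ (x - + 9 / 4) + + 1 / 8
      shift = solve-∀ ring
    lower : ∀ a b → b - (a - + 1 / 8) ≡ b + + 1 / 8 - a
    lower = solve-∀ ring
    upper : ∀ a b → a - + 1 / 8 + ¼ - b ≡ a + + 1 / 8 - b
    upper = solve-∀ ring

  -- Rational weights from a feasible solution

  module Approximation {n : ℕ} (f : BoolFun n) (ε : R.ℝ) (w : R.Weights n) (feasible : R.Feasible f ε w) where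

    -- Cutting at 0 makes nonnegativity exact; the other constraints hold only in the relaxed form
    -- `Good`.
    w′ : ℕ → Bool → Assignment n → ℚ
    w′ k z A = 0ℚ ⊔ seq (w z A) k

    w′-nonNeg : ∀ k z A → 0ℚ ≤ w′ k z A
    w′-nonNeg k z A = p≤p⊔q 0ℚ (seq (w z A) k)

    w≲w′ : ∀ z A → seq (w z A) ≲ (λ k → w′ k z A)
    w≲w′ z A = ≤⇒≲ {seq (w z A)} {λ k → w′ k z A} (λ k → p≤q⊔p 0ℚ (seq (w z A) k))

    w′≲w : ∀ z A → (λ k → w′ k z A) ≲ seq (w z A)
    w′≲w z A = ≲-⊔ {λ _ → 0ℚ} {seq (w z A)} {seq (w z A)} (≤ᴿ⇒≲ R.0ℝ (w z A) (R.Feasible.nonNeg feasible z A))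
      (≤⇒≲ {seq (w z A)} {seq (w z A)} (λ _ → ≤-refl))

    weight : ℕ → Bool → Input n → ℚ
    weight k = Weights.weight (w′ k)

    cost : ℕ → Bool → ℚ
    cost k = Weights.cost (w′ k)

    seq-weight : ∀ z x k → seq (R.∑ (containing x) (w z)) k ≡ ∑[ A ← assignments n ] seq (w z A) k * ind x A
    seq-weight z x k = trans (seq-∑ (containing x) (w z) k) (∑-containing x (λ A → seq (w z A) k))

    covering≲ : ∀ x → (λ k → 1ℚ + - seq ε k) ≲ (λ k → weight k (f x) x)
    covering≲ x = ≲-trans {λ k → 1ℚ + - seq ε k} {seq (R.∑ (containing x) (w (f x)))} {λ k → weight k (f x) x}
      (≤ᴿ⇒≲ (R.1ℝ R.- ε) (R.∑ (containing x) (w (f x))) (R.Feasible.covering feasible x))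
      (≲-trans {seq (R.∑ (containing x) (w (f x)))} {λ k → ∑[ A ← assignments n ] seq (w (f x) A) k * ind x A} {λ k → weight k (f x) x}
        (≤⇒≲ {seq (R.∑ (containing x) (w (f x)))} {λ k → ∑[ A ← assignments n ] seq (w (f x) A) k * ind x A} (λ k → ≤-reflexive (seq-weight (f x) x k)))
        (≲-∑ (assignments n) {λ k A → seq (w (f x) A) k * ind x A} {λ k A → w′ k (f x) A * ind x A}
          (λ A → ≲-*ʳ {seq (w (f x) A)} {λ k → w′ k (f x) A} (ind x A) (ind-nonNeg x A) (w≲w′ (f x) A))))

    weight≲ : ∀ z x → (λ k → weight k z x) ≲ seq (R.∑ (containing x) (w z))
    weight≲ z x = ≲-trans {λ k → weight k z x} {λ k → ∑[ A ← assignments n ] seq (w z A) k * ind x A} {seq (R.∑ (containing x) (w z))}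
      (≲-∑ (assignments n) {λ k A → w′ k z A * ind x A} {λ k A → seq (w z A) k * ind x A}
        (λ A → ≲-*ʳ {λ k → w′ k z A} {seq (w z A)} (ind x A) (ind-nonNeg x A) (w′≲w z A)))
      (≤⇒≲ {λ k → ∑[ A ← assignments n ] seq (w z A) k * ind x A} {seq (R.∑ (containing x) (w z))} (λ k → ≤-reflexive (sym (seq-weight z x k))))

    total≲ : ∀ x → (λ k → weight k false x + weight k true x) ≲ (λ _ → 1ℚ)
    total≲ x = ≲-trans {λ k → weight k false x + weight k true x} {seq labels} {λ _ → 1ℚ}
      (≲-trans {λ k → weight k false x + weight k true x} {λ k → seq (at false) k + seq (at true) k} {seq labels}
        (≲-+ {λ k → weight k false x} {seq (at false)} {λ k → weight k true x} {seq (at true)} (weight≲ false x) (weight≲ true x))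
        (≤⇒≲ {λ k → seq (at false) k + seq (at true) k} {seq labels}
          (λ k → ≤-reflexive (cong (_+_ (seq (at false) k)) (sym (+-identityʳ (seq (at true) k)))))))
      (≤ᴿ⇒≲ labels R.1ℝ (proj₁ (R.Feasible.partition feasible x)))
      where
      at : Bool → R.ℝ
      at z = R.∑ (containing x) (w z)
      labels : R.ℝ
      labels = R.∑ bits at

    cost≲ : ∀ v → R.objective w R.≤ v → (λ k → cost k false + cost k true) ≲ seq v
    cost≲ v obj≤v = ≲-trans {λ k → cost k false + cost k true} {seq (R.objective w)} {seq v}
      (≲-trans {λ k → cost k false + cost k true} {λ k → seq (at false) k + seq (at true) k} {seq (R.objective w)}
        (≲-+ {λ k → cost k false} {seq (at false)} {λ k → cost k true} {seq (at true)} (cost-z≲ false) (cost-z≲ true))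
        (≤⇒≲ {λ k → seq (at false) k + seq (at true) k} {seq (R.objective w)}
          (λ k → ≤-reflexive (cong (_+_ (seq (at false) k)) (sym (+-identityʳ (seq (at true) k)))))))
      (≤ᴿ⇒≲ (R.objective w) v obj≤v)
      where
      at : Bool → R.ℝ
      at z = R.∑ (assignments n) (λ A → w z A R.* R.fromℕ (2 ℕ.^ R.codim A))
      seq-at : ∀ z k → ∑[ A ← assignments n ] seq (w z A) k * ι (2 ℕ.^ R.codim A) ≡ seq (at z) k
      seq-at z k = trans (∑-cong (assignments n) (λ A → cong (seq (w z A) k *_) (ι-≡ (2 ℕ.^ R.codim A))))
        (sym (seq-∑ (assignments n) (λ A → w z A R.* R.fromℕ (2 ℕ.^ R.codim A)) k))
      cost-z≲ : ∀ z → (λ k → cost k z) ≲ seq (at z)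
      cost-z≲ z = ≲-trans {λ k → cost k z} {λ k → ∑[ A ← assignments n ] seq (w z A) k * ι (2 ℕ.^ R.codim A)} {seq (at z)}
        (≲-∑ (assignments n) {λ k A → w′ k z A * ι (2 ℕ.^ R.codim A)} {λ k A → seq (w z A) k * ι (2 ℕ.^ R.codim A)}
          (λ A → ≲-*ʳ {λ k → w′ k z A} {seq (w z A)} (ι (2 ℕ.^ R.codim A)) (ι-nonNeg (2 ℕ.^ R.codim A)) (w′≲w z A)))
        (≤⇒≲ {λ k → ∑[ A ← assignments n ] seq (w z A) k * ι (2 ℕ.^ R.codim A)} {seq (at z)} (λ k → ≤-reflexive (seq-at z k)))

    module _ (e : ℚ) (0<e : 0ℚ < e) (e≤ : e ≤ + 7 / 48) (ε≤e : Ev (λ k → seq ε k ≤ + 17 / 16 * e)) where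

      Good : ℕ → Set
      Good k = (∀ x → + 13 / 16 ≤ weight k (f x) x)
        × (∀ x → weight k (not (f x)) x ≤ + 9 / 8 * e)
        × (∀ x → weight k false x + weight k true x ≤ + 17 / 16)

      private
        η : ℚ
        -- Proportional to e, because the weight of the wrong label must stay O(e): 17/16 + 2 · 1/32
        -- = 9/8.
        η = + 1 / 32 * e
        0<η : 0ℚ < η
        0<η = CauchyLemmas.*-pos (positive⁻¹ (+ 1 / 32)) 0<e

      good : Ev Good
      good = Ev-map (λ k h → (λ x → proj₁ (h x)) , (λ x → proj₁ (proj₂ (h x))) , (λ x → proj₂ (proj₂ (h x))))
        (Ev-Input n (λ x → Ev-zip (λ k ε≤ (cov , tot) → facts x k ε≤ cov tot) ε≤e
          (Ev-zip (λ _ → _,_) (covering≲ x η 0<η) (total≲ x η 0<η))))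
        where
        facts : ∀ x k → seq ε k ≤ + 17 / 16 * e → 1ℚ + - seq ε k ≤ weight k (f x) x + η →
          weight k false x + weight k true x ≤ 1ℚ + η →
          + 13 / 16 ≤ weight k (f x) x × weight k (not (f x)) x ≤ + 9 / 8 * e × weight k false x + weight k true x ≤ + 17 / 16
        facts x k ε≤ cov tot =
          ≤-since (0≤+ (0≤+ (0≤+ (gap cov) (gap ε≤)) (0≤* (nonNegative⁻¹ (+ 35 / 32)) (gap e≤))) (nonNegative⁻¹ (+ 43 / 1536)))
            (certificate₁ (weight k (f x) x) (seq ε k) e) ,
          wrong (f x) cov ,
          ≤-since (0≤+ (0≤+ (gap tot) (0≤* (nonNegative⁻¹ (+ 1 / 32)) (gap e≤))) (nonNegative⁻¹ (+ 89 / 1536)))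
            (certificate₃ (weight k false x + weight k true x) e)
          where
          certificate₁ : ∀ a ε e → a - + 13 / 16 ≡
            (a + + 1 / 32 * e - (1ℚ + - ε)) + (+ 17 / 16 * e - ε) + + 35 / 32 * (+ 7 / 48 - e) + + 43 / 1536
          certificate₁ = solve-∀ ring
          certificate₃ : ∀ a e → + 17 / 16 - a ≡ (1ℚ + + 1 / 32 * e - a) + + 1 / 32 * (+ 7 / 48 - e) + + 89 / 1536
          certificate₃ = solve-∀ ring
          wrong : ∀ z → 1ℚ + - seq ε k ≤ weight k z x + η → weight k (not z) x ≤ + 9 / 8 * e
          wrong false cov = ≤-since (0≤+ (0≤+ (gap cov) (gap tot)) (gap ε≤))
            (certificate (weight k false x) (weight k true x) (seq ε k) e)
            where
            certificate : ∀ a b ε e → + 9 / 8 * e - b ≡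
              (a + + 1 / 32 * e - (1ℚ + - ε)) + (1ℚ + + 1 / 32 * e - (a + b)) + (+ 17 / 16 * e - ε)
            certificate = solve-∀ ring
          wrong true cov = ≤-since (0≤+ (0≤+ (gap cov) (gap tot)) (gap ε≤))
            (certificate (weight k false x) (weight k true x) (seq ε k) e)
            where
            certificate : ∀ a b ε e → + 9 / 8 * e - a ≡
              (b + + 1 / 32 * e - (1ℚ + - ε)) + (1ℚ + + 1 / 32 * e - (a + b)) + (+ 17 / 16 * e - ε)
            certificate = solve-∀ ring

      -- Subcubes separating x from y fix a coordinate, so they cost at least 2.
      cost≥ : ∀ x y → f x ≡ false → f y ≡ true → ∀ k → Good k → + 5 / 2 ≤ cost k false + cost k true
      cost≥ x y fx fy k (cov , wrong , _) = ≤-since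
        (0≤+ (0≤+ (0≤+ (0≤+ (0≤+ (gap (cost-lower f (w′ k) (w′-nonNeg k) false x y))
                                  (gap (cost-lower f (w′ k) (w′-nonNeg k) true y x)))
          (0≤* 0≤2 (0≤+ (gap cov-x) (gap cov-y)))) (0≤* 0≤2 (0≤+ (gap wrong-x) (gap wrong-y))))
          (0≤* (nonNegative⁻¹ (+ 9 / 2)) (gap e≤))) (nonNegative⁻¹ (+ 3 / 32)))
        -- 4 · 13/16 - 4 · 9/8 · 7/48 = 5/2 + 3/32.
        (certificate (cost k false + cost k true) (cost k false) (cost k true) (weight k false x) (weight k false y) (weight k true x) (weight k true y) e refl)
        where
        0≤2 : 0ℚ ≤ 2ℚ
        0≤2 = nonNegative⁻¹ 2ℚ
        cov-x : + 13 / 16 ≤ weight k false x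
        cov-x = subst (λ z → + 13 / 16 ≤ weight k z x) fx (cov x)
        cov-y : + 13 / 16 ≤ weight k true y
        cov-y = subst (λ z → + 13 / 16 ≤ weight k z y) fy (cov y)
        wrong-x : weight k true x ≤ + 9 / 8 * e
        wrong-x = subst (λ z → weight k (not z) x ≤ + 9 / 8 * e) fx (wrong x)
        wrong-y : weight k false y ≤ + 9 / 8 * e
        wrong-y = subst (λ z → weight k (not z) y ≤ + 9 / 8 * e) fy (wrong y)
        certificate : ∀ s c d p q r t e → s ≡ c + d → s - + 5 / 2 ≡
          (c - 2ℚ * (p - q)) + (d - 2ℚ * (t - r)) + 2ℚ * ((p - + 13 / 16) + (t - + 13 / 16))
          + 2ℚ * ((+ 9 / 8 * e - r) + (+ 9 / 8 * e - q)) + + 9 / 2 * (+ 7 / 48 - e) + + 3 / 32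
        certificate _ c d p q r t e refl = identity c d p q r t e
          where
          identity : ∀ c d p q r t e → c + d - + 5 / 2 ≡
            (c - 2ℚ * (p - q)) + (d - 2ℚ * (t - r)) + 2ℚ * ((p - + 13 / 16) + (t - + 13 / 16))
            + 2ℚ * ((+ 9 / 8 * e - r) + (+ 9 / 8 * e - q)) + + 9 / 2 * (+ 7 / 48 - e) + + 3 / 32
          identity = solve-∀ ring

  -- Passing back to the reals

  -- The mass of an input is charged to the error if the tree errs on it, and otherwise to the
  -- success probability under `g`, at a loss of η.
  success : ∀ {n} (f : BoolFun n) t (s : State n) g {η} → (∀ x → mass s x ≤ g x + η) → 0ℚ ≤ η →
    1ℚ ≤ 𝔼 s (err f t) + (∑ (filter (λ x → output t x Bool.≟ f x) (inputs n)) g + (∑[ x ← inputs n ] η))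
  success {n} f t s g {η} close 0≤η = begin
    1ℚ                                                     ≡⟨ sym (𝔼-1 s) ⟩
    ∑[ x ← inputs n ] mass s x * 1ℚ                        ≤⟨ ∑-mono (inputs n) (λ x → pointwise x (output t x Bool.≟ f x)) ⟩
    ∑[ x ← inputs n ] (mass s x * err f t x + (kept x + η))
      ≡⟨ ∑-+ (inputs n) (λ x → mass s x * err f t x) (λ x → kept x + η) ⟩
    𝔼 s (err f t) + (∑[ x ← inputs n ] (kept x + η))
      ≡⟨ cong (λ z → 𝔼 s (err f t) + z) (trans (∑-+ (inputs n) kept (λ _ → η))
           (cong (λ z → z + ∑ (inputs n) (λ _ → η)) (sym (∑-filter (λ x → output t x Bool.≟ f x) (inputs n) g)))) ⟩
    𝔼 s (err f t) + (∑ (filter (λ x → output t x Bool.≟ f x) (inputs n)) g + (∑[ x ← inputs n ] η)) ∎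
    where
    open ≤-Reasoning
    kept : Input n → ℚ
    kept x = if does (output t x Bool.≟ f x) then g x else 0ℚ
    δ-not : ∀ b c → ¬ (b ≡ c) → δ (not b) c ≡ 1ℚ
    δ-not false false b≢c = contradiction refl b≢c
    δ-not false true  b≢c = refl
    δ-not true  false b≢c = refl
    δ-not true  true  b≢c = contradiction refl b≢c
    pointwise : ∀ x (d : Dec (output t x ≡ f x)) →
      mass s x * 1ℚ ≤ mass s x * err f t x + ((if does d then g x else 0ℚ) + η)
    pointwise x (yes _) = ≤-since (0≤+ (0≤* (mass-nonNeg s x) (δ-nonNeg (not (output t x)) (f x))) (gap (close x)))
      (certificate (mass s x) (err f t x) (g x) η)
      where
      certificate : ∀ m d g η → m * d + (g + η) - m * 1ℚ ≡ m * d + (g + η - m)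
      certificate = solve-∀ ring
    pointwise x (no wrong) = ≤-since 0≤η
      (trans (cong (λ d → mass s x * d + (0ℚ + η) - mass s x * 1ℚ) (δ-not (output t x) (f x) wrong)) (certificate (mass s x) η))
      where
      certificate : ∀ m η → m * 1ℚ + (0ℚ + η) - m * 1ℚ ≡ η
      certificate = solve-∀ ring

  module Transfer {n : ℕ} (f : BoolFun n) (ε : R.ℝ) (μ : R.Distribution n)
    (m : Fin n → Bool → R.ℝ) (bounds : ∀ i b → R.0ℝ R.≤ m i b × m i b R.≤ R.1ℝ)
    (sums : ∀ i → m i false R.+ m i true R.≈ R.1ℝ)
    (product : ∀ x → R.pmf μ x R.≈ R.∏ (λ i → m i (lookup x i)))
    (e : ℚ) (0<e : 0ℚ < e) (e≤ε : Ev (λ k → + 15 / 16 * e ≤ seq ε k)) where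

    private
      count C d η : ℚ
      count = ∑[ x ← inputs n ] 1ℚ
      C = 1ℚ + count
      0<C : 0ℚ < C
      0<C = +-mono-<-≤ (positive⁻¹ 1ℚ) (∑-nonNeg (inputs n) (λ _ → nonNegative⁻¹ 1ℚ))
      d = proj₁ (CauchyLemmas.inverse C 0<C)
      0<d : 0ℚ < d
      0<d = proj₁ (proj₂ (CauchyLemmas.inverse C 0<C))
      -- Summed over all inputs this stays below e; 1 + `count` serves as a visibly positive
      -- divisor.
      η = e * d
      0<η : 0ℚ < η
      0<η = CauchyLemmas.*-pos 0<e 0<d
      ∑η≤e : ∑[ x ← inputs n ] η ≤ e
      ∑η≤e = ≤-since (<⇒≤ 0<η) (trans
        (cong₂ _-_ (trans (sym (*-identityʳ e)) (cong (e *_) (sym (proj₂ (proj₂ (CauchyLemmas.inverse C 0<C))))))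
          (trans (∑-cong (inputs n) (λ _ → sym (*-identityʳ η))) (∑-*ˡ η (inputs n) (λ _ → 1ℚ))))
        (certificate e count d))
        where
        certificate : ∀ e s d → e * ((1ℚ + s) * d) - e * d * s ≡ e * d
        certificate = solve-∀ ring

    -- The tree is built from the state at the single index `k`, whereas its success must be judged
    -- at all later terms of μ; hence two indices.
    Tracks : ℕ → Set
    Tracks k = ∀ x l → k ℕ.≤ l → mass (state m k) x ≤ seq (R.pmf μ x) l + η

    tracks : Ev Tracks
    tracks = Ev-Input n (λ x → Ev-zip
      (λ k near steady l k≤l → ≤-since (0≤+ (gap near) (gap (proj₁ (steady l k≤l))))
        (certificate (mass (state m k) x) (seq (R.pmf μ x) k) (seq (R.pmf μ x) l) η))
      (≲-trans {λ k → mass (state m k) x} {seq (R.∏ (λ i → m i (lookup x i)))} {seq (R.pmf μ x)}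
        (~⇒≲ {λ k → mass (state m k) x} {seq (R.∏ (λ i → m i (lookup x i)))} (mass-~ m bounds sums x))
        (≤ᴿ⇒≲ (R.∏ (λ i → m i (lookup x i))) (R.pmf μ x) (proj₂ (product x))) (½ * η) (½-pos 0<η))
      (Ev-close (R.pmf μ x) (½ * η) (½-pos 0<η)))
      where
      certificate : ∀ a b c η → c + η - a ≡ (b + ½ * η - a) + (c + ½ * η - b)
      certificate = solve-∀ ring

    -- Failure would give a positive γ by which the success probability stays below 1 - 8ε. At a
    -- common late index the error is at most 11/2 e + e, while 8ε ≥ 15/2 e, which forces γ ≤ 0.
    computes : ∀ t k → Tracks k → 𝔼 (state m k) (err f t) ≤ + 11 / 2 * e → R.Computes μ (R.fromℕ 8 R.* ε) f t
    computes t k track error (γ , 0<γ , N , below) = contradiction (≤-since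
        (0≤+ (0≤+ (0≤+ (0≤+ (0≤+ (gap (below l N≤l)) (gap (success f t (state m k) (λ x → seq (R.pmf μ x) l) (λ x → track x l k≤l) (<⇒≤ 0<η))))
          (gap error)) (gap ∑η≤e)) (0≤* (nonNegative⁻¹ (+ 8 / 1)) (gap (proj₂ e≤ε l E≤l)))) (<⇒≤ 0<e))
        (certificate γ (seq Pr l) (∑ (filter E? (inputs n)) (λ x → seq (R.pmf μ x) l)) (seq ε l)
          (𝔼 (state m k) (err f t)) (∑[ x ← inputs n ] η) e Pr≡))
      (λ γ≤0 → <-irrefl refl (<-≤-trans 0<γ γ≤0))
      where
      E? = λ x → output t x Bool.≟ f x
      Pr : R.ℝ
      Pr = R.Pr μ E?
      l : ℕ
      l = k ℕ.⊔ (N ℕ.⊔ proj₁ e≤ε)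
      k≤l : k ℕ.≤ l
      k≤l = ℕ.m≤m⊔n k (N ℕ.⊔ proj₁ e≤ε)
      N≤l : N ℕ.≤ l
      N≤l = ℕ.≤-trans (ℕ.m≤m⊔n N (proj₁ e≤ε)) (ℕ.m≤n⊔m k (N ℕ.⊔ proj₁ e≤ε))
      E≤l : proj₁ e≤ε ℕ.≤ l
      E≤l = ℕ.≤-trans (ℕ.m≤n⊔m N (proj₁ e≤ε)) (ℕ.m≤n⊔m k (N ℕ.⊔ proj₁ e≤ε))
      Pr≡ : seq Pr l ≡ ∑ (filter E? (inputs n)) (λ x → seq (R.pmf μ x) l)
      Pr≡ = seq-∑ (filter E? (inputs n)) (R.pmf μ) l
      certificate : ∀ γ p q ε g h e → p ≡ q → 0ℚ - γ ≡
        (1ℚ + - (+ 8 / 1 * ε) - (p + γ)) + (g + (q + h) - 1ℚ) + (+ 11 / 2 * e - g) + (e - h) + + 8 / 1 * (ε - + 15 / 16 * e) + e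
      certificate γ p _ ε g h e refl = identity γ p ε g h e
        where
        identity : ∀ γ p ε g h e → 0ℚ - γ ≡
          (1ℚ + - (+ 8 / 1 * ε) - (p + γ)) + (g + (p + h) - 1ℚ) + (+ 11 / 2 * e - g) + (e - h) + + 8 / 1 * (ε - + 15 / 16 * e) + e
        identity = solve-∀ ring

    constant-computes : ∀ b → (∀ x → f x ≡ b) → R.Computes μ (R.fromℕ 8 R.* ε) f (leaf b)
    constant-computes b f≡b = computes (leaf b) (proj₁ tracks) (proj₂ tracks (proj₁ tracks) ℕ.≤-refl) (begin
      𝔼 s (λ x → δ (not b) (f x))     ≡⟨ 𝔼-cong s (λ x → trans (cong (δ (not b)) (f≡b x)) (right b)) ⟩
      𝔼 s (λ x → 0ℚ)                  ≡⟨ 𝔼-cong s (λ x → sym (*-zeroˡ 1ℚ)) ⟩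
      𝔼 s (λ x → 0ℚ * 1ℚ)             ≡⟨ 𝔼-*ˡ s 0ℚ (λ _ → 1ℚ) ⟩
      0ℚ * 𝔼 s (λ _ → 1ℚ)             ≡⟨ *-zeroˡ (𝔼 s (λ _ → 1ℚ)) ⟩
      0ℚ                              ≤⟨ 0≤* (nonNegative⁻¹ (+ 11 / 2)) (<⇒≤ 0<e) ⟩
      + 11 / 2 * e                    ∎)
      where
      open ≤-Reasoning
      s : State n
      s = state m (proj₁ tracks)
      right : ∀ b → δ (not b) b ≡ 0ℚ
      right false = refl
      right true  = refl

  module Shallow {n : ℕ} (f : BoolFun n) (ε : R.ℝ) (w : R.Weights n) (feasible : R.Feasible f ε w)
    (v : R.ℝ) (obj≤v : R.objective w R.≤ v) (x y : Input n) (fx : f x ≡ false) (fy : f y ≡ true)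
    (e : ℚ) (0<e : 0ℚ < e) (e≤ : e ≤ + 7 / 48) (ε≤e : Ev (λ k → seq ε k ≤ + 17 / 16 * e)) where

    open Approximation f ε w feasible

    Cheap : ℕ → Set
    Cheap k = cost k false + cost k true ≤ seq v k + + 1 / 8

    good-cheap : Ev (λ k → Good e 0<e e≤ ε≤e k × Cheap k)
    good-cheap = Ev-zip (λ _ → _,_) (good e 0<e e≤ ε≤e) (cost≲ v obj≤v (+ 1 / 8) (positive⁻¹ (+ 1 / 8)))

    v-window : ∃[ c ] 2ℚ ≤ c × Ev (λ k → c ≤ seq v k × seq v k ≤ c + ¼)
    v-window = window v (Ev-map
      (λ k (g , cheap) → ≤-since (0≤+ (0≤+ (gap (cost≥ e 0<e e≤ ε≤e x y fx fy k g)) (gap cheap)) (nonNegative⁻¹ (+ 1 / 8)))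
        (certificate (cost k false + cost k true) (seq v k)))
      good-cheap)
      where
      certificate : ∀ c v → v - + 9 / 4 ≡ (c - + 5 / 2) + (v + + 1 / 8 - c) + + 1 / 8
      certificate = solve-∀ ring

    c : ℚ
    c = proj₁ v-window
    2≤c : 2ℚ ≤ c
    2≤c = proj₁ (proj₂ v-window)
    j : ℕ
    j = proj₁ (dyadic c 2≤c)

    v-large : Ev (λ k → ι (2 ℕ.^ (1 ℕ.+ j)) ≤ seq v k)
    v-large = Ev-map (λ k (c≤v , _) → ≤-trans (proj₁ (proj₂ (dyadic c 2≤c))) c≤v) (proj₂ (proj₂ v-window))

    -- The cost is at most v + 1/8 ≤ c + 3/8 ≤ 2c, and c ≤ 2^(2+j).
    usable : Ev (λ k → Good e 0<e e≤ ε≤e k × cost k false + cost k true ≤ ι (2 ℕ.^ (3 ℕ.+ j)))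
    usable = Ev-zip (λ k (g , cheap) (_ , v≤c) → g , ≤-trans
      (≤-since (0≤+ (0≤+ (0≤+ (gap cheap) (gap v≤c)) (0≤+ (gap 2≤c) (nonNegative⁻¹ (+ 13 / 8))))
          (0≤* (nonNegative⁻¹ 2ℚ) (gap (proj₂ (proj₂ (dyadic c 2≤c))))))
        (certificate (cost k false + cost k true) (seq v k) c (ι (2 ℕ.^ (2 ℕ.+ j)))))
      (≤-reflexive (sym (ι-2^suc (2 ℕ.+ j))))) good-cheap (proj₂ (proj₂ v-window))
      where
      certificate : ∀ q v c p → 2ℚ * p - q ≡
        (v + + 1 / 8 - q) + (c + ¼ - v) + (c - 2ℚ + + 13 / 8) + 2ℚ * (p - c)
      certificate = solve-∀ ring

    -- `S` is a slot for one further eventual property, so that the index at which the tree is built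
    -- can also satisfy `Tracks`. The 7 is 3 from the cost bound plus 4 from truncation.
    find-tree : ∀ l K M → K ≡ 7 ℕ.+ j → M ≡ 96 ℕ.* (K ℕ.* K) → 1ℚ ≤ e * ι (2 ℕ.^ l) → (s : ℕ → State n) →
      {S : ℕ → Set} → Ev S → ∃[ k ] S k × (∃[ t ] (∀ x → queries t x ℕ.≤ (2 ℕ.+ l) ℕ.* M) × 𝔼 (s k) (err f t) ≤ + 11 / 2 * e)
    find-tree l K M K≡ M≡ timeout s {S} ev = k , proj₁ at-k ,
      shallow-tree f (w′ k) (w′-nonNeg k) e (<⇒≤ 0<e) (3 ℕ.+ j) K l M K≡ M≡
        (proj₁ g) (proj₁ (proj₂ g)) (proj₂ (proj₂ g)) (proj₂ (proj₂ at-k)) timeout (s k)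
      where
      chosen : Ev (λ k → S k × (Good e 0<e e≤ ε≤e k × cost k false + cost k true ≤ ι (2 ℕ.^ (3 ℕ.+ j))))
      chosen = Ev-zip (λ _ → _,_) ev usable
      k : ℕ
      k = proj₁ chosen
      at-k = proj₂ chosen k ℕ.≤-refl
      g = proj₁ (proj₂ at-k)

  -- The scale of 1/ε and the final constants

  module Logarithm (e : ℚ) (0<e : 0ℚ < e) (e≤ : e ≤ + 7 / 48) where

    a b : ℚ
    a = + 17 / 16 * e
    b = recip a
    0<a : 0ℚ < a
    0<a = CauchyLemmas.*-pos (positive⁻¹ (+ 17 / 16)) 0<e
    0≤b : 0ℚ ≤ b
    0≤b = <⇒≤ (CauchyLemmas.recip-pos a 0<a)
    ab≡1 : a * b ≡ 1ℚ
    ab≡1 = CauchyLemmas.recip-inverse a 0<a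

    2≤b : 2ℚ ≤ b
    2≤b = ≤-since (0≤* 0≤b (0≤+ (0≤* (nonNegative⁻¹ (+ 17 / 8)) (gap e≤)) (nonNegative⁻¹ (+ 265 / 384))))
      (trans (cong (λ z → b - 2ℚ * z) (sym ab≡1)) (certificate e b))
      where
      certificate : ∀ e b → b - 2ℚ * (+ 17 / 16 * e * b) ≡ b * (+ 17 / 8 * (+ 7 / 48 - e) + + 265 / 384)
      certificate = solve-∀ ring

    l : ℕ
    l = proj₁ (dyadic b 2≤b)

    -- `b` is at most 2^(2+l) and e · 2b = 32/17, so one more doubling absorbs the factor 17/16 in
    -- `a`.
    timeout : 1ℚ ≤ e * ι (2 ℕ.^ (3 ℕ.+ l))
    timeout = ≤-since (0≤+ (0≤* (0≤* (nonNegative⁻¹ 2ℚ) (<⇒≤ 0<e)) (gap (proj₂ (proj₂ (dyadic b 2≤b))))) (0≤* (nonNegative⁻¹ (+ 15 / 16)) (0≤* (<⇒≤ 0<e) 0≤b)))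
      (trans (cong₂ (λ p z → e * p - z) (ι-2^suc (2 ℕ.+ l)) (sym ab≡1)) (certificate e b (ι (2 ℕ.^ (2 ℕ.+ l)))))
      where
      certificate : ∀ e b p → e * (2ℚ * p) - + 17 / 16 * e * b ≡ 2ℚ * e * (p - b) + + 15 / 16 * (e * b)
      certificate = solve-∀ ring

    -- `b` is the reciprocal of the upper end of the window, so 2^(1+l) ≤ `b` lies below every 1/x.
    log-large : ∀ x k → + 15 / 16 * e ≤ x → x ≤ a → ι (1 ℕ.+ l) ≤ ratLog (recip x) k
    log-large x k e≤x x≤a = ratLog-lower (1 ℕ.+ l) (recip x) k (≤-trans (proj₁ (proj₂ (dyadic b 2≤b)))
      (CauchyLemmas.recip-antimono (<-≤-trans (CauchyLemmas.*-pos (positive⁻¹ (+ 15 / 16)) 0<e) e≤x) x≤a))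

  log-scale : ∀ e → 0ℚ < e → e ≤ + 7 / 48 → ∃[ l ] 1ℚ ≤ e * ι (2 ℕ.^ (3 ℕ.+ l)) ×
    (∀ x k → + 15 / 16 * e ≤ x → x ≤ + 17 / 16 * e → ι (1 ℕ.+ l) ≤ ratLog (recip x) k)
  log-scale e 0<e e≤ = l , timeout , log-large
    where open Logarithm e 0<e e≤

  -- With v ≥ 2^(1+j) and 1/ε ≥ 2^(1+l) the tree has depth (5 + l) * 96 * (7 + j)²,
  -- which is at most 5 * 96 * 7² * (1 + j)² (1 + l); p ≥ ½ + j ≥ ½ (1 + j) costs
  -- the remaining factor 4.
  B : ℚ
  B = + 94080 / 1

  bound : ∀ x y q λ′ → 0ℚ ≤ x → 0ℚ ≤ y → ½ + x ≤ q → 1ℚ + y ≤ λ′ →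
    (+ 5 / 1 + y) * (+ 96 / 1 * ((+ 7 / 1 + x) * (+ 7 / 1 + x))) ≤ B * (q * q) * λ′
  bound x y q λ′ 0≤x 0≤y x≤q y≤λ = begin
    (+ 5 / 1 + y) * (+ 96 / 1 * ((+ 7 / 1 + x) * (+ 7 / 1 + x)))
      -- 94080 / 4 = 96 · 245 and 245 = 5 · 7², so the constant coefficient cancels and all others
      -- are nonnegative.
      ≤⟨ ≤-since (0≤* (nonNegative⁻¹ (+ 96 / 1)) (0≤+ (0≤+ (0≤+ (0≤+
             (0≤* (nonNegative⁻¹ (+ 420 / 1)) 0≤x) (0≤* (nonNegative⁻¹ (+ 240 / 1)) (0≤* 0≤x 0≤x)))
             (0≤* (nonNegative⁻¹ (+ 196 / 1)) 0≤y)) (0≤* (nonNegative⁻¹ (+ 476 / 1)) (0≤* 0≤x 0≤y)))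
             (0≤* (nonNegative⁻¹ (+ 244 / 1)) (0≤* (0≤* 0≤x 0≤x) 0≤y))))
           (expand x y) ⟩
    B * (½ * (1ℚ + x) * (½ * (1ℚ + x))) * (1ℚ + y)
      ≤⟨ *-mono-≤ {b = B * (q * q)} (0≤* 0≤B (0≤* 0≤q 0≤q)) (0≤+ (nonNegative⁻¹ 1ℚ) 0≤y)
           (*-monoˡ {c = B} 0≤B (*-mono-≤ {½ * (1ℚ + x)} {q} {½ * (1ℚ + x)} {q} 0≤q 0≤h h≤q h≤q)) y≤λ ⟩
    B * (q * q) * λ′ ∎
    where
    open ≤-Reasoning
    0≤B : 0ℚ ≤ B
    0≤B = nonNegative⁻¹ B
    0≤h : 0ℚ ≤ ½ * (1ℚ + x)
    0≤h = 0≤* (nonNegative⁻¹ ½) (0≤+ (nonNegative⁻¹ 1ℚ) 0≤x)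
    h≤q : ½ * (1ℚ + x) ≤ q
    h≤q = ≤-since (0≤+ (gap x≤q) (0≤* (nonNegative⁻¹ ½) 0≤x)) (certificate x q)
      where
      certificate : ∀ x q → q - ½ * (1ℚ + x) ≡ (q - (½ + x)) + ½ * x
      certificate = solve-∀ ring
    0≤q : 0ℚ ≤ q
    0≤q = ≤-trans 0≤h h≤q
    expand : ∀ x y → + 94080 / 1 * (½ * (1ℚ + x) * (½ * (1ℚ + x))) * (1ℚ + y) - (+ 5 / 1 + y) * (+ 96 / 1 * ((+ 7 / 1 + x) * (+ 7 / 1 + x))) ≡
      + 96 / 1 * (+ 420 / 1 * x + + 240 / 1 * (x * x) + + 196 / 1 * y + + 476 / 1 * (x * y) + + 244 / 1 * (x * x * y))
    expand = solve-∀ ring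

  conclude : ∀ d p L → Ev (λ k → ι d ≤ B * (seq p k * seq p k) * seq L k) → R.fromℕ d R.≤ R.fromℕ 94080 R.* (p R.* p) R.* L
  conclude d p L (N , d≤) (γ , 0<γ , N′ , below) = contradiction
    (≤-since (0≤+ (gap (d≤ k (ℕ.m≤m⊔n N N′))) (gap (below k (ℕ.m≤n⊔m N N′))))
      (trans (certificate γ (ι d) (B * (seq p k * seq p k) * seq L k)) (cong (λ z → B * (seq p k * seq p k) * seq L k - ι d + (z - (B * (seq p k * seq p k) * seq L k + γ))) (ι-≡ d))))
    (λ γ≤0 → <-irrefl refl (<-≤-trans 0<γ γ≤0))
    where
    k : ℕ
    k = N ℕ.⊔ N′
    certificate : ∀ γ d r → 0ℚ - γ ≡ (r - d) + (d - (r + γ))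
    certificate = solve-∀ ring

  0<B : R.0ℝ R.< R.fromℕ 94080
  0<B = 1ℚ , positive⁻¹ 1ℚ , 0 , λ _ _ → ≤-since (nonNegative⁻¹ (+ 94079 / 1)) refl

  cast : ∀ d j l K M → K ≡ 7 ℕ.+ j → M ≡ 96 ℕ.* (K ℕ.* K) → d ℕ.≤ (5 ℕ.+ l) ℕ.* M →
    ι d ≤ (+ 5 / 1 + ι l) * (+ 96 / 1 * ((+ 7 / 1 + ι j) * (+ 7 / 1 + ι j)))
  cast d j l K M K≡ M≡ d≤ = ≤-trans (ι-mono d≤) (≤-reflexive (trans (ι-* (5 ℕ.+ l) M) (cong₂ _*_ (trans (ι-+ 5 l) (cong (_+ ι l) (ι-≡ 5))) M-cast)))
    where
    K-cast : ι K ≡ + 7 / 1 + ι j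
    K-cast = trans (cong ι K≡) (trans (ι-+ 7 j) (cong (_+ ι j) (ι-≡ 7)))
    M-cast : ι M ≡ + 96 / 1 * ((+ 7 / 1 + ι j) * (+ 7 / 1 + ι j))
    M-cast = trans (cong ι M≡) (trans (ι-* 96 (K ℕ.* K))
      (cong₂ _*_ (ι-≡ 96) (trans (ι-* K K) (cong (λ z → z * z) K-cast))))

  -- Assembling the bound

  module Assemble {n : ℕ} (f : BoolFun n) (ε : R.ℝ) (μ : R.Distribution n)
    (m : Fin n → Bool → R.ℝ) (bounds : ∀ i b → R.0ℝ R.≤ m i b × m i b R.≤ R.1ℝ)
    (sums : ∀ i → m i false R.+ m i true R.≈ R.1ℝ)
    (product : ∀ x → R.pmf μ x R.≈ R.∏ (λ i → m i (lookup x i)))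
    (d : ℕ) (minimal : ∀ t → R.Computes μ (R.fromℕ 8 R.* ε) f t → d ℕ.≤ worstCase t)
    (p L : R.ℝ)
    (e : ℚ) (0<e : 0ℚ < e) (e≤ : e ≤ + 7 / 48)
    (near : Ev (λ k → + 15 / 16 * e ≤ seq ε k × seq ε k ≤ + 17 / 16 * e))
    (l : ℕ) (timeout : 1ℚ ≤ e * ι (2 ℕ.^ (3 ℕ.+ l))) (L-large : Ev (λ k → ι (1 ℕ.+ l) ≤ seq L k)) where

    open Transfer f ε μ m bounds sums product e 0<e (Ev-map (λ _ → proj₁) near)

    -- A leaf is correct, so minimality gives d = 0 and it is enough that the right side is
    -- nonnegative.
    constant-case : ∀ b → (∀ x → f x ≡ b) → Ev (λ k → ι d ≤ B * (seq p k * seq p k) * seq L k)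
    constant-case b f≡b = Ev-map (λ k 1+l≤L → ≤-trans (≤-trans (ι-mono d≤0) (≤-reflexive (ι-≡ 0)))
      (0≤* (0≤* (nonNegative⁻¹ B) (square-nonNeg (seq p k))) (≤-trans (ι-nonNeg (1 ℕ.+ l)) 1+l≤L))) L-large
      where
      d≤0 : d ℕ.≤ 0
      d≤0 = ℕ.≤-trans (minimal (leaf b) (constant-computes b f≡b)) (worstCase≤ {n} (leaf b) 0 (λ _ → ℕ.z≤n))
      square-nonNeg : ∀ q → 0ℚ ≤ q * q
      square-nonNeg q with ≤-total 0ℚ q
      ... | inj₁ 0≤q = 0≤* 0≤q 0≤q
      ... | inj₂ q≤0 = ≤-trans (0≤* (neg-antimono-≤ q≤0) (neg-antimono-≤ q≤0)) (≤-reflexive (negate q))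
        where
        negate : ∀ q → - q * - q ≡ q * q
        negate = solve-∀ ring

    module _ (w : R.Weights n) (feasible : R.Feasible f ε w) (v : R.ℝ) (0<v : R.0ℝ R.< v) (obj≤v : R.objective w R.≤ v)
      (log≤p : R.log₂ v 0<v R.≤ p) where

      -- `p` agrees with log v only as a real, so its terms may fall slightly short of 1 + j; the
      -- loss of ½ is harmless since ½ + j ≥ ½ (1 + j).
      p-large : ∀ j → Ev (λ k → ι (2 ℕ.^ (1 ℕ.+ j)) ≤ seq v k) → Ev (λ k → ½ + ι j ≤ seq p k)
      p-large j v-large = Ev-zip (λ k 2^j≤v log≤ → ≤-since
          (0≤+ (gap log≤) (gap (ratLog-lower (1 ℕ.+ j) (seq v k) k 2^j≤v)))
          (trans (certificate (seq p k) (ι j) (ratLog (seq v k) k))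
            (cong (λ z → seq p k + ½ - ratLog (seq v k) k + (ratLog (seq v k) k - z)) (sym (ι-suc j)))))
        v-large (≤ᴿ⇒≲ (R.log₂ v 0<v) p log≤p ½ (positive⁻¹ ½))
        where
        certificate : ∀ p j r → p - (½ + j) ≡ (p + ½ - r) + (r - (1ℚ + j))
        certificate = solve-∀ ring

      module _ (x y : Input n) (fx : f x ≡ false) (fy : f y ≡ true) where

        ε≤e : Ev (λ k → seq ε k ≤ + 17 / 16 * e)
        ε≤e = Ev-map (λ _ → proj₂) near

        open Shallow f ε w feasible v obj≤v x y fx fy e 0<e e≤ ε≤e

        -- Minimality of `d` against the tree found at a tracked index. The factor 5 + l is two
        -- blocks for the ¼ in `tail` and 3 + l from `timeout`.
        d≤depth : ∀ K M → K ≡ 7 ℕ.+ j → M ≡ 96 ℕ.* (K ℕ.* K) → d ℕ.≤ (5 ℕ.+ l) ℕ.* M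
        d≤depth K M K≡ M≡ = use (find-tree (3 ℕ.+ l) K M K≡ M≡ timeout (state m) tracks)
          where
          use : ∃[ k ] Tracks k × (∃[ t ] (∀ x → queries t x ℕ.≤ (5 ℕ.+ l) ℕ.* M) × 𝔼 (state m k) (err f t) ≤ + 11 / 2 * e) →
            d ℕ.≤ (5 ℕ.+ l) ℕ.* M
          use (k , track , t , depth , error) =
            ℕ.≤-trans (minimal t (computes t k track error)) (worstCase≤ t ((5 ℕ.+ l) ℕ.* M) depth)

        scale : ∃[ j ] Ev (λ k → ι (2 ℕ.^ (1 ℕ.+ j)) ≤ seq v k) ×
          (∀ K M → K ≡ 7 ℕ.+ j → M ≡ 96 ℕ.* (K ℕ.* K) → d ℕ.≤ (5 ℕ.+ l) ℕ.* M)
        scale = j , v-large , d≤depth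

      nonconstant-case : ∀ x y → f x ≡ false → f y ≡ true → Ev (λ k → ι d ≤ B * (seq p k * seq p k) * seq L k)
      nonconstant-case x y fx fy = use (scale x y fx fy)
        where
        use : (∃[ j ] Ev (λ k → ι (2 ℕ.^ (1 ℕ.+ j)) ≤ seq v k) ×
          (∀ K M → K ≡ 7 ℕ.+ j → M ≡ 96 ℕ.* (K ℕ.* K) → d ℕ.≤ (5 ℕ.+ l) ℕ.* M)) →
          Ev (λ k → ι d ≤ B * (seq p k * seq p k) * seq L k)
        use (j , v-large , d≤) = Ev-zip (λ k p≥ L≥ → ≤-trans (cast d j l (7 ℕ.+ j) (96 ℕ.* ((7 ℕ.+ j) ℕ.* (7 ℕ.+ j))) refl refl (d≤ _ _ refl refl))
            (bound (ι j) (ι l) (seq p k) (seq L k) (ι-nonNeg j) (ι-nonNeg l) p≥ (≤-trans (≤-reflexive (sym (ι-suc l))) L≥)))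
          (p-large j v-large) L-large

  complexity-bound : (n : ℕ) → 1 ℕ.≤ n → (f : BoolFun n) →
       (ε : R.ℝ) → R.0ℝ R.≤ ε → ε R.≤ R.fromℚ (+ 1 / 8) →
       (μ : R.Distribution n) → R.IsProduct μ →
       (d : ℕ) → R.IsDistributionalComplexity μ (R.fromℕ 8 R.* ε) f d →
       (p : R.ℝ) → R.IsPartitionBound f ε p →
       (0<ε : R.0ℝ R.< ε) →
       R.fromℕ d R.≤ R.fromℕ 94080 R.* (p R.* p) R.* R.log₂ (R.inv ε 0<ε) (R.inv-pos ε 0<ε)
  complexity-bound n _ f ε _ ε≤⅛ μ (m , bounds , sums , product) d (_ , minimal) p (v , 0<v , ((w , feasible , obj≈v) , _) , p≈log) 0<ε =
    conclude d p L (at-window (ε-window ε 0<ε ε≤⅛))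
    where
    L : R.ℝ
    L = R.log₂ (R.inv ε 0<ε) (R.inv-pos ε 0<ε)
    Claim : Set
    Claim = Ev (λ k → ι d ≤ B * (seq p k * seq p k) * seq L k)
    at-window : (∃[ e ] 0ℚ < e × e ≤ + 7 / 48 × Ev (λ k → + 15 / 16 * e ≤ seq ε k × seq ε k ≤ + 17 / 16 * e)) → Claim
    at-window (e , 0<e , e≤ , near) = at-scale (log-scale e 0<e e≤)
      where
      at-scale : (∃[ l ] 1ℚ ≤ e * ι (2 ℕ.^ (3 ℕ.+ l)) ×
        (∀ x k → + 15 / 16 * e ≤ x → x ≤ + 17 / 16 * e → ι (1 ℕ.+ l) ≤ ratLog (recip x) k)) → Claim
      at-scale (l , timeout , log-large) = by-cases (constant-or-not n f)
        where
        open Assemble f ε μ m bounds sums product d minimal p L e 0<e e≤ near l timeout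
          (Ev-map (λ k (lo , hi) → log-large (seq ε k) k lo hi) near)
        by-cases : (∃[ b ] ∀ x → f x ≡ b) ⊎ (∃[ x ] ∃[ y ] f x ≡ false × f y ≡ true) → Claim
        by-cases (inj₁ (b , f≡b))           = constant-case b f≡b
        by-cases (inj₂ (x , y , fx , fy)) =
          nonconstant-case w feasible v 0<v (proj₁ obj≈v) (proj₂ p≈log) x y fx fy

open import Defs
open import Data.Nat using () renaming (_≤_ to _≤ℕ_)
open import Data.Rational using (_/_)

theorem3 : ∃[ K ] 0ℝ < K ×
    ((n : ℕ) → 1 ≤ℕ n → (f : BoolFun n) →
    (ε : ℝ) → 0ℝ ≤ ε → ε ≤ fromℚ (+ 1 / 8) →
    (μ : Distribution n) → IsProduct μ →
    (d : ℕ) → IsDistributionalComplexity μ (fromℕ 8 * ε) f d →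
    (p : ℝ) → IsPartitionBound f ε p →
    (0<ε : 0ℝ < ε) →
    fromℕ d ≤ K * (p * p) * log₂ (inv ε 0<ε) (inv-pos ε 0<ε))
theorem3 = fromℕ 94080 , Development.0<B , Development.complexity-bound
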